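{- Let $k\geq 5$ and $\lambda=\left\lceil \frac{k^2-7}{2k-7}\right\rceil$. Let $G$ be a loopless multigraph with a function $h:V(G)\to\{0,\ldots,k-1\}$, and suppose $G$ has no subgraph that is a copy of $K_k$, and, if $k=5$, no subgraph that is a copy of $K_2^4$ or a double cycle. If $(H,L)$ is an $h$-cover of $G$ and $G$ is $(H,L)$-minimal, then $\rho_h(G)\leq -2$.
   Context: Potentials: for $v\in V(G)$, $\rho_h(v)=h(v)\lambda+1$ if $h(v)=k-1$; $h(v)\lambda-1$ if $h(v)\in\{2,\ldots,k-2\}$; $h(v)\lambda-2$ if $h(v)\in\{0,1\}$. For distinct $x,y$ joined by $s$ edges, $\rho(xy)=0$ if $s=0$ and $1-(2\lambda+1)s$ if $s\geq1$. $\rho_h(G)=\sum_{x\in V(G)}\rho_h(x)+\sum_{\{x,y\}\subseteq V(G)}\rho(xy)$. A DP-cover of $G$ is a pair $(H,L)$ with $H$ a graph and $L:V(G)\to 2^{V(H)}$ such that $\{L(u)\}$ partitions $V(H)$, each $L(u)$ is independent in $H$, and for $u,v$ joined by exactly $s$ edges the edges of $H$ between $L(u)$ and $L(v)$ form a union of $s$ matchings (empty if $s=0$). An $(H,L)$-coloring is an independent set in $H$ with exactly one vertex from each $L(v)$. An $h$-cover has $|L(v)|\geq h(v)$ for all $v$. $G$ is $(H,L)$-minimal if $G$ has no $(H,L)$-coloring but every proper subgraph $G'$ has an $(H[L(V(G'))],L|_{V(G')})$-coloring. $K_2^4$ is two vertices joined by four parallel edges; a double cycle is a cycle with every edge doubled.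 -}

module Defs where

open import Data.Nat as ℕ using (ℕ; zero; suc; _+_; _*_; _∸_; _≤_; _<_; _≥_)
open import Data.Nat.DivMod using (_/_)
open import Data.Integer as ℤ using (ℤ; +_)
open import Data.Fin as Fin using (Fin; toℕ; inject₁; fromℕ)
open import Data.Bool using (Bool; true; false; if_then_else_)
open import Data.Product using (Σ; ∃; ∃-syntax; _×_; _,_; proj₁; proj₂)
open import Data.Sum using (_⊎_)
open import Data.List using (List; []; _∷_; sum; map; filter; length; concatMap)
open import Data.List.Base using (allFin)
open import Relation.Nullary using (¬_; Dec; yes; no)
open import Relation.Binary.PropositionalEquality using (_≡_; _≢_)
open import Function.Definitions using (Injective)

-- λ = ⌈(k² - 7)/(2k - 7)⌉.  For k ≥ 5 we have 2k - 7 = suc (2k - 8) > 0,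
-- and ⌈a / b⌉ = ⌊(a + b - 1) / b⌋ for b > 0.
lam : ℕ → ℕ
lam k = (k * k ∸ 7 + (2 * k ∸ 8)) / suc (2 * k ∸ 8)

record Multigraph : Set where
  field
    n     : ℕ
    m     : ℕ
    ends  : Fin m → Fin n × Fin n
    loopless : (e : Fin m) → proj₁ (ends e) ≢ proj₂ (ends e)

open Multigraph public

joins? : (G : Multigraph) → Fin (m G) → Fin (n G) → Fin (n G) → Bool
joins? G e x y with ends G e
... | (a , b) with a Fin.≟ x | b Fin.≟ y | a Fin.≟ y | b Fin.≟ x
...   | yes _ | yes _ | _ | _ = true
...   | _ | _ | yes _ | yes _ = true
...   | _ | _ | _ | _ = false

mult : (G : Multigraph) → Fin (n G) → Fin (n G) → ℕ
mult G x y = length (filter (λ e → Data.Bool._≟_ (joins? G e x y) true) (allFin (m G)))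
  where import Data.Bool

HasK : ℕ → Multigraph → Set
HasK k G = Σ (Fin k → Fin (n G)) λ f → Injective _≡_ _≡_ f ×
             ((i j : Fin k) → i ≢ j → 1 ≤ mult G (f i) (f j))

HasK24 : Multigraph → Set
HasK24 G = Σ (Fin (n G)) λ x → Σ (Fin (n G)) λ y → 4 ≤ mult G x y

HasDoubleCycle : Multigraph → Set
HasDoubleCycle G =
  Σ ℕ λ ℓ → 2 ≤ ℓ × Σ (Fin (suc ℓ) → Fin (n G)) λ f →
    Injective _≡_ _≡_ f ×
    ((i : Fin ℓ) → 2 ≤ mult G (f (inject₁ i)) (f (Fin.suc i))) ×
    2 ≤ mult G (f (fromℕ ℓ)) (f Fin.zero)

ρv : (k : ℕ) → ℕ → ℤ
ρv k t with suc t ℕ.≟ k | t ℕ.≤? 1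
... | yes _ | _     = + (t * lam k) ℤ.+ ℤ.1ℤ
... | no _  | yes _ = + (t * lam k) ℤ.- + 2
... | no _  | no _  = + (t * lam k) ℤ.- ℤ.1ℤ

ρe : (k : ℕ) → ℕ → ℤ
ρe k zero = ℤ.0ℤ
ρe k (suc s) = ℤ.1ℤ ℤ.- (+ (2 * lam k + 1) ℤ.* + suc s)

pairs : (N : ℕ) → List (Fin N × Fin N)
pairs N = concatMap (λ x → map (λ y → (x , y))
            (filter (λ y → toℕ x ℕ.<? toℕ y) (allFin N))) (allFin N)

sumℤ : List ℤ → ℤ
sumℤ [] = ℤ.0ℤ
sumℤ (z ∷ zs) = z ℤ.+ sumℤ zs

ρ : (k : ℕ) → (G : Multigraph) → (Fin (n G) → Fin k) → ℤ
ρ k G h = sumℤ (map (λ v → ρv k (toℕ (h v))) (allFin (n G)))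
          ℤ.+ sumℤ (map (λ p → ρe k (mult G (proj₁ p) (proj₂ p))) (pairs (n G)))

-- DP-covers.  L(v) is represented as Fin (size v); the cover graph H has
-- no edges inside any L(v), and for every edge e = xy of G a matching
-- between L(x) and L(y).  The edges of H between L(x) and L(y) are the
-- union of the matchings of the edges joining x and y (empty if none).

record Cover (G : Multigraph) : Set where
  field
    size  : Fin (n G) → ℕ
    match : (e : Fin (m G)) →
            Fin (size (proj₁ (ends G e))) → Fin (size (proj₂ (ends G e))) → Bool
    match-inj₁ : ∀ e a b b' → match e a b ≡ true → match e a b' ≡ true → b ≡ b'
    match-inj₂ : ∀ e a a' b → match e a b ≡ true → match e a' b ≡ true → a ≡ a'

open Cover public

IsHCover : {G : Multigraph} {k : ℕ} → (Fin (n G) → Fin k) → Cover G → Set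
IsHCover {G} h C = (v : Fin (n G)) → toℕ (h v) ≤ size C v

record Subgraph (G : Multigraph) : Set where
  field
    S : Fin (n G) → Bool
    T : Fin (m G) → Bool
    closed₁ : (e : Fin (m G)) → T e ≡ true → S (proj₁ (ends G e)) ≡ true
    closed₂ : (e : Fin (m G)) → T e ≡ true → S (proj₂ (ends G e)) ≡ true

open Subgraph public

whole : (G : Multigraph) → Subgraph G
whole G = record { S = λ _ → true ; T = λ _ → true
                 ; closed₁ = λ _ _ → _≡_.refl ; closed₂ = λ _ _ → _≡_.refl }

Proper : {G : Multigraph} → Subgraph G → Set
Proper {G} G' = (Σ (Fin (n G)) λ v → S G' v ≡ false)
              ⊎ (Σ (Fin (m G)) λ e → T G' e ≡ false)

-- A coloring of the subgraph G' from the cover restricted to G':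
-- one vertex of L(v) for every v ∈ S, independent in the part of H
-- corresponding to G' (the matchings of the edges of T).
Coloring : {G : Multigraph} → Cover G → Subgraph G → Set
Coloring {G} C G' =
  Σ ((v : Fin (n G)) → S G' v ≡ true → Fin (size C v)) λ φ →
    (e : Fin (m G)) → (t : T G' e ≡ true) →
      match C e (φ _ (closed₁ G' e t)) (φ _ (closed₂ G' e t)) ≡ false

Minimal : {G : Multigraph} → Cover G → Set
Minimal {G} C = ¬ Coloring C (whole G) ×
                ((G' : Subgraph G) → Proper G' → Coloring C G')

-- The proof is by the potential method. By induction on X, a set X is colourable if it contains no exceptional
-- subgraph and no set Y with ρ(Y) + b(v) ≤ −2 for all v ∈ Y; the bonus b(v) ∈ {0, 1, 2} strengthens the induction.
-- Suppose X is a counterexample. Colouring a proper subset Y, deleting conflicting colours from the other lists and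
-- applying induction to the residue gives ρ(X) + (λ − 2) e(Y, X ∖ Y) + 4 ≤ ρ(Y). Every vertex has degree at least
-- h(v); those with equality are called low, and any colouring of the rest of X leaves on a set of low vertices a
-- list cover that is tight for the degrees. Hence a 2-connected set of low vertices is regular, and by Lovász's
-- argument it is complete or a cycle. It cannot be (k − 1)-regular, as it would be exceptional or of small potential.
-- If it is (k − 2)-regular, then either deleting one colour at an outside neighbour keeps X ∖ D uncolourable, or it
-- is a K_{k−1} whose vertices have one outside neighbour each; then joining two of these by an edge that
-- forbids every pair of colours they can take makes X ∖ D uncolourable, and the sets so obtained contradict the
-- inequality above. So the low vertices satisfy a Gallai-type bound, and discharging along the edges that leave them
-- makes the potential of X too small.
module Submission where

open import Data.Nat as ℕ using (ℕ; zero; suc; z≤n; s≤s)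
import Data.Nat.Properties as ℕ
import Data.Nat.DivMod as ℕ
open import Data.Nat.Tactic.RingSolver using () renaming (solve to solveℕ)
open import Data.Nat.Induction using (<-wellFounded)
open import Induction.WellFounded using (Acc; acc)
open import Data.Integer
  using (ℤ; +_; -[1+_]; _+_; _*_; _-_; -_; _≤_; 0ℤ; 1ℤ; +≤+; -≤+; _≤?_; +[1+_])
open import Data.Integer.Properties
  using (+-mono-≤; +-monoʳ-≤; +-monoˡ-≤; ≤-refl; ≤-trans; ≤-reflexive;
         *-monoˡ-≤-nonNeg; *-cancelˡ-≤-pos; +-identityˡ; +-identityʳ;
         *-zeroʳ; +-comm; *-comm; +-0-commutativeMonoid; drop‿+≤+; pos-*; +-injective;
         ≤-antisym; *-cancelˡ-≡; ≰⇒>; i<j⇒suc[i]≤j)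
open import Data.Integer.Tactic.RingSolver using (solve)
import Algebra.Properties.CommutativeMonoid.Sum +-0-commutativeMonoid as Sum
open import Data.Fin as Fin using (Fin; zero; suc; toℕ)
open import Data.Fin.Properties using (any?; all?; toℕ-injective)
import Data.Fin.Properties as Fin
open import Data.Bool using (Bool; true; false; not; _∧_; _∨_; if_then_else_)
import Data.Bool as Bool
open import Data.List.Base using (List; []; _∷_; _++_; length; map; filter; concatMap; tabulate; allFin)
open import Data.List.Properties using (map-++)
open import Data.Product using (∃; _×_; _,_; proj₁; proj₂)
open import Data.Sum using (_⊎_; inj₁; inj₂)
open import Data.Empty using (⊥; ⊥-elim)
open import Data.Unit using (tt)
open import Function using (_∘_; case_of_)
open import Function.Definitions using (Injective)
open import Relation.Nullary using (¬_; Dec; yes; no; does)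
open import Relation.Nullary.Decidable using (decidable-stable; map′; _×-dec_; _→-dec_; ¬?; _⊎-dec_; dec-true; dec-false)
open import Relation.Binary.PropositionalEquality
  using (_≡_; _≢_; refl; sym; trans; cong; cong₂; subst; subst₂)

-- The bonus has its origin in the corrections of the vertex potential. Lowering `h v` from k - 1 to
-- k - 2 drops the correction from 1 to -1, so an induction that only excludes sets of potential at
-- most -2 loses too much whenever lists are shortened; the bonus at the new value makes up for it,
-- and its values are chosen for `P-gain`. At the end the bonus is dropped again: a minimal
-- uncolourable graph has the least potential among its nonempty vertex sets, so any set of
-- potential at most -2 gives the bound. Of the matchings only a degree condition is kept: a colour
-- has at most as many conflicts towards a vertex as there are parallel edges. This class is closed
-- under adding an edge with any partial matching, and the induction quantifies over graph,
-- conflicts, lists and `h` in order to use that. Beyond λ ≥ 6, the value of λ enters only through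
-- `quadratic`, used for high vertices; the resulting bound is an equality for h = k - 1 and degree
-- k. Many existence statements hold only under double negation. This suffices, because integer
-- inequalities and colourability are decidable.

infixr 6 _⊕_
infixr 7 _⋆_

_⊕_ : ∀ {a b c d} → a ≤ b → c ≤ d → a + c ≤ b + d
_⊕_ = +-mono-≤

_⋆_ : ∀ n {a b} → a ≤ b → + n * a ≤ + n * b
n ⋆ p = *-monoˡ-≤-nonNeg (+ n) p

-- Linear arithmetic: a ≤ b follows from x ≤ y when b − a = y − x.
fit : ∀ {a b x y} → x ≤ y → b + x ≡ a + y → a ≤ b
fit {a} {b} {x} {y} p q = subst₂ _≤_ (undo a x) (undo b x)
  (+-monoˡ-≤ (- x) (≤-trans (+-monoʳ-≤ a p) (≤-reflexive (sym q))))
  where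
  undo : ∀ a x → a + x + - x ≡ a
  undo a x = solve (a ∷ x ∷ [])

clash : ∀ n {x y} → x ≤ y → x ≡ y + + suc n → ⊥
clash n {x} {y} p refl with fit {+ suc n} {0ℤ} p (eq (+ suc n) y)
  where
  eq : ∀ s y → 0ℤ + (y + s) ≡ s + y
  eq s y = solve (s ∷ y ∷ [])
... | +≤+ ()

0≤+ : ∀ n → 0ℤ ≤ + n
0≤+ n = +≤+ z≤n

0≤* : ∀ {a b} → 0ℤ ≤ a → 0ℤ ≤ b → 0ℤ ≤ a * b
0≤* {+ a} {+ b} _ _ = subst (0ℤ ≤_) (pos-* a b) (0≤+ _)

scale : ∀ {a b c} → 0ℤ ≤ c → a ≤ b → c * a ≤ c * b
scale {c = + c} _ p = *-monoˡ-≤-nonNeg (+ c) p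

unscale : ∀ {a b c} → 1ℤ ≤ c → c * a ≤ c * b → a ≤ b
unscale {a} {b} {+[1+ c ]} _ p = *-cancelˡ-≤-pos a b +[1+ c ] p
unscale {c = + zero} (+≤+ ())

above : ∀ {a b} → ¬ a ≤ b → b + 1ℤ ≤ a
above {a} {b} p = subst (_≤ a) (+-comm 1ℤ b) (i<j⇒suc[i]≤j (≰⇒> p))

stable : ∀ {a b} → ¬ ¬ a ≤ b → a ≤ b
stable {a} {b} = decidable-stable (a ≤? b)

-- A case distinction on an undecided proposition is harmless when the goal is stable; it is applied
-- to the existence of cuts.
cases : ∀ {Q A : Set} → (¬ ¬ Q → Q) → (A → Q) → (¬ A → Q) → Q
cases s f g = s λ nq → nq (g (nq ∘ f))

does⇒ : ∀ {A : Set} (d : Dec A) → does d ≡ true → A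
does⇒ (yes a) _ = a

tf : ∀ {b : Bool} → b ≡ true → b ≡ false → ⊥
tf refl ()

≢true : ∀ {b : Bool} → ¬ b ≡ true → b ≡ false
≢true {true} p = ⊥-elim (p refl)
≢true {false} p = refl

≢false : ∀ {b : Bool} → ¬ b ≡ false → b ≡ true
≢false {true} p = refl
≢false {false} p = ⊥-elim (p refl)

∧-intro : ∀ {a b} → a ≡ true → b ≡ true → a ∧ b ≡ true
∧-intro refl refl = refl

∧-left : ∀ {a b} → a ∧ b ≡ true → a ≡ true
∧-left {true} _ = refl

∧-right : ∀ {a b} → a ∧ b ≡ true → b ≡ true
∧-right {true} p = p

not-intro : ∀ {a} → a ≡ false → not a ≡ true
not-intro refl = refl

not-elim : ∀ {a} → not a ≡ true → a ≡ false
not-elim {false} _ = refl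

-- Multiplication by an indicator, in a form that computes on a known Boolean. A sum over a subset
-- is a full sum of such terms.
on : Bool → ℤ → ℤ
on true x = x
on false x = 0ℤ

on-mono : ∀ b {x y} → (b ≡ true → x ≤ y) → on b x ≤ on b y
on-mono true p = p refl
on-mono false p = ≤-refl

on-cong : ∀ b {x y} → (b ≡ true → x ≡ y) → on b x ≡ on b y
on-cong true p = p refl
on-cong false p = refl

on-+ : ∀ b x y → on b (x + y) ≡ on b x + on b y
on-+ true x y = refl
on-+ false x y = refl

on-* : ∀ b c x → on b (c * x) ≡ c * on b x
on-* true c x = refl
on-* false c x = sym (*-zeroʳ c)

on-on : ∀ a b x → on a (on b x) ≡ on b (on a x)
on-on true b x = refl
on-on false true x = refl
on-on false false x = refl

on-∧ : ∀ a b x → on (a ∧ b) x ≡ on a (on b x)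
on-∧ true b x = refl
on-∧ false b x = refl

on-zero : ∀ b → on b 0ℤ ≡ 0ℤ
on-zero true = refl
on-zero false = refl

on-nonneg : ∀ b {x} → 0ℤ ≤ x → 0ℤ ≤ on b x
on-nonneg true p = p
on-nonneg false p = ≤-refl

-- Finite sums, counting, and exhaustive search

module _ where
  private
    variable
      m n : ℕ

  -- Opaque, so that sums are compared argument by argument.
  opaque
    ∑ : (Fin n → ℤ) → ℤ
    ∑ = Sum.sum

    ∑-nil : (f : Fin 0 → ℤ) → ∑ f ≡ 0ℤ
    ∑-nil f = refl

    ∑-cons : (f : Fin (suc n) → ℤ) → ∑ f ≡ f zero + ∑ (f ∘ suc)
    ∑-cons f = refl

    ∑-cong : {f g : Fin n → ℤ} → (∀ i → f i ≡ g i) → ∑ f ≡ ∑ g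
    ∑-cong = Sum.sum-cong-≗

    ∑-+ : (f g : Fin n → ℤ) → ∑ (λ i → f i + g i) ≡ ∑ f + ∑ g
    ∑-+ = Sum.∑-distrib-+

    ∑-swap : (f : Fin m → Fin n → ℤ) → ∑ (λ i → ∑ (f i)) ≡ ∑ (λ j → ∑ (λ i → f i j))
    ∑-swap = Sum.∑-comm

    ∑-mono : {f g : Fin n → ℤ} → (∀ i → f i ≤ g i) → ∑ f ≤ ∑ g
    ∑-mono {zero} p = ≤-refl
    ∑-mono {suc n} p = p zero ⊕ ∑-mono (λ i → p (suc i))

    -- Room to spare at one index carries over to the sum. In this way the bonus of a single vertex
    -- enters an estimate over a whole set.
    ∑-gain : {f g : Fin n → ℤ} {c : ℤ} → (∀ i → f i ≤ g i) → ∀ j → f j + c ≤ g j → ∑ f + c ≤ ∑ g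
    ∑-gain {f = f} {c = c} p zero q =
      ≤-trans (≤-reflexive (swap (f zero) (∑ (f ∘ suc)) c)) (q ⊕ ∑-mono (λ i → p (suc i)))
      where
      swap : ∀ a b c → a + b + c ≡ (a + c) + b
      swap a b c = solve (a ∷ b ∷ c ∷ [])
    ∑-gain {f = f} {c = c} p (suc j) q =
      ≤-trans (≤-reflexive (assoc (f zero) (∑ (f ∘ suc)) c)) (p zero ⊕ ∑-gain (λ i → p (suc i)) j q)
      where
      assoc : ∀ a b c → a + b + c ≡ a + (b + c)
      assoc a b c = solve (a ∷ b ∷ c ∷ [])

    ∑-zero : {f : Fin n → ℤ} → (∀ i → f i ≡ 0ℤ) → ∑ f ≡ 0ℤ
    ∑-zero {zero} p = refl
    ∑-zero {suc n} p = cong₂ _+_ (p zero) (∑-zero (λ i → p (suc i)))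

    ∑-* : ∀ c (f : Fin n → ℤ) → ∑ (λ i → c * f i) ≡ c * ∑ f
    ∑-* {zero} c f = sym (*-zeroʳ c)
    ∑-* {suc n} c f = trans (cong (λ s → c * f zero + s) (∑-* c (f ∘ suc))) (dist c (f zero) (∑ (f ∘ suc)))
      where
      dist : ∀ c a b → c * a + c * b ≡ c * (a + b)
      dist c a b = solve (c ∷ a ∷ b ∷ [])

    ∑-nonneg : {f : Fin n → ℤ} → (∀ i → 0ℤ ≤ f i) → 0ℤ ≤ ∑ f
    ∑-nonneg {zero} p = ≤-refl
    ∑-nonneg {suc n} p = p zero ⊕ ∑-nonneg (λ i → p (suc i))

    ∑-term : {f : Fin n → ℤ} → (∀ i → 0ℤ ≤ f i) → ∀ j → f j ≤ ∑ f
    ∑-term {suc n} {f} p zero = subst (_≤ ∑ f) (+-identityʳ (f zero)) (≤-refl {f zero} ⊕ ∑-nonneg (λ i → p (suc i)))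
    ∑-term {suc n} {f} p (suc j) = subst (_≤ ∑ f) (+-identityˡ (f (suc j))) (p zero ⊕ ∑-term (λ i → p (suc i)) j)

    ∑-point : ∀ v (f : Fin n → ℤ) → ∑ (λ w → on (does (v Fin.≟ w)) (f w)) ≡ f v
    ∑-point {suc n} zero f = trans (cong (λ s → f zero + s) (∑-zero {n} {λ _ → 0ℤ} λ _ → refl)) (+-identityʳ (f zero))
    ∑-point {suc n} (suc v) f = trans (+-identityˡ _) (∑-point {n} v (f ∘ suc))

  on-∑ : ∀ b (f : Fin n → ℤ) → on b (∑ f) ≡ ∑ (λ i → on b (f i))
  on-∑ true f = refl
  on-∑ {n} false f = sym (∑-zero {n} (λ _ → refl))

  count : (Fin n → Bool) → ℤ
  count f = ∑ (λ i → on (f i) 1ℤ)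

  count-mono : {f g : Fin n → Bool} → (∀ i → f i ≡ true → g i ≡ true) → count f ≤ count g
  count-mono {f = f} {g} p = ∑-mono λ i → lem (f i) (g i) (p i)
    where
    lem : ∀ a b → (a ≡ true → b ≡ true) → on a 1ℤ ≤ on b 1ℤ
    lem true b p rewrite p refl = ≤-refl
    lem false b p = on-nonneg b (0≤+ 1)

  -- The pigeonhole principle by which colours are chosen.
  count-excess : {f g : Fin n → Bool} → count g + 1ℤ ≤ count f → ∃ λ i → f i ≡ true × g i ≡ false
  count-excess {f = f} {g} p with any? (λ i → (f i Bool.≟ true) ×-dec (g i Bool.≟ false))
  ... | yes r = r
  ... | no r = ⊥-elim (clash 0 (≤-trans p (count-mono sub)) refl)
    where
    sub : ∀ i → f i ≡ true → g i ≡ true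
    sub i fi with g i in eq
    ... | true = refl
    ... | false = ⊥-elim (r (i , fi , eq))

  count-some : {f : Fin n → Bool} → 1ℤ ≤ count f → ∃ λ i → f i ≡ true
  count-some {n} {f} p with count-excess {f = f} {λ _ → false} (subst (λ z → z + 1ℤ ≤ count f) (sym (∑-zero {n} λ _ → refl)) p)
  ... | i , fi , _ = i , fi

  some : (Fin n → Bool) → Bool
  some {zero} f = false
  some {suc n} f = f zero ∨ some (f ∘ suc)

  some-false : (f : Fin n → Bool) → some f ≡ false → ∀ i → f i ≡ false
  some-false f p zero with f zero
  ... | false = refl
  some-false f p (suc i) with f zero
  ... | false = some-false (f ∘ suc) p i

  some-none : (f : Fin n → Bool) → (∀ i → f i ≡ false) → some f ≡ false
  some-none {zero} f p = refl
  some-none {suc n} f p rewrite p zero = some-none (f ∘ suc) (λ i → p (suc i))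

  opaque
    unfolding ∑

    some-≤ : (f : Fin n → Bool) → on (some f) 1ℤ ≤ count f
    some-≤ {zero} f = ≤-refl
    some-≤ {suc n} f with f zero
    ... | true = ≤-refl {1ℤ} ⊕ ∑-nonneg (λ i → on-nonneg (f (suc i)) (0≤+ 1))
    ... | false = subst (on (some (f ∘ suc)) 1ℤ ≤_) (sym (+-identityˡ _)) (some-≤ (f ∘ suc))

  -- Under a double negation finitely many propositions can be decided at once, without a decision
  -- procedure for any of them.
  decideAll : {P : Fin n → Set} → ¬ ¬ (∀ i → Dec (P i))
  decideAll {zero} c = c λ ()
  decideAll {suc n} {P} c = decideAll {n} {λ i → P (suc i)} λ d →
    (λ (nz : ¬ ¬ Dec (P zero)) → nz λ z → c λ { zero → z ; (suc i) → d i })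
    (λ nd → nd (no λ p → nd (yes p)))

  -- The enumeration rebuilds an assignment value by value, so it meets a given one only up to
  -- pointwise equality; hence the second hypothesis.
  search : ∀ {K} {P : (Fin n → Fin K) → Set} → (∀ f → Dec (P f)) →
    (∀ f g → (∀ i → f i ≡ g i) → P f → P g) → Dec (∃ P)
  search {zero} {K} {P} d ext = map′ (λ p → empty , p) (λ (f , p) → ext f empty (λ ()) p) (d empty)
    where
    empty : Fin zero → Fin K
    empty ()
  search {suc n} {K} {P} d ext =
    map′ (λ (c , f , p) → cons c f , p)
         (λ (f , p) → f zero , f ∘ suc , ext f (cons (f zero) (f ∘ suc)) (λ { zero → refl ; (suc i) → refl }) p)
         (any? λ c → search (λ f → d (cons c f))
           (λ f g e → ext (cons c f) (cons c g) λ { zero → refl ; (suc i) → e i }))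
    where
    cons : Fin K → (Fin n → Fin K) → Fin (suc n) → Fin K
    cons c f zero = c
    cons c f (suc i) = f i

-- Vertex sets: partitions, sums, cardinalities, induction on proper subsets

Sub : ℕ → Set
Sub N = Fin N → Bool

module _ {N : ℕ} where

  infix 4 _∈_ _⊆_ _⊂_
  infixl 6 _∖_ _⊝_

  _∈_ : Fin N → Sub N → Set
  v ∈ X = X v ≡ true

  _⊆_ : Sub N → Sub N → Set
  X ⊆ Y = ∀ v → v ∈ X → v ∈ Y

  Nonempty : Sub N → Set
  Nonempty X = ∃ λ v → v ∈ X

  _⊂_ : Sub N → Sub N → Set
  Y ⊂ X = Y ⊆ X × ∃ λ v → v ∈ X × Y v ≡ false

  ⊆-trans : ∀ {X Y Z} → X ⊆ Y → Y ⊆ Z → X ⊆ Z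
  ⊆-trans p q v = q v ∘ p v

  _∖_ : Sub N → Sub N → Sub N
  (X ∖ Y) v = X v ∧ not (Y v)

  opaque
    ⁅_⁆ : Fin N → Sub N
    ⁅ v ⁆ w = does (v Fin.≟ w)

    ∈⁅⁆ : ∀ v → v ∈ ⁅ v ⁆
    ∈⁅⁆ v = dec-true (v Fin.≟ v) refl

    ⁅⁆-≡ : ∀ {v w} → w ∈ ⁅ v ⁆ → v ≡ w
    ⁅⁆-≡ {v} {w} p with v Fin.≟ w
    ... | yes e = e

    ∉⁅⁆ : ∀ {v w} → v ≢ w → ⁅ v ⁆ w ≡ false
    ∉⁅⁆ {v} {w} = dec-false (v Fin.≟ w)

    Σₛ-point : ∀ v (f : Fin N → ℤ) → ∑ (λ w → on (⁅ v ⁆ w) (f w)) ≡ f v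
    Σₛ-point = ∑-point

  _⊝_ : Sub N → Fin N → Sub N
  X ⊝ v = X ∖ ⁅ v ⁆

  ⁅⁆-≢ : ∀ {v w} → ⁅ v ⁆ w ≡ false → v ≢ w
  ⁅⁆-≢ {v} p refl = tf (∈⁅⁆ v) p

  ∖-intro : ∀ X Y {v} → v ∈ X → Y v ≡ false → v ∈ X ∖ Y
  ∖-intro X Y p q = ∧-intro p (not-intro q)

  ∖-left : ∀ X Y {v} → v ∈ X ∖ Y → v ∈ X
  ∖-left X Y p = ∧-left p

  ∖-right : ∀ X Y {v} → v ∈ X ∖ Y → Y v ≡ false
  ∖-right X Y {v} p = not-elim (∧-right {X v} p)

  ⊝-intro : ∀ X {v w} → w ∈ X → v ≢ w → w ∈ X ⊝ v
  ⊝-intro X {v} p q = ∖-intro X ⁅ v ⁆ p (∉⁅⁆ q)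

  ⊝-⊆ : ∀ X v → X ⊝ v ⊆ X
  ⊝-⊆ X v w p = ∧-left p

  ⊝-≢ : ∀ X {v w} → w ∈ X ⊝ v → v ≢ w
  ⊝-≢ X {v} p = ⁅⁆-≢ (∖-right X ⁅ v ⁆ p)

  -- The admissible rows of the membership table of a partition. Since `Part` is pointwise data of
  -- this kind, partitions are regrouped by pattern matching.
  data Split : Bool → Bool → Bool → Set where
    left : Split true true false
    right : Split true false true
    none : Split false false false

  Part : Sub N → Sub N → Sub N → Set
  Part X A C = ∀ v → Split (X v) (A v) (C v)

  part-∖ : ∀ {X A} → A ⊆ X → Part X A (X ∖ A)
  part-∖ {X} {A} s v with X v | A v | s v
  ... | true | true | _ = left
  ... | true | false | _ = right
  ... | false | false | _ = none
  ... | false | true | p with p refl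
  ...   | ()

  part-⊝ : ∀ X {v} → v ∈ X → Part X ⁅ v ⁆ (X ⊝ v)
  part-⊝ X {v} p = part-∖ λ w q → subst (_∈ X) (⁅⁆-≡ q) p

  part-sym : ∀ {X A C} → Part X A C → Part X C A
  part-sym p v with p v
  ... | q = flip q
    where
    flip : ∀ {x a c} → Split x a c → Split x c a
    flip left = right
    flip right = left
    flip none = none

  part-∨ : ∀ {A C} → (∀ v → v ∈ C → A v ≡ false) → Part (λ v → A v ∨ C v) A C
  part-∨ {A} {C} p v with A v | C v | p v
  ... | true | false | _ = left
  ... | false | true | _ = right
  ... | false | false | _ = none
  ... | true | true | q with q refl
  ...   | ()

  part-merge : ∀ {X Y Z Y′ Z′ Y″} → Part X Y Z → Part Z Y′ Z′ → Part Y″ Y Y′ → Part X Y″ Z′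
  part-merge p q r v = merge (p v) (q v) (r v)
    where
    merge : ∀ {x y z y′ z′ y″} → Split x y z → Split z y′ z′ → Split y″ y y′ → Split x y″ z′
    merge left none left = left
    merge right left right = left
    merge right right none = right
    merge none none none = none

  part-all : ∀ {X A C} → Part X A C → ¬ Nonempty C → ∀ v → X v ≡ A v
  part-all p ne v = lem (p v) (≢true λ e → ne (v , e))
    where
    lem : ∀ {x a c} → Split x a c → c ≡ false → x ≡ a
    lem left _ = refl
    lem none _ = refl

  module _ {X A C : Sub N} (p : Part X A C) where

    part-left : A ⊆ X
    part-left v q with X v | A v | C v | p v
    ... | true | true | false | left = refl

    part-right : C ⊆ X
    part-right v q with X v | A v | C v | p v
    ... | true | false | true | right = refl

    part-disjoint : ∀ {v} → v ∈ A → C v ≡ false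
    part-disjoint {v} q with X v | A v | C v | p v
    ... | true | true | false | left = refl

    part-either : ∀ {v} → v ∈ X → (v ∈ A) ⊎ (v ∈ C)
    part-either {v} q with X v | A v | C v | p v
    ... | true | true | false | left = inj₁ refl
    ... | true | false | true | right = inj₂ refl

  Σₛ : Sub N → (Fin N → ℤ) → ℤ
  Σₛ X f = ∑ (λ v → on (X v) (f v))

  Σₛ-cong : ∀ X {f g} → (∀ v → v ∈ X → f v ≡ g v) → Σₛ X f ≡ Σₛ X g
  Σₛ-cong X p = ∑-cong λ v → on-cong (X v) (p v)

  Σₛ-mono : ∀ X {f g} → (∀ v → v ∈ X → f v ≤ g v) → Σₛ X f ≤ Σₛ X g
  Σₛ-mono X p = ∑-mono λ v → on-mono (X v) (p v)

  Σₛ-gain : ∀ X {f g} {c} → (∀ v → v ∈ X → f v ≤ g v) → ∀ {u} → u ∈ X → f u + c ≤ g u → Σₛ X f + c ≤ Σₛ X g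
  Σₛ-gain X {f} {g} {c} p {u} q r = ∑-gain (λ v → on-mono (X v) (p v)) u
    (subst (λ b → on b (f u) + c ≤ on b (g u)) (sym q) r)

  Σₛ-+ : ∀ X f g → Σₛ X (λ v → f v + g v) ≡ Σₛ X f + Σₛ X g
  Σₛ-+ X f g = trans (∑-cong λ v → on-+ (X v) (f v) (g v)) (∑-+ _ _)

  Σₛ-* : ∀ X c f → Σₛ X (λ v → c * f v) ≡ c * Σₛ X f
  Σₛ-* X c f = trans (∑-cong λ v → on-* (X v) c (f v)) (∑-* c _)

  Σₛ-nonneg : ∀ X {f} → (∀ v → v ∈ X → 0ℤ ≤ f v) → 0ℤ ≤ Σₛ X f
  Σₛ-nonneg X {f} p = ∑-nonneg λ v → lem v (X v) refl
    where
    lem : ∀ v b → X v ≡ b → 0ℤ ≤ on b (f v)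
    lem v true e = p v e
    lem v false e = ≤-refl

  Σₛ-term : ∀ X {f} → (∀ v → 0ℤ ≤ f v) → ∀ {u} → u ∈ X → f u ≤ Σₛ X f
  Σₛ-term X {f} p {u} q = subst (λ b → on b (f u) ≤ Σₛ X f) q (∑-term (λ v → on-nonneg (X v) (p v)) u)

  Σₛ-part : ∀ {X A C} → Part X A C → ∀ f → Σₛ X f ≡ Σₛ A f + Σₛ C f
  Σₛ-part p f = trans (∑-cong λ v → lem (p v) (f v)) (∑-+ _ _)
    where
    lem : ∀ {x a c} → Split x a c → ∀ z → on x z ≡ on a z + on c z
    lem left z = sym (+-identityʳ z)
    lem right z = sym (+-identityˡ z)
    lem none z = refl

  Σₛ-remove : ∀ X {v} → v ∈ X → ∀ f → Σₛ X f ≡ f v + Σₛ (X ⊝ v) f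
  Σₛ-remove X {v} p f = trans (Σₛ-part (part-⊝ X p) f) (cong (λ z → z + Σₛ (X ⊝ v) f) (Σₛ-point v f))

  Σₛ-∑ : ∀ {n} X (f : Fin N → Fin n → ℤ) → Σₛ X (λ v → ∑ (f v)) ≡ ∑ (λ c → Σₛ X (λ v → f v c))
  Σₛ-∑ X f = trans (∑-cong λ v → on-∑ (X v) (f v)) (∑-swap λ v c → on (X v) (f v c))

  Σₛ-swap : ∀ A C (f : Fin N → Fin N → ℤ) → Σₛ A (λ a → Σₛ C (f a)) ≡ Σₛ C (λ c → Σₛ A (λ a → f a c))
  Σₛ-swap A C f = trans (Σₛ-∑ A (λ a c → on (C c) (f a c)))
    (∑-cong λ c → trans (∑-cong λ a → on-on (A a) (C c) (f a c)) (sym (on-∑ (C c) λ a → on (A a) (f a c))))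

  Σₛ-subset : ∀ {A X} → A ⊆ X → ∀ {f} → (∀ v → 0ℤ ≤ f v) → Σₛ A f ≤ Σₛ X f
  Σₛ-subset {A} {X} s {f} p = subst₂ _≤_ (+-identityʳ _) (sym (Σₛ-part (part-∖ s) f))
    (≤-refl {Σₛ A f} ⊕ Σₛ-nonneg (X ∖ A) (λ v _ → p v))

  Σₛ-pair : ∀ X {a b} → a ∈ X → b ∈ X → a ≢ b → ∀ {f} → (∀ w → w ∈ X → a ≢ w → b ≢ w → f w ≡ 0ℤ) → Σₛ X f ≡ f a + f b
  Σₛ-pair X {a} {b} aX bX a≢b {f} p = trans (Σₛ-remove X aX f) (cong (λ z → f a + z)
    (trans (Σₛ-remove (X ⊝ a) (⊝-intro X bX a≢b) f) (trans (cong (λ z → f b + z) rest) (+-identityʳ (f b)))))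
    where
    rest : Σₛ (X ⊝ a ⊝ b) f ≡ 0ℤ
    rest = trans (Σₛ-cong (X ⊝ a ⊝ b) λ w q → p w (∧-left (∧-left {(X ⊝ a) w} q)) (⊝-≢ X (∖-left (X ⊝ a) ⁅ b ⁆ q)) (⊝-≢ (X ⊝ a) q))
      (∑-zero λ w → on-zero ((X ⊝ a ⊝ b) w))

  card : Sub N → ℤ
  card X = Σₛ X λ _ → 1ℤ

  Σₛ-at : ∀ X v (f : Fin N → ℤ) → Σₛ X (λ w → on (⁅ v ⁆ w) (f w)) ≡ on (X v) (f v)
  Σₛ-at X v f = trans (∑-cong λ w → on-on (X w) (⁅ v ⁆ w) (f w)) (Σₛ-point v λ w → on (X w) (f w))

  Σₛ-on : ∀ X b (f : Fin N → ℤ) → Σₛ X (λ w → on b (f w)) ≡ on b (Σₛ X f)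
  Σₛ-on X b f = trans (∑-cong λ w → on-on (X w) b (f w)) (sym (on-∑ b λ w → on (X w) (f w)))

  Σₛ-const : ∀ X c → Σₛ X (λ _ → c) ≡ c * card X
  Σₛ-const X c = trans (Σₛ-cong X λ _ _ → one c) (Σₛ-* X c λ _ → 1ℤ)
    where
    one : ∀ c → c ≡ c * 1ℤ
    one c = solve (c ∷ [])

  card-remove : ∀ X {v} → v ∈ X → card X ≡ 1ℤ + card (X ⊝ v)
  card-remove X p = Σₛ-remove X p _

  card-pos : ∀ X {v} → v ∈ X → 1ℤ ≤ card X
  card-pos X p = Σₛ-term X (λ _ → 0≤+ 1) p

  card-some : ∀ X → 1ℤ ≤ card X → Nonempty X
  card-some X p = count-some p

  Σₛ-some : ∀ X {f} → 1ℤ ≤ Σₛ X f → ∃ λ v → v ∈ X × 1ℤ ≤ f v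
  Σₛ-some X {f} p with any? (λ v → (X v Bool.≟ true) ×-dec (1ℤ ≤? f v))
  ... | yes r = r
  ... | no n = ⊥-elim (clash 0 (≤-trans p (≤-trans (Σₛ-mono X λ v vX → below (above λ q → n (v , vX , q)))
      (≤-reflexive (∑-zero λ v → on-zero (X v))))) refl)
    where
    below : ∀ {a} → a + 1ℤ ≤ 1ℤ → a ≤ 0ℤ
    below {a} q = fit q (solve (a ∷ []))

count-one : ∀ {n} {f : Fin n → Bool} → count f ≤ 1ℤ → ∀ {i j} → f i ≡ true → f j ≡ true → i ≡ j
count-one {f = f} p {i} {j} fi fj = decidable-stable (i Fin.≟ j) λ ne → clash 0
  (≤-trans (≤-refl {1ℤ} ⊕ card-pos (f ⊝ i) (⊝-intro f fj ne)) (≤-trans (≤-reflexive (sym (card-remove f fi))) p)) refl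

count-≤1 : ∀ {n} {f : Fin n → Bool} → (∀ i j → f i ≡ true → f j ≡ true → i ≡ j) → count f ≤ 1ℤ
count-≤1 {n} {f} u with any? (λ i → f i Bool.≟ true)
... | no e = ≤-trans (≤-reflexive (∑-zero λ i → cong (λ b → on b 1ℤ) (≢true λ p → e (i , p)))) (0≤+ 1)
... | yes (i , fi) = ≤-reflexive (trans (card-remove f fi) (cong (λ z → 1ℤ + z) (∑-zero λ j → cong (λ b → on b 1ℤ)
        (≢true λ p → ⊝-≢ f p (u i j fi (∧-left p))))))

sizeₛ : ∀ {N} → Sub N → ℕ
sizeₛ {zero} X = 0
sizeₛ {suc N} X = (if X zero then 1 else 0) ℕ.+ sizeₛ (X ∘ suc)

sizeₛ-⊆ : ∀ {N} {Y X : Sub N} → Y ⊆ X → sizeₛ Y ℕ.≤ sizeₛ X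
sizeₛ-⊆ {zero} p = z≤n
sizeₛ-⊆ {suc N} {Y} {X} p with Y zero | X zero | p zero
... | true | true | _ = s≤s (sizeₛ-⊆ (λ v → p (suc v)))
... | true | false | q with q refl
...   | ()
sizeₛ-⊆ {suc N} p | false | true | _ = ℕ.m≤n⇒m≤1+n (sizeₛ-⊆ (λ v → p (suc v)))
sizeₛ-⊆ {suc N} p | false | false | _ = sizeₛ-⊆ (λ v → p (suc v))

sizeₛ-⊂ : ∀ {N} {Y X : Sub N} → Y ⊂ X → sizeₛ Y ℕ.< sizeₛ X
sizeₛ-⊂ {suc N} {Y} {X} (p , zero , q , r) rewrite q | r = s≤s (sizeₛ-⊆ (λ v → p (suc v)))
sizeₛ-⊂ {suc N} {Y} {X} (p , suc v , q , r)
  with Y zero | X zero | p zero | sizeₛ-⊂ {N} {Y ∘ suc} {X ∘ suc} ((λ w → p (suc w)) , v , q , r)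
... | true | true | _ | s = s≤s s
... | true | false | t | s with t refl
...   | ()
sizeₛ-⊂ {suc N} (p , suc v , q , r) | false | true | _ | s = ℕ.m≤n⇒m≤1+n s
sizeₛ-⊂ {suc N} (p , suc v , q , r) | false | false | _ | s = s

⊂-rec : ∀ {N} (P : Sub N → Set) → (∀ X → (∀ Y → Y ⊂ X → P Y) → P X) → ∀ X → P X
⊂-rec P step X = go X (<-wellFounded (sizeₛ X))
  where
  go : ∀ X → Acc ℕ._<_ (sizeₛ X) → P X
  go X (acc r) = step X λ Y s → go Y (r (sizeₛ-⊂ s))

⊝-⊂ : ∀ {N} (X : Sub N) {v} → v ∈ X → X ⊝ v ⊂ X
⊝-⊂ X {v} p = ⊝-⊆ X v , v , p , lem
  where
  lem : X v ∧ not (⁅ v ⁆ v) ≡ false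
  lem rewrite ∈⁅⁆ v with X v
  ... | true = refl
  ... | false = refl

-- Multigraphs, degrees and connectivity

record Graph (N : ℕ) : Set where
  field
    m : Fin N → Fin N → ℕ
    m-sym : ∀ v w → m v w ≡ m w v
    m-irr : ∀ v → m v v ≡ 0

module Graphs {N : ℕ} (g : Graph N) where
  open Graph g public

  infix 4 _~_

  μ : Fin N → Fin N → ℤ
  μ v w = + m v w

  _~_ : Fin N → Fin N → Set
  v ~ w = m v w ≢ 0

  μ-sym : ∀ v w → μ v w ≡ μ w v
  μ-sym v w = cong +_ (m-sym v w)

  ~-sym : ∀ {v w} → v ~ w → w ~ v
  ~-sym {v} {w} p q = p (trans (m-sym v w) q)

  ~-≢ : ∀ {v w} → v ~ w → v ≢ w
  ~-≢ {v} p refl = p (m-irr v)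

  ~-pos : ∀ {v w} → v ~ w → 1ℤ ≤ μ v w
  ~-pos {v} {w} p with m v w
  ... | zero = ⊥-elim (p refl)
  ... | suc _ = +≤+ (s≤s z≤n)

  pos-≢ : ∀ {v w} → 1ℤ ≤ μ v w → v ≢ w
  pos-≢ {v} p refl = clash 0 (≤-trans p (≤-reflexive (cong +_ (m-irr v)))) refl

  μ-zero : ∀ {v w} → μ v w ≤ 0ℤ → m v w ≡ 0
  μ-zero (+≤+ p) = ℕ.n≤0⇒n≡0 p

  deg : Sub N → Fin N → ℤ
  deg X v = Σₛ X (μ v)

  deg-nonneg : ∀ X v → 0ℤ ≤ deg X v
  deg-nonneg X v = Σₛ-nonneg X λ w _ → 0≤+ (m v w)

  deg-part : ∀ {X A C} → Part X A C → ∀ v → deg X v ≡ deg A v + deg C v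
  deg-part p v = Σₛ-part p (μ v)

  deg-⊆ : ∀ {A X} → A ⊆ X → ∀ v → deg A v ≤ deg X v
  deg-⊆ s v = Σₛ-subset s λ w → 0≤+ (m v w)

  deg-term : ∀ X {v w} → w ∈ X → μ v w ≤ deg X v
  deg-term X {v} p = Σₛ-term X (λ w → 0≤+ (m v w)) p

  deg-remove : ∀ X {w} → w ∈ X → ∀ v → deg X v ≡ μ v w + deg (X ⊝ w) v
  deg-remove X p v = Σₛ-remove X p (μ v)

  deg-⊝ : ∀ X {v} → v ∈ X → deg X v ≡ deg (X ⊝ v) v
  deg-⊝ X {v} p = trans (deg-remove X p v) (trans (cong (λ z → + z + deg (X ⊝ v) v) (m-irr v)) (+-identityˡ _))

  record Cut (T : Sub N) : Set where
    constructor cut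
    field
      {A C} : Sub N
      part : Part T A C
      neA : Nonempty A
      neC : Nonempty C
      apart : ∀ {a c} → a ∈ A → c ∈ C → m a c ≡ 0

  -- Connectivity as the absence of a cut: the empty set counts as connected, and the property is
  -- applied by exhibiting a forbidden cut.
  Conn : Sub N → Set
  Conn T = ¬ Cut T

  -- A single vertex and a pair of adjacent vertices qualify, so splitting along cuts and cut
  -- vertices always ends in such sets.
  record TwoConn (T : Sub N) : Set where
    field
      conn : Conn T
      conn⊝ : ∀ v → v ∈ T → Conn (T ⊝ v)

  open TwoConn public

  -- Otherwise the vertices with and without the property would form a cut. This takes the place of
  -- induction along paths.
  spread : ∀ {T} → Conn T → (f : Sub N) → ∀ {u} → u ∈ T → u ∈ f →
    (∀ {v w} → v ∈ T → w ∈ T → v ~ w → v ∈ f → w ∈ f) → T ⊆ f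
  spread {T} conn f {u} uT uf step v vT with f v in eq
  ... | true = refl
  ... | false = ⊥-elim (conn (cut (part-∖ {X = T} {A = λ w → T w ∧ f w} (λ w → ∧-left)) (u , ∧-intro uT uf)
          (v , ∧-intro vT (not-intro (out v vT eq))) apart))
    where
    out : ∀ w → w ∈ T → f w ≡ false → T w ∧ f w ≡ false
    out w p q rewrite p = q
    apart : ∀ {a c} → T a ∧ f a ≡ true → T c ∧ not (T c ∧ f c) ≡ true → m a c ≡ 0
    apart {a} {c} p q with m a c ℕ.≟ 0
    ... | yes e = e
    ... | no n with step (∧-left p) (∧-left q) n (∧-right {T a} p)
    ...   | fc = ⊥-elim (tf (∧-intro (∧-left {T c} q) fc) (not-elim (∧-right {T c} q)))

-- Colouring from lists: residual lists, greedy colouring, tight assignments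

record Conflicts {N} (g : Graph N) (K : ℕ) : Set where
  open Graph g
  field
    R : Fin N → Fin N → Fin K → Fin K → Bool
    R-sym : ∀ v w a b → R v w a b ≡ R w v b a
    R-deg : ∀ v w a → count (R v w a) ≤ + m v w

Lists : ℕ → ℕ → Set
Lists N K = Fin N → Fin K → Bool

len : ∀ {N K} → Lists N K → Fin N → ℤ
len l v = count (l v)

module Colouring {N K : ℕ} {g : Graph N} (Γ : Conflicts g (suc K)) where
  open Graphs g public
  open Conflicts Γ public

  record Colours (X : Sub N) (l : Lists N (suc K)) (φ : Fin N → Fin (suc K)) : Set where
    constructor colours
    field
      listed : ∀ v → v ∈ X → l v (φ v) ≡ true
      proper : ∀ v w → v ∈ X → w ∈ X → R v w (φ v) (φ w) ≡ false

  open Colours public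

  Colourable : Sub N → Lists N (suc K) → Set
  Colourable X l = ∃ (Colours X l)

  colours? : ∀ X l φ → Dec (Colours X l φ)
  colours? X l φ = map′ (λ (p , q) → colours p q) (λ c → listed c , proper c)
    (all? (λ v → (X v Bool.≟ true) →-dec (l v (φ v) Bool.≟ true))
      ×-dec all? (λ v → all? (λ w → (X v Bool.≟ true) →-dec ((X w Bool.≟ true) →-dec (R v w (φ v) (φ w) Bool.≟ false)))))

  colours-ext : ∀ X l φ ψ → (∀ v → φ v ≡ ψ v) → Colours X l φ → Colours X l ψ
  colours-ext X l φ ψ e (colours p q) = colours (λ v x → subst (λ c → l v c ≡ true) (e v) (p v x))
    (λ v w x y → subst₂ (λ c d → R v w c d ≡ false) (e v) (e w) (q v w x y))

  colourable? : ∀ X l → Dec (Colourable X l)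
  colourable? X l = search (colours? X l) (colours-ext X l)

  R-none : ∀ {v w} → m v w ≡ 0 → ∀ a b → R v w a b ≡ false
  R-none {v} {w} e a b with R v w a b in eq
  ... | false = refl
  ... | true = ⊥-elim (clash 0 (≤-trans (subst (λ x → on x 1ℤ ≤ count (R v w a)) eq
      (∑-term (λ c → on-nonneg (R v w a c) (0≤+ 1)) b)) (subst (λ z → count (R v w a) ≤ + z) e (R-deg v w a))) refl)

  R-deg′ : ∀ v w b → count (λ a → R v w a b) ≤ μ v w
  R-deg′ v w b = subst₂ _≤_ (∑-cong λ a → cong (λ x → on x 1ℤ) (R-sym w v b a)) (μ-sym w v) (R-deg w v b)

  resid : Sub N → (Fin N → Fin (suc K)) → Lists N (suc K) → Lists N (suc K)
  resid A φ l w c = l w c ∧ not (some λ v → A v ∧ R v w (φ v) c)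

  resid-avoids : ∀ A φ l {w c} → resid A φ l w c ≡ true → ∀ {v} → v ∈ A → R v w (φ v) c ≡ false
  resid-avoids A φ l {w} {c} p {v} q = lem (some-false _ (not-elim (∧-right {l w c} p)) v)
    where
    lem : A v ∧ R v w (φ v) c ≡ false → R v w (φ v) c ≡ false
    lem rewrite q = λ x → x

  resid-intro : ∀ A φ l {w c} → l w c ≡ true → (∀ v → v ∈ A → R v w (φ v) c ≡ false) → resid A φ l w c ≡ true
  resid-intro A φ l {w} {c} p q = ∧-intro p (not-intro (some-none _ lem))
    where
    lem : ∀ v → A v ∧ R v w (φ v) c ≡ false
    lem v with A v in eq
    ... | true = q v eq
    ... | false = refl

  hit : Lists N (suc K) → Fin N → Fin N → Fin (suc K) → ℤ
  hit l v w a = count λ c → l w c ∧ R v w a c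

  hit-≤ : ∀ l v w a → hit l v w a ≤ μ v w
  hit-≤ l v w a = ≤-trans (count-mono λ c p → ∧-right {l w c} p) (R-deg v w a)

  -- A union bound over the coloured vertices. Only conflicts inside the list of `w` are charged;
  -- `reg` needs this precision.
  resid-hit : ∀ A φ l w → len l w ≤ len (resid A φ l) w + Σₛ A (λ v → hit l v w (φ v))
  resid-hit A φ l w = ≤-trans (∑-mono point) (≤-reflexive (trans (∑-+ _ _)
      (cong (λ z → len (resid A φ l) w + z) (sym (Σₛ-∑ A λ v c → on (l w c ∧ R v w (φ v) c) 1ℤ)))))
    where
    bit : ∀ s {x} → on s 1ℤ ≤ x → 1ℤ ≤ on (not s) 1ℤ + x
    bit true {x} p = subst (1ℤ ≤_) (sym (+-identityˡ x)) p
    bit false p = ≤-refl {1ℤ} ⊕ p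
    point : ∀ c → on (l w c) 1ℤ ≤ on (resid A φ l w c) 1ℤ + Σₛ A (λ v → on (l w c ∧ R v w (φ v) c) 1ℤ)
    point c with l w c
    ... | true = bit (some λ v → A v ∧ R v w (φ v) c) (≤-trans (some-≤ _) (≤-reflexive (∑-cong λ v → on-∧ (A v) (R v w (φ v) c) 1ℤ)))
    ... | false = ≤-refl {0ℤ} ⊕ Σₛ-nonneg A λ _ _ → ≤-refl

  resid-len : ∀ A φ l w → len l w ≤ len (resid A φ l) w + deg A w
  resid-len A φ l w = ≤-trans (resid-hit A φ l w) (+-monoʳ-≤ (len (resid A φ l) w)
    (Σₛ-mono A λ v _ → ≤-trans (hit-≤ l v w (φ v)) (≤-reflexive (μ-sym v w))))

  combine : ∀ {X A C} → Part X A C → ∀ {l φ} → Colours A l φ → Colourable C (resid A φ l) → Colourable X l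
  combine {X} {A} {C} part {l} {φ} (colours p q) (ψ , colours p′ q′) = χ , colours good clean
    where
    χ : Fin N → Fin (suc K)
    χ v = if A v then φ v else ψ v
    χ-A : ∀ {v} → v ∈ A → χ v ≡ φ v
    χ-A e rewrite e = refl
    χ-C : ∀ {v} → v ∈ C → χ v ≡ ψ v
    χ-C {v} e rewrite part-disjoint (part-sym part) {v} e = refl
    good : ∀ v → v ∈ X → l v (χ v) ≡ true
    good v x with part-either part x
    ... | inj₁ a rewrite χ-A a = p v a
    ... | inj₂ c rewrite χ-C c = ∧-left (p′ v c)
    mixed : ∀ {v w} → v ∈ A → w ∈ C → R v w (φ v) (ψ w) ≡ false
    mixed a c = resid-avoids A φ l (p′ _ c) a
    clean : ∀ v w → v ∈ X → w ∈ X → R v w (χ v) (χ w) ≡ false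
    clean v w x y with part-either part x | part-either part y
    ... | inj₁ a | inj₁ b rewrite χ-A a | χ-A b = q v w a b
    ... | inj₁ a | inj₂ d rewrite χ-A a | χ-C d = mixed a d
    ... | inj₂ c | inj₁ b rewrite χ-C c | χ-A b = trans (R-sym v w _ _) (mixed b c)
    ... | inj₂ c | inj₂ d rewrite χ-C c | χ-C d = q′ v w c d

  single : ∀ {v l c} → l v c ≡ true → Colours ⁅ v ⁆ l (λ _ → c)
  single {v} {l} {c} p = colours (λ w e → subst (λ w → l w c ≡ true) (⁅⁆-≡ e) p) lem
    where
    lem : ∀ u w → u ∈ ⁅ v ⁆ → w ∈ ⁅ v ⁆ → R u w c c ≡ false
    lem u w e f = subst₂ (λ u w → R u w c c ≡ false) (⁅⁆-≡ {v = v} {w = u} e) (⁅⁆-≡ {v = v} {w = w} f) (R-none (m-irr v) c c)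

  extend : ∀ {X l v} → v ∈ X → ¬ len l v ≤ deg X v → Colourable (X ⊝ v) l → Colourable X l
  extend {X} {l} {v} x big (φ , col) with count-some {f = resid (X ⊝ v) φ l v}
      (room (above big) (subst (λ d → len l v ≤ len (resid (X ⊝ v) φ l) v + d) (sym (deg-⊝ X x)) (resid-len (X ⊝ v) φ l v)))
    where
    room : ∀ {a r d} → d + 1ℤ ≤ a → a ≤ r + d → 1ℤ ≤ r
    room {a} {r} {d} p q = fit (p ⊕ q) (solve (a ∷ r ∷ d ∷ []))
  ... | c , cl = combine (part-sym (part-⊝ X x)) col ((λ _ → c) , single cl)

  -- Degeneracy: a vertex with more colours than edges into the remaining set can be coloured last.
  greedy : ∀ T l → (∀ A → A ⊆ T → Nonempty A → (∀ v → v ∈ A → len l v ≤ deg A v) → ⊥) → Colourable T l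
  greedy T l = ⊂-rec (λ X → (∀ A → A ⊆ X → Nonempty A → (∀ v → v ∈ A → len l v ≤ deg A v) → ⊥) → Colourable X l) step T
    where
    step : ∀ X → (∀ Y → Y ⊂ X → (∀ A → A ⊆ Y → Nonempty A → (∀ v → v ∈ A → len l v ≤ deg A v) → ⊥) → Colourable Y l) →
      (∀ A → A ⊆ X → Nonempty A → (∀ v → v ∈ A → len l v ≤ deg A v) → ⊥) → Colourable X l
    step X rec H with any? (λ v → X v Bool.≟ true)
    ... | no e = (λ _ → zero) , colours (λ v x → ⊥-elim (e (v , x))) λ v w x → ⊥-elim (e (v , x))
    ... | yes ne = decidable-stable (colourable? X l) λ nc → H X (λ _ x → x) ne λ v x → stable λ big →
      nc (extend x big (rec (X ⊝ v) (⊝-⊂ X x) λ A s → H A (⊆-trans s (⊝-⊆ X v))))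

  -- The obstructions of the degree version of list colouring; uncoloured sets of low vertices carry
  -- them.
  record Tight (T : Sub N) (l : Lists N (suc K)) : Set where
    constructor tight
    field
      stuck : ¬ Colourable T l
      enough : ∀ v → v ∈ T → deg T v ≤ len l v

  open Tight public

  -- Colouring `A` takes from a vertex at most as many colours as it takes edges, so list lengths
  -- stay at or above the degrees.
  tight-rest : ∀ {T A C l φ} → Tight T l → Part T A C → Colours A l φ → Tight C (resid A φ l)
  tight-rest {T} {A} {C} {l} {φ} t part col = tight (λ c → stuck t (combine part col c)) λ v c →
    lem (≤-trans (enough t v (part-right part v c)) (resid-len A φ l v)) (deg-part part v)
    where
    lem : ∀ {d a c r} → d ≤ r + a → d ≡ a + c → c ≤ r
    lem {d} {a} {c} {r} p refl = fit p (solve (a ∷ c ∷ r ∷ []))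

  -- Greedy colouring fails only at a set `A` whose lists do not exceed its inner degrees. If `A`
  -- misses `v`, the lower bound of tightness leaves no edge from `A` to the rest, and this is a
  -- cut.
  exact : ∀ {T l} → Conn T → Tight T l → ∀ {v} → v ∈ T → len l v ≤ deg T v
  exact {T} {l} conn t {v} vT = stable λ big → stuck t (greedy T l λ A s ne small → lem big A s ne small)
    where
    sum0 : ∀ {x a c} → x ≡ a + c → x ≤ a → c ≤ 0ℤ
    sum0 {a = a} {c} refl p = fit p (solve (a ∷ c ∷ []))
    lem : ¬ len l v ≤ deg T v → ∀ A → A ⊆ T → Nonempty A → (∀ v → v ∈ A → len l v ≤ deg A v) → ⊥
    lem big A s ne small with A v in eq
    ... | true = big (≤-trans (small v eq) (deg-⊆ s v))
    ... | false = conn (cut (part-∖ s) ne (v , ∖-intro T A vT eq) λ {a} {c} p q →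
      μ-zero (≤-trans (deg-term (T ∖ A) q) (sum0 (deg-part (part-∖ s) a) (≤-trans (enough t a (s a p)) (small a p)))))

count-gain : ∀ {n} {f g : Fin n → Bool} → (∀ i → f i ≡ true → g i ≡ true) →
  ∀ {j} → f j ≡ false → g j ≡ true → count f + 1ℤ ≤ count g
count-gain {f = f} {g} p {j} q r = ∑-gain (λ i → on-mono′ (f i) (g i) (p i)) j
  (subst₂ (λ a b → on a 1ℤ + 1ℤ ≤ on b 1ℤ) (sym q) (sym r) ≤-refl)
  where
  on-mono′ : ∀ a b → (a ≡ true → b ≡ true) → on a 1ℤ ≤ on b 1ℤ
  on-mono′ true b p rewrite p refl = ≤-refl
  on-mono′ false b p = on-nonneg b (0≤+ 1)

-- Tight assignments: multiplicities and conflicts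

module Bricks {N K : ℕ} {g : Graph N} (Γ : Conflicts g (suc K)) where
  open Colouring Γ public

  nonempty-list : ∀ {T l} → Tight T l → ∀ {v w} → v ∈ T → w ∈ T → v ~ w → ∃ λ c → l v c ≡ true
  nonempty-list {T} t {v} p q e = count-some (≤-trans (~-pos e) (≤-trans (deg-term T q) (enough t v p)))

  -- The list of `w` is at least its degree in `T` before, and by `exact` at most its degree in
  -- `T ⊝ v` after `v` receives `c`. So `c` must take the full `μ v w` colours from it.
  reg : ∀ {T l} → Tight T l → ∀ {v w c} → v ∈ T → w ∈ T → v ≢ w → Conn (T ⊝ v) → l v c ≡ true → μ v w ≤ hit l v w c
  reg {T} {l} t {v} {w} {c} p q ne conn lc =
    lem (μ-sym w v) (subst (_≤ len l w) (deg-remove T p w) (enough t w q))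
      (subst (λ z → len l w ≤ len (resid ⁅ v ⁆ (λ _ → c) l) w + z) (Σₛ-point v (λ u → hit l u w c)) (resid-hit ⁅ v ⁆ (λ _ → c) l w))
      (exact conn (tight-rest t (part-⊝ T p) (single lc)) (⊝-intro T q ne))
    where
    lem : ∀ {a a′ d n r h} → a ≡ a′ → a + d ≤ n → n ≤ r + h → r ≤ d → a′ ≤ h
    lem {a} {_} {d} {n} {r} {h} refl x y z = fit (x ⊕ y ⊕ z) (solve (a ∷ d ∷ n ∷ r ∷ h ∷ []))

  -- Double counting of the conflicts between the two lists: a colour at `v` has at least `μ v w` of
  -- them by `reg`, a colour at `w` has at most that many.
  len-mono : ∀ {T l} → Tight T l → ∀ {v w} → v ∈ T → w ∈ T → v ~ w → Conn (T ⊝ v) → len l v ≤ len l w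
  len-mono {T} {l} t {v} {w} p q e conn = unscale (~-pos e)
    (≤-trans (≤-reflexive (sym (Σₛ-* (l v) (μ v w) λ _ → 1ℤ)))
    (≤-trans (Σₛ-mono (l v) λ c lc → ≤-trans (≤-reflexive (one (μ v w))) (≤-trans (reg t p q (~-≢ e) conn lc) (≤-reflexive (∑-cong λ d → on-∧ (l w d) (R v w c d) 1ℤ))))
    (≤-trans (≤-reflexive (Σₛ-swap (l v) (l w) λ c d → on (R v w c d) 1ℤ))
    (≤-trans (Σₛ-mono (l w) λ d _ → ≤-trans (∑-mono λ c → drop (l v c) (R v w c d)) (≤-trans (R-deg′ v w d) (≤-reflexive (sym (one (μ v w))))))
    (≤-reflexive (Σₛ-* (l w) (μ v w) λ _ → 1ℤ))))))
    where
    one : ∀ a → a * 1ℤ ≡ a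
    one a = solve (a ∷ [])
    drop : ∀ a b → on a (on b 1ℤ) ≤ on b 1ℤ
    drop true b = ≤-refl
    drop false b = on-nonneg b (0≤+ 1)

  regular : ∀ {T l} → TwoConn T → Tight T l → ∀ {u v} → u ∈ T → v ∈ T → deg T v ≡ deg T u
  regular {T} {l} two t {u} {v} p q = does-≡ (spread (conn two) (λ w → does (deg T w ℤ≟ deg T u)) p (dec-true (deg T u ℤ≟ deg T u) refl)
      (λ {v} {w} x y e f → dec-true (deg T w ℤ≟ deg T u) (trans (≤-antisym (step y x (~-sym e)) (step x y e)) (does-≡ f))) v q)
    where
    open import Data.Integer using () renaming (_≟_ to _ℤ≟_)
    does-≡ : ∀ {a b} → does (a ℤ≟ b) ≡ true → a ≡ b
    does-≡ {a} {b} f with a ℤ≟ b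
    ... | yes e = e
    step : ∀ {v w} → v ∈ T → w ∈ T → v ~ w → deg T v ≤ deg T w
    step {v} {w} x y e = ≤-trans (enough t v x) (≤-trans (len-mono t x y e (conn⊝ two v x)) (exact (conn two) t y))

  -- Take conflicting colours `c` at `w` and `a` at `v`. Each of the `μ v u` listed colours of `u`
  -- in conflict with `a` must also conflict with `c`. Otherwise it survives the choice of `c` at
  -- `w`, has by `reg` a full set of conflicts in the remaining list of `v`, and conflicts in
  -- addition with `a`, which has left that list.
  mult-≤ : ∀ {T l} → Tight T l → ∀ {v u w} → v ∈ T → u ∈ T → w ∈ T → v ≢ u → u ≢ w → v ~ w →
    Conn (T ⊝ v) → Conn (T ⊝ w) → Conn (T ⊝ w ⊝ u) → μ v u ≤ μ w u
  mult-≤ {T} {l} t {v} {u} {w} vT uT wT v≢u u≢w vw cv cw cwu with nonempty-list t wT vT (~-sym vw)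
  ... | c , lc with count-some (≤-trans (~-pos (~-sym vw)) (reg t wT vT (~-≢ (~-sym vw)) cw lc))
  ...   | a , la = ≤-trans (reg t vT uT v≢u cv (∧-left la))
      (≤-trans (count-mono λ d ld → ≢false λ free → clash 0 (twice d ld free) refl) (R-deg w u c))
    where
    l₁ : Lists N (suc K)
    l₁ = resid ⁅ w ⁆ (λ _ → c) l
    t₁ : Tight (T ⊝ w) l₁
    t₁ = tight-rest t (part-⊝ T wT) (single lc)
    gone : l₁ v a ≡ false
    gone = ≢true λ e → tf (∧-right {l v a} la) (resid-avoids ⁅ w ⁆ (λ _ → c) l {v} {a} e (∈⁅⁆ w))
    twice : ∀ d → l u d ∧ R v u a d ≡ true → R w u c d ≡ false → μ u v + 1ℤ ≤ μ u v
    twice d ld free = ≤-trans (reg t₁ (⊝-intro T uT (u≢w ∘ sym)) (⊝-intro T vT (~-≢ (~-sym vw))) (v≢u ∘ sym) cwu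
        (resid-intro ⁅ w ⁆ (λ _ → c) l {u} {d} (∧-left ld) λ z e → subst (λ z → R z u c d ≡ false) (⁅⁆-≡ e) free) ⊕ ≤-refl {1ℤ})
      (≤-trans (count-gain {f = λ x → l₁ v x ∧ R u v d x} {g = R u v d} (λ x → ∧-right {l₁ v x}) {a} (cong (_∧ R u v d a) gone) (trans (R-sym u v d a) (∧-right {l u d} ld))) (R-deg u v d))

  -- Two colours available at a pendant vertex exclude the same colours of its neighbour:
  -- otherwise only their common conflicts need to be deleted there.
  twins : ∀ {T l} → Tight T l → ∀ {x y} → x ∈ T → y ∈ T → x ≢ y → deg T x ≡ μ x y → Conn (T ⊝ x) →
    ∀ {a a′ b} → l x a ≡ true → l x a′ ≡ true → l y b ≡ true → R x y a b ≡ true → R x y a′ b ≡ true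
  twins {T} {l} t {x} {y} xT yT x≢y pendant conn {a} {a′} {b} la la′ lb ab = ≢false λ nr → clash 0
      (≤-trans (need ⊕ ≤-refl {1ℤ}) (≤-trans (count-gain (λ c p → ∧-left (∧-right {l y c} p)) {b} (out nr) ab) (R-deg x y a))) refl
    where
    both : Fin (suc K) → Bool
    both c = R x y a c ∧ R x y a′ c
    J : ℤ
    J = count λ c → l y c ∧ both c
    out : R x y a′ b ≡ false → l y b ∧ both b ≡ false
    out nr rewrite lb | ab | nr = refl
    l₂ : Lists N (suc K)
    l₂ v c = l v c ∧ not (⁅ y ⁆ v ∧ both c)
    bits : ∀ p s z → on p 1ℤ ≤ on (p ∧ not (s ∧ z)) 1ℤ + on (p ∧ z) 1ℤ
    bits false s z = ≤-refl
    bits true true true = ≤-refl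
    bits true true false = ≤-refl
    bits true false true = +≤+ (s≤s z≤n)
    bits true false false = ≤-refl
    lose : len l y ≤ len l₂ y + J
    lose = ≤-trans (∑-mono λ c → bits (l y c) (⁅ y ⁆ y) (both c)) (≤-reflexive (∑-+ _ _))
    far : ∀ v → v ∈ T → y ≢ v → m v x ≡ 0
    far v vT ne = trans (m-sym v x) (μ-zero (≤-trans (deg-term (T ⊝ y) (⊝-intro T vT ne)) (rest (deg-remove T yT x) pendant)))
      where
      rest : ∀ {d e s} → d ≡ e + s → d ≡ e → s ≤ 0ℤ
      rest {e = e} {s} p q = fit (≤-reflexive (trans (sym p) q)) (solve (e ∷ s ∷ []))
    J≤ : J ≤ μ y x
    J≤ = ≤-trans (count-mono λ c p → ∧-left (∧-right {l y c} p)) (≤-trans (R-deg x y a) (≤-reflexive (μ-sym x y)))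
    extend₂ : Colourable (T ⊝ x) l₂ → ⊥
    extend₂ (φ , colours p q) = stuck t (combine (part-sym (part-⊝ T xT)) (colours (λ v e → ∧-left (p v e)) q) pick)
      where
      attempt : ∀ {e} → l x e ≡ true → R x y e (φ y) ≡ false → Colourable ⁅ x ⁆ (resid (T ⊝ x) φ l)
      attempt {e} le fr = (λ _ → e) , single (resid-intro (T ⊝ x) φ l {x} {e} le λ v vT → lem v vT)
        where
        lem : ∀ v → v ∈ T ⊝ x → R v x (φ v) e ≡ false
        lem v vT with y Fin.≟ v
        ... | yes refl = trans (R-sym y x _ _) fr
        ... | no ne = R-none (far v (∧-left vT) ne) _ _
      pick : Colourable ⁅ x ⁆ (resid (T ⊝ x) φ l)
      pick with R x y a (φ y) in e₁ | R x y a′ (φ y) in e₂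
      ... | false | _ = attempt la e₁
      ... | true | false = attempt la′ e₂
      ... | true | true = ⊥-elim (tf (p y (⊝-intro T yT x≢y)) (lem (l y (φ y))))
        where
        lem : ∀ z → z ∧ not (⁅ y ⁆ y ∧ both (φ y)) ≡ false
        lem z rewrite ∈⁅⁆ y | e₁ | e₂ with z
        ... | true = refl
        ... | false = refl
    t₂ : Tight (T ⊝ x) l₂
    t₂ = tight extend₂ λ v vT → room v vT
      where
      at-y : ∀ {d a n r j} → d ≡ a + r → d ≤ n → j ≤ a → ∀ {n′} → n ≤ n′ + j → r ≤ n′
      at-y {_} {a} {n} {r} {j} refl p q {n′} s = fit (p ⊕ q ⊕ s) (solve (a ∷ n ∷ r ∷ j ∷ n′ ∷ []))
      room′ : ∀ v → v ∈ T ⊝ x → Dec (y ≡ v) → deg (T ⊝ x) v ≤ len l₂ v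
      room′ v vT (yes refl) = at-y (deg-remove T xT y) (enough t y yT) J≤ lose
      room′ v vT (no ne) = ≤-trans (deg-⊆ (⊝-⊆ T x) v) (≤-trans (enough t v (∧-left vT)) (count-mono λ c lc → ∧-intro lc (lem c)))
        where
        lem : ∀ c → not (⁅ y ⁆ v ∧ both c) ≡ true
        lem c rewrite ∉⁅⁆ ne = refl
      room : ∀ v → v ∈ T ⊝ x → deg (T ⊝ x) v ≤ len l₂ v
      room v vT = room′ v vT (y Fin.≟ v)
    need : μ x y ≤ J
    need = lem (μ-sym y x) (deg-remove T xT y) (enough t y yT) lose (exact conn t₂ (⊝-intro T yT x≢y))
      where
      lem : ∀ {a a′ d r n n′ j} → a ≡ a′ → d ≡ a + r → d ≤ n → n ≤ n′ + j → n′ ≤ r → a′ ≤ j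
      lem {a} {_} {_} {r} {n} {n′} {j} refl refl p q s = fit (p ⊕ q ⊕ s) (solve (a ∷ r ∷ n ∷ n′ ∷ j ∷ []))

  -- Suppose `x` has more edges to `y` than to `u`. Fix `b` at `y` and a colour `a` at `x`
  -- compatible with `b`. If some `c` at `u` were compatible with `a`, then after choosing `c` some
  -- colour in conflict with `b` would also survive at `x`; now `x` is pendant at `y`, and `twins`
  -- makes `a` conflict with `b`. So all colours of `u` conflict with `a`, too many for `μ u x`
  -- edges, as `u` and `x` have the same degree.
  path-mult-≤ : ∀ {T l} → TwoConn T → Tight T l → ∀ {u x y} → u ∈ T → x ∈ T → y ∈ T → u ≢ y → x ~ u → x ~ y → m u y ≡ 0 →
    deg T x ≡ μ x u + μ x y → Conn (T ⊝ u ⊝ x) → μ x y ≤ μ x u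
  path-mult-≤ {T} {l} two t {u} {x} {y} uT xT yT u≢y xu xy uy degx conn-ux = stable λ big → main (above big)
    where
    main : μ x u + 1ℤ ≤ μ x y → ⊥
    main big with nonempty-list t yT xT (~-sym xy)
    ... | b , lb with count-excess {f = l x} {g = λ a → R x y a b}
           (lem₁ (R-deg′ x y b) (~-pos xu) degx (enough t x xT))
      where
      lem₁ : ∀ {r p q d n} → r ≤ p → 1ℤ ≤ q → d ≡ q + p → d ≤ n → r + 1ℤ ≤ n
      lem₁ {r} {p} {q} {_} {n} s o refl z = fit (s ⊕ o ⊕ z) (solve (r ∷ p ∷ q ∷ n ∷ []))
    ... | a , la , ab = clash 0 (≤-trans (lem₂ (~-pos xy) degx (μ-sym x u) (≤-trans (≤-reflexive (regular two t uT xT)) (enough t u uT)))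
            (≤-trans (count-mono λ c lc → ≢false λ nr → tf (step2 c lc a la nr) ab) (R-deg′ u x a))) refl
      where
      lem₂ : ∀ {p q q′ d n} → 1ℤ ≤ p → d ≡ q + p → q ≡ q′ → d ≤ n → q′ + 1ℤ ≤ n
      lem₂ {p} {q} {_} {_} {n} o refl refl z = fit (o ⊕ z) (solve (p ∷ q ∷ n ∷ []))
      step2 : ∀ c → l u c ≡ true → ∀ a → l x a ≡ true → R u x c a ≡ false → R x y a b ≡ true
      step2 c lc a la ca with count-excess {f = λ a → l x a ∧ R y x b a} {g = R u x c}
          (≤-trans (≤-trans (R-deg u x c) (≤-reflexive (μ-sym u x)) ⊕ ≤-refl {1ℤ}) (≤-trans big (≤-trans (≤-reflexive (μ-sym x y)) (reg t yT xT (~-≢ (~-sym xy)) (conn⊝ two y yT) lb))))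
      ... | a₀ , q , r = twins t₁ (⊝-intro T xT (~-≢ (~-sym xu))) (⊝-intro T yT u≢y) (~-≢ xy) (lem₃ {q = μ x u} (deg-remove T uT x) degx) conn-ux
            {a₀} {a} {b} (intro x (∧-left q) r) (intro x la ca) (intro y lb (R-none uy c b)) (trans (R-sym x y a₀ b) (∧-right {l x a₀} q))
        where
        l₁ : Lists N (suc K)
        l₁ = resid ⁅ u ⁆ (λ _ → c) l
        t₁ : Tight (T ⊝ u) l₁
        t₁ = tight-rest t (part-⊝ T uT) (single lc)
        intro : ∀ z {e} → l z e ≡ true → R u z c e ≡ false → l₁ z e ≡ true
        intro z {e} p q = resid-intro ⁅ u ⁆ (λ _ → c) l {z} {e} p λ v f → subst (λ v → R v z c e ≡ false) (⁅⁆-≡ f) q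
        lem₃ : ∀ {d q s p} → d ≡ q + s → d ≡ q + p → s ≡ p
        lem₃ {d} {q} {s} {p} e f = trans (sym (undo q s)) (trans (cong (λ z → - q + z) (trans (sym e) f)) (undo q p))
          where
          undo : ∀ q s → - q + (q + s) ≡ s
          undo q s = solve (q ∷ s ∷ [])

-- Structure of 2-connected graphs: complete graphs and cycles

module Blocks {N : ℕ} (g : Graph N) where
  open Graphs g

  closed-⊥ : ∀ {S} → Conn S → ∀ {B} → B ⊆ S → Nonempty B → ∀ {z} → z ∈ S → B z ≡ false →
    (∀ {b c} → b ∈ B → c ∈ S → B c ≡ false → m b c ≡ 0) → ⊥
  closed-⊥ {S} conn {B} s ne {z} zS zB h = conn (cut (part-∖ s) ne (z , ∖-intro S B zS zB)
    λ p q → h p (∖-left S B q) (∖-right S B q))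

  -- The deleted vertex can be put on the side of its only possible neighbour, so a cut of `S ⊝ x`
  -- would extend to `S`.
  pendant-conn : ∀ {S x y} → Conn S → x ∈ S → (∀ {c} → c ∈ S → x ~ c → c ≡ y) → Conn (S ⊝ x)
  pendant-conn {S} {x} {y} conn xS only (cut {A} {C} part (a , aA) (c , cC) apart) with A y in eq
  ... | true = closed-⊥ conn {C} (⊆-trans (part-right part) (⊝-⊆ S x)) (c , cC) (∖-left S ⁅ x ⁆ (part-left part a aA)) (part-disjoint part aA) lem
    where
    lem : ∀ {b d} → b ∈ C → d ∈ S → C d ≡ false → m b d ≡ 0
    lem {b} {d} bC dS dC with x Fin.≟ d | m b d ℕ.≟ 0
    ... | _ | yes e = e
    ... | yes refl | no ne with only (⊝-⊆ S x b (part-right part b bC)) (~-sym ne)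
    ...   | refl = ⊥-elim (tf bC (part-disjoint part eq))
    lem {b} {d} bC dS dC | no x≢d | no ne with part-either part (⊝-intro S dS x≢d)
    ...   | inj₁ dA = trans (m-sym b d) (apart dA bC)
    ...   | inj₂ dC′ = ⊥-elim (tf dC′ dC)
  ... | false = closed-⊥ conn {A} (⊆-trans (part-left part) (⊝-⊆ S x)) (a , aA) (∖-left S ⁅ x ⁆ (part-right part c cC)) (part-disjoint (part-sym part) cC) lem
    where
    lem : ∀ {b d} → b ∈ A → d ∈ S → A d ≡ false → m b d ≡ 0
    lem {b} {d} bA dS dA with x Fin.≟ d | m b d ℕ.≟ 0
    ... | _ | yes e = e
    ... | yes refl | no ne with only (⊝-⊆ S x b (part-left part b bA)) (~-sym ne)
    ...   | refl = ⊥-elim (tf bA eq)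
    lem {b} {d} bA dS dA | no x≢d | no ne with part-either part (⊝-intro S dS x≢d)
    ...   | inj₁ dA′ = ⊥-elim (tf dA′ dA)
    ...   | inj₂ dC = apart bA dC

  Complete : Sub N → Set
  Complete T = ∀ {u w} → u ∈ T → w ∈ T → u ≢ w → u ~ w

  record TwoNeighbours (T : Sub N) (v : Fin N) : Set where
    constructor two-neighbours
    field
      {a b} : Fin N
      a∈ : a ∈ T
      b∈ : b ∈ T
      a~ : v ~ a
      b~ : v ~ b
      a≢b : a ≢ b
      a≁b : m a b ≡ 0
      only : ∀ {c} → c ∈ T → v ~ c → (c ≡ a) ⊎ (c ≡ b)

  -- Lovász's argument for Brooks' theorem: a 2-connected graph in which two neighbours of a vertex
  -- are adjacent unless they separate is complete or a cycle.
  module _ {T : Sub N} (two : TwoConn T)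
    (link : ∀ {v u w} → v ∈ T → u ∈ T → w ∈ T → v ~ u → v ~ w → u ≢ w → Conn (T ⊝ w ⊝ u) → u ~ w) where

    private
      -- The vertex belongs to a separating pair.
      Breaks : Fin N → Set
      Breaks u = ∃ λ x → x ∈ T ⊝ u × Cut (T ⊝ u ⊝ x)

      inside : ∀ {u x y} → y ∈ T ⊝ u ⊝ x → y ∈ T × u ≢ y × x ≢ y
      inside {u} {x} {y} p = ∧-left (∧-left {(T ⊝ u) y} p) , ⊝-≢ T (∖-left (T ⊝ u) ⁅ x ⁆ p) , ⊝-≢ (T ⊝ u) p

      -- This plays the role of an inner vertex of an end block of `T ⊝ u`. There is a neighbour `v`
      -- of `u` in `A`, as otherwise `x` alone would cut off `A`. If deleting `v` disconnects
      -- `T ⊝ u`, the side without `x` lies properly inside `A` and is separated by `v`, so the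
      -- search continues there.
      end : ∀ {u} → u ∈ T → ∀ A {x C} → x ∈ T ⊝ u → Part (T ⊝ u ⊝ x) A C → Nonempty A →
        (∀ {a c} → a ∈ A → c ∈ C → m a c ≡ 0) → ¬ ¬ ∃ λ v → v ∈ A × u ~ v × Conn (T ⊝ u ⊝ v)
      end {u} uT = ⊂-rec (λ A → ∀ {x C} → x ∈ T ⊝ u → Part (T ⊝ u ⊝ x) A C → Nonempty A →
        (∀ {a c} → a ∈ A → c ∈ C → m a c ≡ 0) → ¬ ¬ ∃ λ v → v ∈ A × u ~ v × Conn (T ⊝ u ⊝ v)) step
        where
        step : ∀ A → (∀ B → B ⊂ A → ∀ {x C} → x ∈ T ⊝ u → Part (T ⊝ u ⊝ x) B C → Nonempty B →
            (∀ {a c} → a ∈ B → c ∈ C → m a c ≡ 0) → ¬ ¬ ∃ λ v → v ∈ B × u ~ v × Conn (T ⊝ u ⊝ v)) →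
          ∀ {x C} → x ∈ T ⊝ u → Part (T ⊝ u ⊝ x) A C → Nonempty A →
          (∀ {a c} → a ∈ A → c ∈ C → m a c ≡ 0) → ¬ ¬ ∃ λ v → v ∈ A × u ~ v × Conn (T ⊝ u ⊝ v)
        step A rec {x} {C} xT part ne apart k with any? (λ v → (A v Bool.≟ true) ×-dec ¬? (m u v ℕ.≟ 0))
        ... | no nn = closed-⊥ (conn⊝ two x (∧-left xT)) {A} sub ne {u} (⊝-intro T uT (⊝-≢ T xT ∘ sym)) (≢true λ uA → proj₁ (proj₂ (inside (part-left part u uA))) refl) lem
          where
          sub : A ⊆ T ⊝ x
          sub v vA with inside (part-left part v vA)
          ... | p , _ , q = ⊝-intro T p q
          lem : ∀ {b c} → b ∈ A → c ∈ T ⊝ x → A c ≡ false → m b c ≡ 0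
          lem {b} {c} bA cT cA with u Fin.≟ c
          ... | yes refl = trans (m-sym b u) (decidable-stable (m u b ℕ.≟ 0) λ e → nn (b , bA , e))
          ... | no u≢c with part-either part (⊝-intro (T ⊝ u) (⊝-intro T (∧-left cT) u≢c) (⊝-≢ T cT))
          ...   | inj₁ cA′ = ⊥-elim (tf cA′ cA)
          ...   | inj₂ cC = apart bA cC
        ... | yes (v , vA , uv) = k (v , vA , uv , λ { (cut {B} {B′} part′ neB neB′ apart′) → split part′ neB neB′ apart′ })
          where
          vin = inside (part-left part v vA)
          xB : x ∈ T ⊝ u ⊝ v
          xB = ⊝-intro (T ⊝ u) xT (proj₂ (proj₂ vin) ∘ sym)
          smaller : ∀ {B B′} → Part (T ⊝ u ⊝ v) B B′ → x ∈ B′ → (∀ {a c} → a ∈ B → c ∈ B′ → m a c ≡ 0) → B ⊂ A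
          smaller {B} {B′} part′ xB′ apart′ = (λ b bB → ≢false (escape b bB)) , v , vA , ≢true λ vB → proj₂ (proj₂ (inside (part-left part′ v vB))) refl
            where
            escape : ∀ b → b ∈ B → A b ≡ false → ⊥
            escape b bB bA with inside (part-left part′ b bB)
            ... | bT , u≢b , v≢b with part-either part {b} (⊝-intro (T ⊝ u) (⊝-intro T bT u≢b) λ { refl → tf xB′ (part-disjoint part′ bB) })
            ...   | inj₁ bA′ = tf bA′ bA
            ...   | inj₂ bC = closed-⊥ (conn⊝ two u uT) {λ w → B w ∧ C w} (λ w wBC → ∧-left (part-right part w (∧-right {B w} wBC)))
                  (b , ∧-intro bB bC) {x} xT (lem₀ (part-disjoint (part-sym part′) xB′)) lem
              where
              lem₀ : ∀ {p q} → p ≡ false → p ∧ q ≡ false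
              lem₀ refl = refl
              lem : ∀ {b c} → B b ∧ C b ≡ true → c ∈ T ⊝ u → B c ∧ C c ≡ false → m b c ≡ 0
              lem {b} {c} bBC cT cBC with x Fin.≟ c
              ... | yes refl = apart′ (∧-left bBC) xB′
              ... | no x≢c with part-either part (⊝-intro (T ⊝ u) cT x≢c)
              ...   | inj₁ cA = trans (m-sym b c) (apart cA (∧-right {B b} bBC))
              ...   | inj₂ cC with part-either part′ (⊝-intro (T ⊝ u) cT λ { refl → tf cC (part-disjoint part vA) })
              ...     | inj₁ cB = ⊥-elim (tf (∧-intro cB cC) cBC)
              ...     | inj₂ cB′ = apart′ (∧-left bBC) cB′
          split : ∀ {B B′} → Part (T ⊝ u ⊝ v) B B′ → Nonempty B → Nonempty B′ → (∀ {a c} → a ∈ B → c ∈ B′ → m a c ≡ 0) → ⊥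
          split {B} {B′} part′ neB neB′ apart′ with part-either part′ xB
          ... | inj₂ xB′ = rec B sm (⊝-intro T (proj₁ vin) (proj₁ (proj₂ vin))) part′ neB apart′ λ (w , wB , r) → k (w , proj₁ sm w wB , r)
            where sm = smaller part′ xB′ apart′
          ... | inj₁ xB₁ = rec B′ sm (⊝-intro T (proj₁ vin) (proj₁ (proj₂ vin))) (part-sym part′) neB′ ap λ (w , wB , r) → k (w , proj₁ sm w wB , r)
            where
            ap : ∀ {a c} → a ∈ B′ → c ∈ B → m a c ≡ 0
            ap {a} {c} p q = trans (m-sym a c) (apart′ q p)
            sm = smaller (part-sym part′) xB₁ ap

      record Degree2 (u : Fin N) : Set where
        field
          nbrs : TwoNeighbours T u
          x : Fin N
          x∈ : x ∈ T
          u≢x : u ≢ x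
          a≢x : TwoNeighbours.a nbrs ≢ x
          b≢x : TwoNeighbours.b nbrs ≢ x

      -- Choose such neighbours `v` and `w` on the two sides of `x`. With a third neighbour of `u`,
      -- `third` would keep `T ⊝ w ⊝ v` connected, and `link` would join `v` to `w` across the
      -- separation.
      degree2 : ∀ {u} → u ∈ T → Breaks u → ¬ ¬ Degree2 u
      degree2 {u} uT (x , xT , cut {A} {C} part neA neC apart) k =
        end uT A xT part neA apart λ (v , vA , uv , cv) →
        end uT C xT (part-sym part) neC (λ {c} {a} p q → trans (m-sym c a) (apart q p)) λ (w , wC , uw , cw) →
        let v≢w = λ { refl → tf wC (part-disjoint part vA) }
            vin = inside (part-left part v vA)
            win = inside (part-right part w wC)
            only = λ {c} cT uc → decidable-stable ((c Fin.≟ v) ⊎-dec (c Fin.≟ w)) λ ne →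
              link uT (proj₁ vin) (proj₁ win) uv uw v≢w (third vA wC cv cw cT uc (λ e → ne (inj₁ e)) (λ e → ne (inj₂ e))) (apart vA wC)
        in k record { nbrs = two-neighbours (proj₁ vin) (proj₁ win) uv uw v≢w (apart vA wC) only
                    ; x = x ; x∈ = ∧-left xT ; u≢x = ⊝-≢ T xT ; a≢x = λ e → proj₂ (proj₂ vin) (sym e) ; b≢x = λ e → proj₂ (proj₂ win) (sym e) }
        where
        -- The set `B` can be left only through `u`, `v` and `w`. Its trace on `A` would be cut off
        -- in `T ⊝ u` by `v` alone, its trace on `C` by `w` alone, and one of the traces is
        -- nonempty.
        blocked : ∀ {v w B} → v ∈ A → w ∈ C → Conn (T ⊝ u ⊝ v) → Conn (T ⊝ u ⊝ w) → B ⊆ T ⊝ w ⊝ v → Nonempty B →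
          B u ≡ false → B x ≡ false → (∀ {b c} → b ∈ B → c ∈ T ⊝ u → v ≢ c → w ≢ c → B c ≡ false → m b c ≡ 0) → ⊥
        blocked {v} {w} {B} vA wC cv cw s (b , bB) uB xB h with inside (s b bB)
        ... | bT , w≢b , v≢b with part-either part {b} (⊝-intro (T ⊝ u) (⊝-intro T bT λ { refl → tf bB uB }) λ { refl → tf bB xB })
        ...   | inj₁ bA = closed-⊥ cv {λ y → B y ∧ A y}
          (λ y p → ⊝-intro (T ⊝ u) (∖-left (T ⊝ u) ⁅ x ⁆ (part-left part y (∧-right {B y} p))) (proj₂ (proj₂ (inside (s y (∧-left p))))))
          (b , ∧-intro bB bA) {x} (⊝-intro (T ⊝ u) xT (proj₂ (proj₂ (inside (part-left part v vA))) ∘ sym)) (cong (_∧ A x) xB) lem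
          where
          lem : ∀ {b c} → B b ∧ A b ≡ true → c ∈ T ⊝ u ⊝ v → B c ∧ A c ≡ false → m b c ≡ 0
          lem {b} {c} bb cT cB with x Fin.≟ c
          ... | yes refl = h (∧-left bb) xT (⊝-≢ (T ⊝ u) cT) (proj₂ (proj₂ (inside (part-right part w wC))) ∘ sym) xB
          ... | no x≢c with part-either part (⊝-intro (T ⊝ u) (∧-left cT) x≢c)
          ...   | inj₂ cC = apart (∧-right {B b} bb) cC
          ...   | inj₁ cA = h (∧-left bb) (∧-left cT) (⊝-≢ (T ⊝ u) cT) (λ { refl → tf wC (part-disjoint part cA) }) (≢true λ cB′ → tf (∧-intro cB′ cA) cB)
        blocked {v} {w} {B} vA wC cv cw s (b , bB) uB xB h | bT , w≢b , v≢b | inj₂ bC = closed-⊥ cw {λ y → B y ∧ C y}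
          (λ y p → ⊝-intro (T ⊝ u) (∖-left (T ⊝ u) ⁅ x ⁆ (part-right part y (∧-right {B y} p))) (proj₁ (proj₂ (inside (s y (∧-left p))))))
          (b , ∧-intro bB bC) {x} (⊝-intro (T ⊝ u) xT (proj₂ (proj₂ (inside (part-right part w wC))) ∘ sym)) (cong (_∧ C x) xB) lem
          where
          lem : ∀ {b c} → B b ∧ C b ≡ true → c ∈ T ⊝ u ⊝ w → B c ∧ C c ≡ false → m b c ≡ 0
          lem {b} {c} bb cT cB with x Fin.≟ c
          ... | yes refl = h (∧-left bb) xT (proj₂ (proj₂ (inside (part-left part v vA))) ∘ sym) (⊝-≢ (T ⊝ u) cT) xB
          ... | no x≢c with part-either part (⊝-intro (T ⊝ u) (∧-left cT) x≢c)
          ...   | inj₁ cA = trans (m-sym b c) (apart cA (∧-right {B b} bb))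
          ...   | inj₂ cC = h (∧-left bb) (∧-left cT) (λ { refl → tf cC (part-disjoint part vA) }) (⊝-≢ (T ⊝ u) cT) (≢true λ cB′ → tf (∧-intro cB′ cC) cB)

        -- The side of a cut without `u` is blocked if it misses `x`. If it contains `x`, the other
        -- side without `u` is blocked instead; it is nonempty because `z`, being adjacent to `u`,
        -- lies there.
        third : ∀ {v w z} → v ∈ A → w ∈ C → Conn (T ⊝ u ⊝ v) → Conn (T ⊝ u ⊝ w) → z ∈ T → u ~ z → z ≢ v → z ≢ w → Conn (T ⊝ w ⊝ v)
        third {v} {w} {z} vA wC cv cw zT uz z≢v z≢w (cut part′ neB neD apart′) = wlog
          where
          u∈ : u ∈ T ⊝ w ⊝ v
          u∈ = ⊝-intro (T ⊝ w) (⊝-intro T uT (proj₁ (proj₂ (inside (part-right part w wC))) ∘ sym)) (proj₁ (proj₂ (inside (part-left part v vA))) ∘ sym)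
          z∈ : z ∈ T ⊝ w ⊝ v
          z∈ = ⊝-intro (T ⊝ w) (⊝-intro T zT (z≢w ∘ sym)) (z≢v ∘ sym)
          shrink : ∀ {B D} → Nonempty B → u ∈ D → Part (T ⊝ w ⊝ v) B D → (∀ {a c} → a ∈ B → c ∈ D → m a c ≡ 0) → ⊥
          shrink {B} {D} neB uD part′ apart′ with B x in eq
          ... | false = blocked vA wC cv cw (part-left part′) neB (part-disjoint (part-sym part′) uD) eq lem
            where
            lem : ∀ {b c} → b ∈ B → c ∈ T ⊝ u → v ≢ c → w ≢ c → B c ≡ false → m b c ≡ 0
            lem bB cT v≢c w≢c cB with part-either part′ (⊝-intro (T ⊝ w) (⊝-intro T (∧-left cT) w≢c) v≢c)
            ... | inj₁ cB′ = ⊥-elim (tf cB′ cB)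
            ... | inj₂ cD = apart′ bB cD
          ... | true = blocked vA wC cv cw (⊆-trans (⊝-⊆ D u) (part-right part′)) (z , z∈D) (≢true λ p → ⊝-≢ D p refl)
                (≢true λ p → tf (∧-left p) (part-disjoint part′ eq)) lem
            where
            z∈D : z ∈ D ⊝ u
            z∈D with part-either part′ z∈
            ... | inj₁ zB = ⊥-elim (uz (trans (m-sym u z) (apart′ zB uD)))
            ... | inj₂ zD = ⊝-intro D zD (~-≢ uz)
            lem : ∀ {b c} → b ∈ D ⊝ u → c ∈ T ⊝ u → v ≢ c → w ≢ c → (D ⊝ u) c ≡ false → m b c ≡ 0
            lem {b} {c} bD cT v≢c w≢c cD with part-either part′ (⊝-intro (T ⊝ w) (⊝-intro T (∧-left cT) w≢c) v≢c)
            ... | inj₁ cB = trans (m-sym b c) (apart′ cB (∧-left bD))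
            ... | inj₂ cD′ = ⊥-elim (tf (⊝-intro D cD′ (⊝-≢ T cT)) cD)
          wlog : ⊥
          wlog with part-either part′ u∈
          ... | inj₂ uD = shrink neB uD part′ apart′
          ... | inj₁ uB = shrink neD uB (part-sym part′) λ {a} {c} p q → trans (m-sym a c) (apart′ q p)

      -- The two neighbours of `u` separate it from `x`, so each of them breaks together with the
      -- other.
      breaks-next : ∀ {u w} → u ∈ T → w ∈ T → u ~ w → Degree2 u → Breaks w
      breaks-next {u} {w} uT wT uw d with TwoNeighbours.only nbrs wT uw
        where open Degree2 d
      ... | inj₁ refl = b , ⊝-intro T b∈ a≢b , cut (part-⊝ (T ⊝ a ⊝ b) {u} (⊝-intro (T ⊝ a) (⊝-intro T uT (~-≢ (~-sym a~))) (~-≢ (~-sym b~)))) (u , ∈⁅⁆ u)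
            (x , ⊝-intro (T ⊝ a ⊝ b) (⊝-intro (T ⊝ a) (⊝-intro T x∈ a≢x) b≢x) u≢x) lem
        where
        open Degree2 d
        open TwoNeighbours nbrs
        lem : ∀ {p c} → p ∈ ⁅ u ⁆ → c ∈ T ⊝ a ⊝ b ⊝ u → m p c ≡ 0
        lem {p} {c} pu cT with ⁅⁆-≡ {v = u} {w = p} pu
        ... | refl = decidable-stable (m u c ℕ.≟ 0) λ ne → case only (proj₁ (inside (∧-left cT))) ne of λ
          { (inj₁ e) → proj₁ (proj₂ (inside (∧-left cT))) (sym e) ; (inj₂ e) → proj₂ (proj₂ (inside (∧-left cT))) (sym e) }
      ... | inj₂ refl = a , ⊝-intro T a∈ (a≢b ∘ sym) , cut (part-⊝ (T ⊝ b ⊝ a) {u} (⊝-intro (T ⊝ b) (⊝-intro T uT (~-≢ (~-sym b~))) (~-≢ (~-sym a~)))) (u , ∈⁅⁆ u)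
            (x , ⊝-intro (T ⊝ b ⊝ a) (⊝-intro (T ⊝ b) (⊝-intro T x∈ b≢x) a≢x) u≢x) lem
        where
        open Degree2 d
        open TwoNeighbours nbrs
        lem : ∀ {p c} → p ∈ ⁅ u ⁆ → c ∈ T ⊝ b ⊝ a ⊝ u → m p c ≡ 0
        lem {p} {c} pu cT with ⁅⁆-≡ {v = u} {w = p} pu
        ... | refl = decidable-stable (m u c ℕ.≟ 0) λ ne → case only (proj₁ (inside (∧-left cT))) ne of λ
          { (inj₁ e) → proj₂ (proj₂ (inside (∧-left cT))) (sym e) ; (inj₂ e) → proj₁ (proj₂ (inside (∧-left cT))) (sym e) }

      complete : (∀ u → u ∈ T → ¬ Breaks u) → Complete T
      complete nb {u} {w} uT wT u≢w = near⇒ (spread (conn two) near {u} uT (⇒near λ ne → ⊥-elim (ne refl)) step w wT) u≢w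
        where
        near : Sub N
        near w = does (u Fin.≟ w) ∨ not (m u w ℕ.≡ᵇ 0)
        near⇒ : ∀ {w} → w ∈ near → u ≢ w → u ~ w
        near⇒ {w} p u≢w with u Fin.≟ w | m u w
        ... | yes e | _ = ⊥-elim (u≢w e)
        ... | no _ | suc _ = λ ()
        ⇒near : ∀ {w} → (u ≢ w → u ~ w) → w ∈ near
        ⇒near {w} p with u Fin.≟ w | m u w
        ... | yes e | _ = refl
        ... | no ne | zero = ⊥-elim (p ne refl)
        ... | no _ | suc _ = refl
        step : ∀ {v w} → v ∈ T → w ∈ T → v ~ w → v ∈ near → w ∈ near
        step {v} {w} vT wT vw vn = ⇒near λ u≢w → case u Fin.≟ v of λ
          { (yes refl) → vw
          ; (no u≢v) → link vT uT wT (~-sym (near⇒ vn u≢v)) vw u≢w λ c → nb w wT (u , ⊝-intro T uT (u≢w ∘ sym) , c) }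

    -- Breaking passes to neighbours, so all vertices break or none does. If none does, `link`
    -- applies at every pair and adjacency becomes transitive.
    complete-or-cyclic : (Complete T → ⊥) → ((∀ v → v ∈ T → TwoNeighbours T v) → ⊥) → ⊥
    complete-or-cyclic k₁ k₂ = decideAll {P = Breaks} λ dec → decideAll {P = λ v → v ∈ T → TwoNeighbours T v} λ dec₂ →
      case any? (λ v → (T v Bool.≟ true) ×-dec dec v) of λ
        { (no n) → k₁ (complete λ u uT b → n (u , uT , b))
        ; (yes (u , uT , bu)) → k₂ λ v vT → decidable-stable (dec₂ v) (λ nt →
            degree2 vT (all dec uT bu v vT) λ d → nt λ _ → Degree2.nbrs d) vT }
      where
      all : (dec : ∀ v → Dec (Breaks v)) → ∀ {u} → u ∈ T → Breaks u → ∀ v → v ∈ T → Breaks v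
      all dec {u} uT bu v vT = does⇒ (dec v) (spread (conn two) (λ v → does (dec v)) uT (dec-true (dec u) bu)
        (λ {v} {w} vT wT vw bv → decidable-stable (does (dec w) Bool.≟ true) λ nw →
          degree2 vT (does⇒ (dec v) bv) λ d → nw (dec-true (dec w) (breaks-next vT wT vw d))) v vT)

-- Adding one edge together with a partial matching

bit : Bool → ℕ
bit true = 1
bit false = 0

∨-swap : ∀ a b → a ∨ b ≡ b ∨ a
∨-swap true true = refl
∨-swap true false = refl
∨-swap false true = refl
∨-swap false false = refl

∨-false : ∀ {a b} → a ∨ b ≡ false → a ≡ false × b ≡ false
∨-false {false} {false} _ = refl , refl

count-∨ : ∀ {n} (f g : Fin n → Bool) → count (λ i → f i ∨ g i) ≤ count f + count g
count-∨ f g = ≤-trans (∑-mono λ i → lem (f i) (g i)) (≤-reflexive (∑-+ _ _))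
  where
  lem : ∀ a b → on (a ∨ b) 1ℤ ≤ on a 1ℤ + on b 1ℤ
  lem true true = +≤+ (s≤s z≤n)
  lem true false = ≤-refl
  lem false true = ≤-refl
  lem false false = ≤-refl

module AddedEdge {N : ℕ} (x y : Fin N) (x≢y : x ≢ y) where

  -- Directed on purpose: the new conflicts are read as given from `x` to `y` and transposed from
  -- `y` to `x`.
  δ : Fin N → Fin N → Bool
  δ p q = ⁅ x ⁆ p ∧ ⁅ y ⁆ q

  δ-≡ : ∀ {p q} → δ p q ≡ true → x ≡ p × y ≡ q
  δ-≡ {p} e = ⁅⁆-≡ (∧-left e) , ⁅⁆-≡ (∧-right {⁅ x ⁆ p} e)

  δ-xy : δ x y ≡ true
  δ-xy = ∧-intro (∈⁅⁆ x) (∈⁅⁆ y)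

  δ-diag : ∀ v → δ v v ≡ false
  δ-diag v = ≢true λ e → x≢y (trans (proj₁ (δ-≡ {v} {v} e)) (sym (proj₂ (δ-≡ {v} {v} e))))

  plus : Graph N → Graph N
  plus g = record
    { m = λ p q → m p q ℕ.+ (bit (δ p q) ℕ.+ bit (δ q p))
    ; m-sym = λ p q → cong₂ ℕ._+_ (m-sym p q) (ℕ.+-comm (bit (δ p q)) (bit (δ q p)))
    ; m-irr = λ v → cong₂ ℕ._+_ (m-irr v) (cong (λ b → bit b ℕ.+ bit b) (δ-diag v)) }
    where open Graph g

  module _ {g : Graph N} where
    open Graph g
    open Graph (plus g) using () renaming (m to m′)

    plus-same : ∀ {p q} → δ p q ≡ false → δ q p ≡ false → m′ p q ≡ m p q
    plus-same {p} {q} e f rewrite e | f = ℕ.+-identityʳ (m p q)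

    conflicts : ∀ {K} (Γ : Conflicts g K) (C : Fin K → Fin K → Bool) →
      (∀ c → count (C c) ≤ 1ℤ) → (∀ d → count (λ c → C c d) ≤ 1ℤ) → Conflicts (plus g) K
    conflicts Γ C row col = record
      { R = λ p q a b → R p q a b ∨ ((δ p q ∧ C a b) ∨ (δ q p ∧ C b a))
      ; R-sym = λ p q a b → cong₂ _∨_ (R-sym p q a b) (∨-swap (δ p q ∧ C a b) (δ q p ∧ C b a))
      ; R-deg = λ p q a → ≤-trans (count-∨ (R p q a) _) (R-deg p q a ⊕ ≤-trans (count-∨ (λ b → δ p q ∧ C a b) _)
          (guard (δ p q) (C a) (row a) ⊕ guard (δ q p) (λ b → C b a) (col a))) }
      where
      open Conflicts Γ
      guard : ∀ b f → count f ≤ 1ℤ → count (λ i → b ∧ f i) ≤ + bit b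
      guard true f p = p
      guard false f p = ≤-reflexive (∑-zero λ _ → refl)

part-∩ : ∀ {N} (W U : Sub N) → Part W (W ∖ U) (λ v → W v ∧ U v)
part-∩ W U v with W v | U v
... | true | true = right
... | true | false = left
... | false | _ = none

-- Potentials, bonuses, bad sets and exceptional subgraphs

module Potential (κ ℓ : ℤ) (κ≥5 : + 5 ≤ κ) (ℓ≥6 : + 6 ≤ ℓ) where

  open import Data.Integer using () renaming (_≟_ to _ℤ≟_)

  -- The potential of a vertex is t ℓ + corr t; the bonus is the amount by which a set
  -- containing it may miss the bound −2.
  opaque
    corr bonus : ℤ → ℤ
    corr t with t ℤ≟ κ - 1ℤ | t ≤? 1ℤ
    ... | yes _ | _ = 1ℤ
    ... | no _ | yes _ = -[1+ 1 ]
    ... | no _ | no _ = -[1+ 0 ]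
    bonus t with t ℤ≟ κ - 1ℤ | t ℤ≟ κ - + 2 | t ≤? 0ℤ
    ... | yes _ | _ | _ = 0ℤ
    ... | no _ | yes _ | _ = + 2
    ... | no _ | no _ | yes _ = 0ℤ
    ... | no _ | no _ | no _ = 1ℤ

  -- The values of `corr` and `bonus` as one table, so that inequalities about them are checked by
  -- matching on its rows.
  data View (t : ℤ) : ℤ → ℤ → Set where
    top : t ≡ κ - 1ℤ → View t 1ℤ 0ℤ
    sub : t ≡ κ - + 2 → View t -[1+ 0 ] (+ 2)
    mid : + 2 ≤ t → t ≤ κ - + 3 → View t -[1+ 0 ] 1ℤ
    one : t ≡ 1ℤ → View t -[1+ 1 ] 1ℤ
    low : t ≤ 0ℤ → View t -[1+ 1 ] 0ℤ

  opaque
    unfolding corr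

    view : ∀ t → t ≤ κ - 1ℤ → View t (corr t) (bonus t)
    view t p with t ℤ≟ κ - 1ℤ | t ℤ≟ κ - + 2 | t ≤? 1ℤ | t ≤? 0ℤ
    ... | yes e | _ | _ | _ = top e
    ... | no _ | yes e | no _ | _ = sub e
    ... | no _ | yes refl | yes q | _ = ⊥-elim (clash 1 (q ⊕ κ≥5) (lem κ))
      where
      lem : ∀ κ → κ - + 2 + + 5 ≡ 1ℤ + κ + + 2
      lem κ = solve (κ ∷ [])
    ... | no _ | no _ | yes q | yes r = low r
    ... | no _ | no _ | yes q | no r = one (≤-antisym q (above r))
    ... | no _ | no _ | no q | yes r = ⊥-elim (q (≤-trans r (0≤+ 1)))
    ... | no n₁ | no n₂ | no q | no _ = mid (above q) (below (strict (strict p n₁) λ e → n₂ (trans e (lem κ))))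
      where
      lem : ∀ κ → κ - 1ℤ - 1ℤ ≡ κ - + 2
      lem κ = solve (κ ∷ [])
      strict : ∀ {a b} → a ≤ b → a ≢ b → a ≤ b - 1ℤ
      strict {a} {b} p q = fit (above (λ r → q (≤-antisym p r))) (solve (a ∷ b ∷ []))
      below : t ≤ κ - 1ℤ - 1ℤ - 1ℤ → t ≤ κ - + 3
      below r = fit r (solve (κ ∷ t ∷ []))

  bonus≥0 : ∀ {t c b} → View t c b → 0ℤ ≤ b
  bonus≥0 (top _) = 0≤+ 0
  bonus≥0 (sub _) = 0≤+ 2
  bonus≥0 (mid _ _) = 0≤+ 1
  bonus≥0 (one _) = 0≤+ 1
  bonus≥0 (low _) = 0≤+ 0

  bonus≤2 : ∀ {t c b} → View t c b → b ≤ + 2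
  bonus≤2 (top _) = 0≤+ 2
  bonus≤2 (sub _) = ≤-refl
  bonus≤2 (mid _ _) = +≤+ (s≤s z≤n)
  bonus≤2 (one _) = +≤+ (s≤s z≤n)
  bonus≤2 (low _) = 0≤+ 2

  private
    corr+bonus : ∀ {t c b} → View t c b → -[1+ 1 ] ≤ c + b
    corr+bonus (top _) = -≤+
    corr+bonus (sub _) = -≤+
    corr+bonus (mid _ _) = -≤+
    corr+bonus (one _) = Data.Integer.-≤- z≤n
      where import Data.Integer
    corr+bonus (low _) = ≤-refl

    -- Checked entry by entry. With `s = 1` the step from `top` to `sub` forces the bonus 2 at
    -- `κ - 2`, and the step from 2 to 1 forces the bonus 1 at 1.
    view-gain : ∀ {t t′ s c b c′ b′} → View t c b → View t′ c′ b′ → t ≡ t′ + s → 1ℤ ≤ s → c + + 2 ≤ c′ + b′ + + 2 * s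
    view-gain {s = s} {b′ = b′} (top refl) (top refl) e p = ⊥-elim (clash 0 (p ⊕ ≤-reflexive (sym e)) (solve (κ ∷ s ∷ [])))
    view-gain {s = s} (top refl) (sub refl) e p = fit (2 ⋆ p) (solve (s ∷ []))
    view-gain {t′ = t′} {s} (top refl) (mid q r) e p = fit (2 ⋆ ≤-reflexive e ⊕ 2 ⋆ r ⊕ 0≤+ 1) (solve (κ ∷ t′ ∷ s ∷ []))
    view-gain {s = s} (top refl) (one refl) e p = fit (2 ⋆ ≤-reflexive e ⊕ 2 ⋆ κ≥5 ⊕ 0≤+ 2) (solve (κ ∷ s ∷ []))
    view-gain {t′ = t′} {s} (top refl) (low r) e p = fit (2 ⋆ ≤-reflexive e ⊕ 2 ⋆ r ⊕ 2 ⋆ κ≥5 ⊕ 0≤+ 3) (solve (κ ∷ t′ ∷ s ∷ []))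
    view-gain {s = s} (sub refl) (top refl) e p = ⊥-elim (clash 1 (p ⊕ ≤-reflexive (sym e)) (solve (κ ∷ s ∷ [])))
    view-gain {s = s} (sub refl) (sub _) e p = fit (2 ⋆ p ⊕ 0≤+ 2) (solve (s ∷ []))
    view-gain {s = s} (sub refl) (mid _ _) e p = fit (2 ⋆ p ⊕ 0≤+ 1) (solve (s ∷ []))
    view-gain {s = s} (sub refl) (one _) e p = fit (2 ⋆ p) (solve (s ∷ []))
    view-gain {t′ = t′} {s} (sub refl) (low r) e p = fit (2 ⋆ ≤-reflexive e ⊕ 2 ⋆ r ⊕ 2 ⋆ κ≥5 ⊕ 0≤+ 3) (solve (κ ∷ t′ ∷ s ∷ []))
    view-gain {t = t} {s = s} (mid x y) (top refl) e p = ⊥-elim (clash 2 (p ⊕ ≤-reflexive (sym e) ⊕ y) (solve (κ ∷ s ∷ t ∷ [])))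
    view-gain {s = s} (mid _ _) (sub _) e p = fit (2 ⋆ p ⊕ 0≤+ 2) (solve (s ∷ []))
    view-gain {s = s} (mid _ _) (mid _ _) e p = fit (2 ⋆ p ⊕ 0≤+ 1) (solve (s ∷ []))
    view-gain {s = s} (mid _ _) (one _) e p = fit (2 ⋆ p) (solve (s ∷ []))
    view-gain {t = t} {t′} {s} (mid x y) (low r) e p = fit (2 ⋆ ≤-reflexive e ⊕ 2 ⋆ r ⊕ 2 ⋆ x ⊕ 0≤+ 1) (solve (t ∷ t′ ∷ s ∷ []))
    view-gain {s = s} {c′ = c′} {b′} (one _) w e p = fit (2 ⋆ p ⊕ corr+bonus w) (solve (s ∷ c′ ∷ b′ ∷ []))
    view-gain {s = s} {c′ = c′} {b′} (low _) w e p = fit (2 ⋆ p ⊕ corr+bonus w) (solve (s ∷ c′ ∷ b′ ∷ []))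

  opaque
    P : ℤ → ℤ
    P t = t * ℓ + corr t

    P-def : ∀ t → P t ≡ t * ℓ + corr t
    P-def t = refl

    -- Each lost colour costs at most `ℓ + 2`. The constant 2 on the left is one half of the 4 in
    -- `rho-cut`; the other half is the bound -2 for bad sets.
    P-gain : ∀ {t s} → t ≤ κ - 1ℤ → 1ℤ ≤ s → P t + + 2 ≤ P (t - s) + bonus (t - s) + s * (ℓ + + 2)
    P-gain {t} {s} p q = lem (view-gain (view t p) (view (t - s) smaller) (eq t s) q)
      where
      eq : ∀ t s → t ≡ t - s + s
      eq t s = solve (t ∷ s ∷ [])
      smaller : t - s ≤ κ - 1ℤ
      smaller = fit (p ⊕ q ⊕ 0≤+ 1) (solve (t ∷ s ∷ κ ∷ []))
      lem : ∀ {c c′ b′} → c + + 2 ≤ c′ + b′ + + 2 * s → t * ℓ + c + + 2 ≤ (t - s) * ℓ + c′ + b′ + s * (ℓ + + 2)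
      lem {c} {c′} {b′} r = fit r (solve (t ∷ s ∷ ℓ ∷ c ∷ c′ ∷ b′ ∷ []))

    P-weak : ∀ {t s} → t ≤ κ - 1ℤ → 0ℤ ≤ s → P t ≤ P (t - s) + s * (ℓ + + 2)
    P-weak {t} {s} p q with s ℤ≟ 0ℤ
    ... | yes refl = ≤-reflexive (trans (cong P (eq t)) (z (P (t - 0ℤ)) ℓ))
      where
      eq : ∀ t → t ≡ t - 0ℤ
      eq t = solve (t ∷ [])
      z : ∀ a ℓ → a ≡ a + 0ℤ * (ℓ + + 2)
      z a ℓ = solve (a ∷ ℓ ∷ [])
    ... | no ne = lem {P t} {P (t - s)} (P-gain {t} {s} p (above λ r → ne (≤-antisym r q))) (bonus≤2 (view (t - s) smaller))
      where
      smaller : t - s ≤ κ - 1ℤ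
      smaller = fit (p ⊕ q) (solve (t ∷ s ∷ κ ∷ []))
      lem : ∀ {a a′ b} → a + + 2 ≤ a′ + b + s * (ℓ + + 2) → b ≤ + 2 → a ≤ a′ + s * (ℓ + + 2)
      lem {a} {a′} {b} x y = fit (x ⊕ y) (solve (a ∷ a′ ∷ b ∷ s ∷ ℓ ∷ []))

  Hmax : ℤ
  Hmax = (κ - 1ℤ) * ℓ + 1ℤ

  -- Upper bounds for potentials may therefore treat all vertices as having `h = κ - 1`, and the
  -- bonus of one vertex is included.
  P-max : ∀ {t} → t ≤ κ - 1ℤ → P t + bonus t ≤ Hmax
  P-max {t} p = subst (λ z → z + bonus t ≤ Hmax) (sym (P-def t)) (lem (view t p))
    where
    ℓ≥0 : 0ℤ ≤ ℓ
    ℓ≥0 = ≤-trans (0≤+ 6) ℓ≥6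
    κ-1≥0 : 0ℤ ≤ κ - 1ℤ
    κ-1≥0 = fit (κ≥5 ⊕ 0≤+ 4) (solve (κ ∷ []))
    lem : ∀ {t c b} → View t c b → t * ℓ + c + b ≤ (κ - 1ℤ) * ℓ + 1ℤ
    lem (top refl) = fit (≤-refl {0ℤ}) (solve (κ ∷ ℓ ∷ []))
    lem (sub refl) = fit ℓ≥0 (solve (κ ∷ ℓ ∷ []))
    lem {t} (mid _ q) = fit (scale ℓ≥0 q ⊕ 2 ⋆ ℓ≥0 ⊕ 0≤+ 1) (solve (κ ∷ ℓ ∷ t ∷ []))
    lem (one refl) = fit (scale ℓ≥0 κ≥5 ⊕ 3 ⋆ ℓ≥0 ⊕ 0≤+ 2) (solve (κ ∷ ℓ ∷ []))
    lem {t} (low q) = fit (scale ℓ≥0 q ⊕ scale ℓ≥0 κ-1≥0 ⊕ 0≤+ 3) (solve (κ ∷ ℓ ∷ t ∷ []))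

  P-top : P (κ - 1ℤ) ≡ (κ - 1ℤ) * ℓ + 1ℤ × bonus (κ - 1ℤ) ≡ 0ℤ
  P-top = subst (λ p → p ≡ (κ - 1ℤ) * ℓ + 1ℤ × bonus (κ - 1ℤ) ≡ 0ℤ) (sym (P-def (κ - 1ℤ))) (lem (view (κ - 1ℤ) ≤-refl))
    where
    lem : ∀ {c b} → View (κ - 1ℤ) c b → (κ - 1ℤ) * ℓ + c ≡ (κ - 1ℤ) * ℓ + 1ℤ × b ≡ 0ℤ
    lem (top _) = refl , refl
    lem (sub e) = ⊥-elim (clash 0 (≤-reflexive e) (solve (κ ∷ [])))
    lem (mid _ e) = ⊥-elim (clash 1 e (solve (κ ∷ [])))
    lem (one e) = ⊥-elim (clash 2 (≤-reflexive e ⊕ κ≥5) (solve (κ ∷ [])))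
    lem (low e) = ⊥-elim (clash 3 (e ⊕ κ≥5) (solve (κ ∷ [])))

  P-sub : P (κ - + 2) ≡ (κ - + 2) * ℓ - 1ℤ × bonus (κ - + 2) ≡ + 2
  P-sub = subst (λ p → p ≡ (κ - + 2) * ℓ - 1ℤ × bonus (κ - + 2) ≡ + 2) (sym (P-def (κ - + 2))) (lem (view (κ - + 2) smaller))
    where
    smaller : κ - + 2 ≤ κ - 1ℤ
    smaller = fit (0≤+ 1) (solve (κ ∷ []))
    lem : ∀ {c b} → View (κ - + 2) c b → (κ - + 2) * ℓ + c ≡ (κ - + 2) * ℓ - 1ℤ × b ≡ + 2
    lem (top e) = ⊥-elim (clash 0 (≤-reflexive (sym e)) (solve (κ ∷ [])))
    lem (sub _) = refl , refl
    lem (mid _ e) = ⊥-elim (clash 0 e (solve (κ ∷ [])))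
    lem (one e) = ⊥-elim (clash 1 (≤-reflexive e ⊕ κ≥5) (solve (κ ∷ [])))
    lem (low e) = ⊥-elim (clash 2 (e ⊕ κ≥5) (solve (κ ∷ [])))

  sgn : ℕ → ℕ
  sgn zero = 0
  sgn (suc _) = 1

  module Weights {N : ℕ} (g : Graph N) where
    open Graphs g

    -- `E` is the potential of a pair and is symmetric; `F` keeps it for one order of the pair only,
    -- so that `rho` counts unordered pairs.
    adj E F : Fin N → Fin N → ℤ
    adj v w = + sgn (m v w)
    E v w = adj v w - (+ 2 * ℓ + 1ℤ) * μ v w
    F v w = on (toℕ v ℕ.<ᵇ toℕ w) (E v w)

    adj≤μ : ∀ v w → adj v w ≤ μ v w
    adj≤μ v w with m v w
    ... | zero = ≤-refl
    ... | suc _ = +≤+ (s≤s z≤n)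

    E-sym : ∀ v w → E v w ≡ E w v
    E-sym v w rewrite m-sym v w = refl

    E-none : ∀ {v w} → m v w ≡ 0 → E v w ≡ 0ℤ
    E-none e rewrite e = lem ℓ
      where
      lem : ∀ ℓ → 0ℤ - (+ 2 * ℓ + 1ℤ) * 0ℤ ≡ 0ℤ
      lem ℓ = solve (ℓ ∷ [])

    E-≤ : ∀ v w → E v w ≤ - (+ 2 * ℓ) * μ v w
    E-≤ v w = lem (adj≤μ v w)
      where
      lem : ∀ {a b} → a ≤ b → a - (+ 2 * ℓ + 1ℤ) * b ≤ - (+ 2 * ℓ) * b
      lem {a} {b} p = fit p (solve (a ∷ b ∷ ℓ ∷ []))

    E-split : ∀ v w → E v w ≡ F v w + F w v
    E-split v w with v Fin.≟ w
    ... | yes refl = trans (E-none (m-irr v)) (sym (cong (λ b → on b (E v v) + on b (E v v)) (irr (toℕ v))))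
      where
      irr : ∀ n → (n ℕ.<ᵇ n) ≡ false
      irr zero = refl
      irr (suc n) = irr n
    ... | no ne = lem (toℕ v) (toℕ w) (λ e → ne (toℕ-injective e)) (E-sym v w)
      where
      lem : ∀ a b → a ≢ b → ∀ {x y} → x ≡ y → x ≡ on (a ℕ.<ᵇ b) x + on (b ℕ.<ᵇ a) y
      lem zero zero ne _ = ⊥-elim (ne refl)
      lem zero (suc b) ne {x} e = sym (+-identityʳ x)
      lem (suc a) zero ne {x} {y} e = trans e (sym (+-identityˡ y))
      lem (suc a) (suc b) ne e = lem a b (ne ∘ cong suc) e

    cross edges : Sub N → Sub N → ℤ
    cross A C = Σₛ A λ a → Σₛ C (E a)
    edges A C = Σₛ A λ a → deg C a

    edges-swap : ∀ A C → edges A C ≡ edges C A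
    edges-swap A C = trans (Σₛ-swap A C μ) (Σₛ-cong C λ c _ → Σₛ-cong A λ a _ → μ-sym a c)

    cross-swap : ∀ A C → cross A C ≡ cross C A
    cross-swap A C = trans (Σₛ-swap A C E) (Σₛ-cong C λ c _ → Σₛ-cong A λ a _ → E-sym a c)

    cross-≤ : ∀ A C → cross A C ≤ - (+ 2 * ℓ) * edges A C
    cross-≤ A C = ≤-trans (Σₛ-mono A λ a _ → ≤-trans (Σₛ-mono C λ c _ → E-≤ a c) (≤-reflexive (Σₛ-* C (- (+ 2 * ℓ)) (μ a))))
      (≤-reflexive (Σₛ-* A (- (+ 2 * ℓ)) (deg C)))

    edges-part : ∀ {X A C} → Part X A C → ∀ Y → edges X Y ≡ edges A Y + edges C Y
    edges-part p Y = Σₛ-part p (deg Y)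

    edges-partʳ : ∀ {X A C} → Part X A C → ∀ Y → edges Y X ≡ edges Y A + edges Y C
    edges-partʳ p Y = trans (Σₛ-cong Y λ y _ → deg-part p y) (Σₛ-+ Y _ _)

    edges-nonneg : ∀ A C → 0ℤ ≤ edges A C
    edges-nonneg A C = Σₛ-nonneg A λ a _ → deg-nonneg C a

    opaque
      rho : (Fin N → ℤ) → Sub N → ℤ
      rho h X = Σₛ X λ v → P (h v) + Σₛ X (F v)

      rho-def : ∀ h X → rho h X ≡ Σₛ X λ v → P (h v) + Σₛ X (F v)
      rho-def h X = refl

      rho-ext : ∀ h {X Y} → (∀ v → X v ≡ Y v) → rho h X ≡ rho h Y
      rho-ext h {X} {Y} e = ∑-cong λ v → cong₂ on (e v) (cong (λ z → P (h v) + z) (∑-cong λ w → cong (λ b → on b (F v w)) (e w)))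

      -- After doubling, the sum over unordered pairs is a sum over vertices. In this form
      -- potentials are estimated vertex by vertex.
      rho-double : ∀ h X → + 2 * rho h X ≡ Σₛ X λ v → + 2 * P (h v) + Σₛ X (E v)
      rho-double h X = trans (cong (+ 2 *_) (Σₛ-+ X (P ∘ h) λ v → Σₛ X (F v)))
        (trans (arith (Σₛ X (P ∘ h)) _)
        (trans (cong₂ _+_ (sym (Σₛ-* X (+ 2) (P ∘ h))) (trans (cong (λ z → Σₛ X (λ v → Σₛ X (F v)) + z) (Σₛ-swap X X F))
          (trans (sym (Σₛ-+ X (λ v → Σₛ X (F v)) λ v → Σₛ X (λ w → F w v)))
            (Σₛ-cong X λ v _ → trans (sym (Σₛ-+ X (F v) λ w → F w v)) (Σₛ-cong X λ w _ → sym (E-split v w))))))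
        (sym (Σₛ-+ X (λ v → + 2 * P (h v)) λ v → Σₛ X (E v)))))
        where
        arith : ∀ a b → + 2 * (a + b) ≡ + 2 * a + (b + b)
        arith a b = solve (a ∷ b ∷ [])

      rho-shift : ∀ {h h′} Y {d} → (∀ v → v ∈ Y → P (h v) ≤ P (h′ v) + d v) → rho h Y ≤ rho h′ Y + Σₛ Y d
      rho-shift {h} {h′} Y {d} p = ≤-trans (Σₛ-mono Y λ v vY → ≤-trans (p v vY ⊕ ≤-refl {Σₛ Y (F v)}) (≤-reflexive (arith (P (h′ v)) (d v) (Σₛ Y (F v)))))
        (≤-reflexive (Σₛ-+ Y _ _))
        where
        arith : ∀ a b c → (a + b) + c ≡ (a + c) + b
        arith a b c = solve (a ∷ b ∷ c ∷ [])

      rho-gain : ∀ {h h′} Y {d c} → (∀ v → v ∈ Y → P (h v) ≤ P (h′ v) + d v) → ∀ {u} → u ∈ Y → P (h u) + c ≤ P (h′ u) + d u →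
        rho h Y + c ≤ rho h′ Y + Σₛ Y d
      rho-gain {h} {h′} Y {d} {c} p {u} uY q = ≤-trans (Σₛ-gain Y (λ v vY → ≤-trans (p v vY ⊕ ≤-refl {Σₛ Y (F v)}) (≤-reflexive (arith (P (h′ v)) (d v) (Σₛ Y (F v)))))
          uY (≤-trans (≤-reflexive (arith (P (h u)) (Σₛ Y (F u)) c)) (≤-trans (q ⊕ ≤-refl {Σₛ Y (F u)}) (≤-reflexive (arith (P (h′ u)) (d u) (Σₛ Y (F u)))))))
        (≤-reflexive (Σₛ-+ Y _ _))
        where
        arith : ∀ a b c → (a + b) + c ≡ (a + c) + b
        arith a b c = solve (a ∷ b ∷ c ∷ [])

      rho-single : ∀ h v → rho h ⁅ v ⁆ ≡ P (h v)
      rho-single h v = trans (Σₛ-point v _) (trans (cong (λ z → P (h v) + z) (trans (Σₛ-point v (F v)) (trans (cong (on _) (E-none (m-irr v))) (on-zero _)))) (+-identityʳ _))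

    rho-part : ∀ {X A C} → Part X A C → ∀ h → rho h X ≡ rho h A + rho h C + cross A C
    rho-part {X} {A} {C} p h = *-cancelˡ-≡ (+ 2) _ _ (trans (rho-double h X)
      (trans (Σₛ-cong X λ v _ → cong (λ z → + 2 * P (h v) + z) (Σₛ-part p (E v)))
      (trans (Σₛ-part p _)
      (trans (cong₂ _+_ (side A C) (trans (Σₛ-cong C λ v _ → cong (λ z → + 2 * P (h v) + z) (+-comm (Σₛ A (E v)) (Σₛ C (E v)))) (side C A)))
      (trans (cong (λ z → (+ 2 * rho h A + cross A C) + (+ 2 * rho h C + z)) (cross-swap C A))
      (arith (rho h A) (rho h C) (cross A C)))))))
      where
      arith : ∀ a b c → (+ 2 * a + c) + (+ 2 * b + c) ≡ + 2 * (a + b + c)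
      arith a b c = solve (a ∷ b ∷ c ∷ [])
      assoc : ∀ a b c → a + (b + c) ≡ (a + b) + c
      assoc a b c = solve (a ∷ b ∷ c ∷ [])
      side : ∀ A C → Σₛ A (λ v → + 2 * P (h v) + (Σₛ A (E v) + Σₛ C (E v))) ≡ + 2 * rho h A + cross A C
      side A C = trans (Σₛ-cong A λ v _ → assoc (+ 2 * P (h v)) (Σₛ A (E v)) (Σₛ C (E v)))
        (trans (Σₛ-+ A _ _) (cong (_+ cross A C) (sym (rho-double h A))))

    Bad : (Fin N → ℤ) → Sub N → Set
    Bad h Y = Nonempty Y × (∀ v → v ∈ Y → rho h Y + bonus (h v) ≤ -[1+ 1 ])

    bad-cong : ∀ {h h′ Y} → (∀ v → v ∈ Y → h v ≡ h′ v) → Bad h′ Y → Bad h Y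
    bad-cong {h} {h′} {Y} same (ne , bad) = ne , λ v vY →
      ≤-trans (rho-shift {h} {h′} Y {λ _ → 0ℤ} (λ w wY → ≤-reflexive (trans (cong P (same w wY)) (sym (+-identityʳ _)))) ⊕ ≤-refl {bonus (h v)})
        (≤-trans (≤-reflexive (cong₂ _+_ (trans (cong (λ z → rho h′ Y + z) (∑-zero λ w → on-zero (Y w))) (+-identityʳ (rho h′ Y))) (cong bonus (same v vY)))) (bad v vY))

    nb : Sub N → Fin N → ℤ
    nb Y v = Σₛ Y (adj v)

    Σ-E : ∀ Y v → Σₛ Y (E v) ≡ nb Y v - (+ 2 * ℓ + 1ℤ) * deg Y v
    Σ-E Y v = trans (Σₛ-cong Y λ w _ → neg (adj v w) (+ 2 * ℓ + 1ℤ) (μ v w)) (trans (Σₛ-+ Y _ _)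
      (trans (cong (λ z → nb Y v + z) (Σₛ-* Y (- (+ 2 * ℓ + 1ℤ)) (μ v))) (sym (neg (nb Y v) (+ 2 * ℓ + 1ℤ) (deg Y v)))))
      where
      neg : ∀ a b c → a - b * c ≡ a + - b * c
      neg a b c = solve (a ∷ b ∷ c ∷ [])

    rho-const : ∀ {h Y p ν r} → (∀ v → v ∈ Y → P (h v) ≡ p × nb Y v ≡ ν × deg Y v ≡ r) →
      + 2 * rho h Y ≡ (+ 2 * p + (ν - (+ 2 * ℓ + 1ℤ) * r)) * card Y
    rho-const {h} {Y} {p} {ν} {r} c = trans (rho-double h Y) (trans (Σₛ-cong Y λ v vY → same v (c v vY)) (Σₛ-const Y _))
      where
      same : ∀ v → P (h v) ≡ p × nb Y v ≡ ν × deg Y v ≡ r → + 2 * P (h v) + Σₛ Y (E v) ≡ + 2 * p + (ν - (+ 2 * ℓ + 1ℤ) * r)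
      same v (a , b , d) = trans (cong (λ z → + 2 * P (h v) + z) (Σ-E Y v)) (cong₂ _+_ (cong (+ 2 *_) a) (cong₂ _-_ b (cong ((+ 2 * ℓ + 1ℤ) *_) d)))

    E≤0 : ∀ v w → E v w ≤ 0ℤ
    E≤0 v w = ≤-trans (E-≤ v w) (lem (0≤* ℓ≥0 (0≤+ (m v w))))
      where
      ℓ≥0 : 0ℤ ≤ ℓ
      ℓ≥0 = ≤-trans (0≤+ 6) ℓ≥6
      lem : ∀ {b} → 0ℤ ≤ ℓ * b → - (+ 2 * ℓ) * b ≤ 0ℤ
      lem {b} p = fit (2 ⋆ p) (solve (ℓ ∷ b ∷ []))

    Σ-E≤0 : ∀ Y v → Σₛ Y (E v) ≤ 0ℤ
    Σ-E≤0 Y v = ≤-trans (Σₛ-mono Y λ w _ → E≤0 v w) (≤-reflexive (∑-zero λ w → on-zero (Y w)))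

    Σ-E-⊆ : ∀ {A Y} → A ⊆ Y → ∀ v → Σₛ Y (E v) ≤ Σₛ A (E v)
    Σ-E-⊆ {A} {Y} s v = ≤-trans (≤-reflexive (Σₛ-part (part-∖ s) (E v))) (≤-trans (≤-refl {Σₛ A (E v)} ⊕ Σ-E≤0 (Y ∖ A) v) (≤-reflexive (+-identityʳ _)))

    Σ-E-term : ∀ Y {v w} → w ∈ Y → Σₛ Y (E v) ≤ E v w
    Σ-E-term Y {v} {w} p = ≤-trans (Σ-E-⊆ (λ z e → subst (_∈ Y) (⁅⁆-≡ e) p) v) (≤-reflexive (Σₛ-point w (E v)))

    -- Every vertex is raised to the top potential; the room that `P-max` leaves at `u` pays for its
    -- bonus.
    hat : ∀ {h} → (∀ v → h v ≤ κ - 1ℤ) → ∀ A U {u} → u ∈ A → + 2 * (rho h A + bonus (h u) + cross A U) ≤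
      Σₛ A λ v → + 2 * Hmax + Σₛ A (E v) + + 2 * Σₛ U (E v)
    hat {h} hκ A U {u} uA = ≤-trans (≤-reflexive (trans (arith (rho h A) (bonus (h u)) (cross A U))
        (cong₂ (λ y z → y + z + + 2 * bonus (h u)) (rho-double h A) (sym (Σₛ-* A (+ 2) λ v → Σₛ U (E v))))))
      (≤-trans (≤-reflexive (cong (_+ + 2 * bonus (h u)) (sym (Σₛ-+ A _ _))))
        (Σₛ-gain A (λ v _ → lem₁ {P (h v)} {bonus (h v)} {Σₛ A (E v)} {Σₛ U (E v)} (bonus≥0 (view (h v) (hκ v))) (P-max (hκ v)))
          uA (lem₂ {P (h u)} {bonus (h u)} {Σₛ A (E u)} {Σₛ U (E u)} (P-max (hκ u)))))
      where
      arith : ∀ a b c → + 2 * (a + b + c) ≡ + 2 * a + + 2 * c + + 2 * b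
      arith a b c = solve (a ∷ b ∷ c ∷ [])
      lem₁ : ∀ {p b x y H} → 0ℤ ≤ b → p + b ≤ H → + 2 * p + x + + 2 * y ≤ + 2 * H + x + + 2 * y
      lem₁ {p} {b} {x} {y} {H} q r = fit (2 ⋆ q ⊕ 2 ⋆ r) (solve (p ∷ b ∷ x ∷ y ∷ H ∷ []))
      lem₂ : ∀ {p b x y H} → p + b ≤ H → + 2 * p + x + + 2 * y + + 2 * b ≤ + 2 * H + x + + 2 * y
      lem₂ {p} {b} {x} {y} {H} r = fit (2 ⋆ r) (solve (p ∷ b ∷ x ∷ y ∷ H ∷ []))

    hat₀ : ∀ {h} → (∀ v → h v ≤ κ - 1ℤ) → ∀ A {u} → u ∈ A → + 2 * (rho h A + bonus (h u)) ≤ Σₛ A λ v → + 2 * Hmax + Σₛ A (E v)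
    hat₀ {h} hκ A {u} uA = ≤-trans (≤-reflexive (cong (+ 2 *_) (trans (sym (+-identityʳ _)) (cong (λ z → rho h A + bonus (h u) + z)
        (sym (∑-zero λ v → trans (cong (on (A v)) (empty v)) (on-zero (A v))))))))
      (≤-trans (hat hκ A (λ _ → false) uA) (≤-reflexive (Σₛ-cong A λ v _ → trans (cong (λ z → + 2 * Hmax + Σₛ A (E v) + + 2 * z) (empty v)) (+-identityʳ _))))
      where
      empty : ∀ v → Σₛ (λ _ → false) (E v) ≡ 0ℤ
      empty v = ∑-zero {N} λ _ → refl

    adj-one : ∀ {v w} → v ~ w → adj v w ≡ 1ℤ
    adj-one {v} {w} p with m v w
    ... | zero = ⊥-elim (p refl)
    ... | suc _ = refl

    edges-term : ∀ A C {a c} → a ∈ A → c ∈ C → μ a c ≤ edges A C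
    edges-term A C p q = ≤-trans (deg-term C q) (Σₛ-term A (λ a → deg-nonneg C a) p)

    -- In the last case a set in which every vertex has two doubly joined neighbours stands for a
    -- double cycle. The structure theorem delivers it in this form, and `walk` extracts the cycle
    -- at the end.
    data Exceptional (X : Sub N) : Set where
      clique : ∀ W → W ⊆ X → Σₛ W (λ _ → 1ℤ) ≡ κ → (∀ {u w} → u ∈ W → w ∈ W → u ≢ w → u ~ w) → Exceptional X
      heavy : κ ≡ + 5 → ∀ {u w} → u ∈ X → w ∈ X → + 4 ≤ μ u w → Exceptional X
      doubled : κ ≡ + 5 → ∀ W → W ⊆ X → Nonempty W →
        (∀ v → v ∈ W → ∃ λ a → ∃ λ b → a ∈ W × b ∈ W × a ≢ b × + 2 ≤ μ v a × + 2 ≤ μ v b) → Exceptional X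

    Exceptional-⊆ : ∀ {X Y} → X ⊆ Y → Exceptional X → Exceptional Y
    Exceptional-⊆ s (clique W t c k) = clique W (⊆-trans t s) c k
    Exceptional-⊆ s (heavy e p q r) = heavy e (s _ p) (s _ q) r
    Exceptional-⊆ s (doubled e W t n d) = doubled e W (⊆-trans t s) n d

-- The colouring theorem; elementary inequalities used in it

module Reduction (κ ℓ : ℤ) (κ≥5 : + 5 ≤ κ) (ℓ≥6 : + 6 ≤ ℓ)
  (quadratic : κ * κ - + 7 ≤ (+ 2 * κ - + 7) * ℓ) where
  open Potential κ ℓ κ≥5 ℓ≥6
  open import Data.Integer using () renaming (_≟_ to _ℤ≟_)

  -- Integrality: an estimate of a doubled potential may be off by one.
  half-≤ : ∀ {a b} → + 2 * a ≤ + 2 * b + 1ℤ → a ≤ b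
  half-≤ {a} {b} p = stable λ q → clash 0 (p ⊕ 2 ⋆ above q) (solve (a ∷ b ∷ []))

  ≥-cast : ∀ {x y} → x ≡ y → y ≤ x
  ≥-cast e = ≤-reflexive (sym e)

  six : κ ≢ + 5 → + 6 ≤ κ
  six ne = above {κ} {+ 5} λ q → ne (≤-antisym q κ≥5)

  ℓ≥0 : 0ℤ ≤ ℓ
  ℓ≥0 = ≤-trans (0≤+ 6) ℓ≥6

  ℓ-2≥0 : 0ℤ ≤ ℓ - + 2
  ℓ-2≥0 = fit (ℓ≥6 ⊕ 0≤+ 4) (solve (ℓ ∷ []))

  one-arith : ∀ n y → y + (+ 3 + (n + 0ℤ)) ≡ 1ℤ + (n + (1ℤ + y + 1ℤ))
  one-arith n y = solve (n ∷ y ∷ [])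

  two-arith : ∀ n z → z + (+ 3 + n) ≡ 1ℤ + (n + (1ℤ + (1ℤ + z)))
  two-arith n z = solve (n ∷ z ∷ [])

  deg-vw-three : ∀ {x y z} → x ≡ 1ℤ + y → y ≡ 1ℤ + z → 1ℤ ≤ z → + 3 ≤ x
  deg-vw-three {_} {_} {z} refl refl p = fit p (solve (z ∷ []))

  half-arith : ∀ {a b} → a ≡ 1ℤ + b → a - 1ℤ ≡ b
  half-arith {_} {b} refl = solve (b ∷ [])

  sparse-arith : ∀ {r a b c r′ e β} → r ≡ a + b + c → c ≤ - (+ 2 * ℓ) * e → b ≤ r′ + (ℓ + + 2) * e → r′ + β ≤ -[1+ 1 ] → 0ℤ ≤ β → 0ℤ ≤ e → r ≤ a
  sparse-arith {_} {a} {b} {c} {r′} {e} {β} refl p q s t u = fit (p ⊕ q ⊕ s ⊕ t ⊕ 0≤* ℓ-2≥0 u ⊕ 0≤+ 2) (solve (a ∷ b ∷ c ∷ r′ ∷ e ∷ β ∷ ℓ ∷ []))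

  lt-arith : ∀ {a d x} → a ≡ x - 1ℤ → d ≡ κ - 1ℤ → d ≡ a → x ≡ κ
  lt-arith {_} {_} {x} refl refl e = ≤-antisym (fit (≤-reflexive (sym e)) (solve (x ∷ κ ∷ []))) (fit (≤-reflexive e) (solve (x ∷ κ ∷ [])))

  small-arith : + 6 ≤ κ → + 3 ≤ (κ - + 3 - 1ℤ) * + 2
  small-arith p = fit (2 ⋆ p ⊕ 0≤+ 1) (solve (κ ∷ []))

  large-arith : ∀ {n} → + 2 * (n - 1ℤ) ≤ κ - 1ℤ → + 6 ≤ κ → + 3 ≤ n → n + 1ℤ ≤ κ - + 2
  large-arith {n} p r s = half-≤ (fit (p ⊕ r) (solve (n ∷ κ ∷ [])))

  pt-arith : ∀ e ℓ → - (+ 2 * ℓ) * -[1+ 1 ] + (e + + 4 * 0ℤ) ≡ e + (0ℤ + + 4 * ℓ)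
  pt-arith e ℓ = solve (e ∷ ℓ ∷ [])

  pt-arith₁ : ∀ e ℓ → - (+ 2 * ℓ) * -[1+ 0 ] + (e + + 2 * 0ℤ) ≡ e + (0ℤ + + 2 * ℓ)
  pt-arith₁ e ℓ = solve (e ∷ ℓ ∷ [])

  pt-arith₂ : ∀ e ℓ → - (+ 2 * ℓ) * 0ℤ + e ≡ e + 0ℤ
  pt-arith₂ e ℓ = solve (e ∷ ℓ ∷ [])

  pt-arith₃ : ∀ e u ℓ → - (+ 2 * ℓ) * 1ℤ + (e + ℓ * (+ 2 * 1ℤ)) ≡ e + (- (+ 2 * ℓ) * u + ℓ * (+ 2 * u))
  pt-arith₃ e u ℓ = solve (e ∷ u ∷ ℓ ∷ [])

  shape-arith : ∀ a b → + 2 * ((κ - 1ℤ) * ℓ + 1ℤ) + - (+ 2 * ℓ) * (κ + -[1+ 0 ] * (1ℤ + (a + b))) ≡ + 2 * ((κ - 1ℤ) * ℓ + 1ℤ) - + 2 * ℓ * (κ - 1ℤ) + + 2 * ℓ * (a + b)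
  shape-arith a b = solve (κ ∷ ℓ ∷ a ∷ b ∷ [])

  shape-arith₁ : ∀ a b o → + 2 * ((κ - 1ℤ) * ℓ + 1ℤ) + (- (+ 2 * ℓ) * (a + -[1+ 0 ] * 1ℤ) + + 2 * (- (+ 2 * ℓ) * (b + -[1+ 0 ] * o)))
    ≡ + 2 * ((κ - 1ℤ) * ℓ + 1ℤ) - + 2 * ℓ * (a - 1ℤ) - + 4 * ℓ * b + + 4 * ℓ * o
  shape-arith₁ a b o = solve (κ ∷ ℓ ∷ a ∷ b ∷ o ∷ [])

  num-pred : ∀ {a} → 1ℤ ≤ a → 0ℤ ≤ a - 1ℤ
  num-pred {a} r = fit r (solve (a ∷ []))

  term-arith : ∀ {a} → a ≤ 0ℤ → a + (+ 2 * ℓ + 1ℤ) * 0ℤ ≤ 0ℤ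
  term-arith {a} p = fit p (solve (a ∷ ℓ ∷ []))

  term-arith₁ : ∀ {a} → a ≤ 1ℤ - (+ 2 * ℓ + 1ℤ) * + 1 → a + (+ 2 * ℓ + 1ℤ) * 1ℤ ≤ 1ℤ
  term-arith₁ {a} p = fit p (solve (a ∷ ℓ ∷ []))

  crossed-arith : ∀ e → κ - 1ℤ ≤ e → - (+ 2 * ℓ) * e ≤ - (+ 2 * ℓ) * (κ - 1ℤ)
  crossed-arith e p = fit (scale (0≤* (0≤+ 2) (≤-trans (0≤+ 6) ℓ≥6)) p) (solve (e ∷ κ ∷ ℓ ∷ []))

  finish-hat-κ-3≥0 : 0ℤ ≤ κ - + 3
  finish-hat-κ-3≥0 = fit (κ≥5 ⊕ 0≤+ 2) (solve (κ ∷ []))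

  absurd-arith : ∀ {a b c d} → a ≤ b → b ≤ c + d → a - d ≤ c
  absurd-arith {a} {b} {c} {d} p q = fit (p ⊕ q) (solve (a ∷ b ∷ c ∷ d ∷ []))

  absurd-arith₁ : ∀ {a b c} → a ≤ b → 0ℤ ≤ c → a - c ≤ b
  absurd-arith₁ {a} {b} {c} p q = fit (p ⊕ q) (solve (a ∷ b ∷ c ∷ []))

  rho-cut-arith : ∀ {x y z e e₁ e₂ e₃ e₄} → x + (ℓ - + 2) * e₄ + + 4 ≤ z → z + + 4 + (ℓ - + 2) * e₁ ≤ y → e ≡ e₁ + e₂ → e₄ ≡ e₂ + e₃ → 0ℤ ≤ (ℓ - + 2) * e₃ →
    x + (ℓ - + 2) * e + + 4 ≤ y
  rho-cut-arith {x} {y} {z} {_} {e₁} {e₂} {e₃} p q refl refl r = fit (p ⊕ q ⊕ r ⊕ 0≤+ 4) (solve (x ∷ y ∷ z ∷ e₁ ∷ e₂ ∷ e₃ ∷ ℓ ∷ []))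

  rho-cut-arith₁ : ∀ {x y z e e₁ e₂} → x ≡ z → z + + 4 + (ℓ - + 2) * e₁ ≤ y → e ≡ e₁ + e₂ → e₂ ≡ 0ℤ → x + (ℓ - + 2) * e + + 4 ≤ y
  rho-cut-arith₁ {x} {y} {_} {_} {e₁} refl q refl refl = fit q (solve (x ∷ y ∷ e₁ ∷ ℓ ∷ []))

  pos-arith : ∀ {d} → d ≡ κ - 1ℤ → 1ℤ ≤ d
  pos-arith {d} refl = fit (κ≥5 ⊕ 0≤+ 3) (solve (κ ∷ []))

  cyclic-twos : κ ≡ + 5 → ∀ {d a b} → d ≡ κ - 1ℤ → d ≡ a + b → a ≡ b → + 2 ≤ a
  cyclic-twos refl {_} {a} e f refl = unscale {+ 2} {a} {+ 2} (+≤+ (s≤s z≤n)) (fit (≤-reflexive (trans (sym e) f)) (solve (a ∷ [])))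

  gain-arith : ∀ {p q b} → p + + 2 ≤ q + b + 1ℤ * (ℓ + + 2) → p + (+ 2 - b) ≤ q + (ℓ + + 2)
  gain-arith {p} {q} {b} r = fit r (solve (p ∷ q ∷ b ∷ ℓ ∷ []))

  gain-arith₁ : ∀ {p q} → p ≤ q + 1ℤ * (ℓ + + 2) → p ≤ q + (ℓ + + 2)
  gain-arith₁ {p} {q} r = fit r (solve (p ∷ q ∷ ℓ ∷ []))

  total-arith : (+ 2 * ((κ - 1ℤ) * ℓ + 1ℤ) - + 2 * ℓ * (κ - 1ℤ)) * κ + + 2 * ℓ * (1ℤ + 1ℤ) ≤ + 2 * (+ 2 * ℓ + κ) + 1ℤ
  total-arith = fit (0≤+ 1) (solve (κ ∷ ℓ ∷ []))

  add-arith : ∀ a b c → a + b + c ≡ a + (b + c)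
  add-arith a b c = solve (a ∷ b ∷ c ∷ [])

  E-double-arith : ∀ {e} → e ≤ 1ℤ - (+ 2 * ℓ + 1ℤ) * + 2 → e ≤ - (+ 4 * ℓ + 1ℤ) + (+ 2 * ℓ + 1ℤ) * 0ℤ
  E-double-arith {e} p = fit p (solve (e ∷ ℓ ∷ []))

  less-solve-it : ∀ n → n + + 4 ≡ + 3 + (n + 1ℤ)
  less-solve-it n = solve (n ∷ [])

  finish-good-arith : ∀ {r a b c e f} → r ≡ a + b + c → c ≡ 0ℤ → r + (ℓ - + 2) * e + + 4 ≤ a → r + (ℓ - + 2) * f + + 4 ≤ b → 0ℤ ≤ (ℓ - + 2) * e → 0ℤ ≤ (ℓ - + 2) * f → -[1+ 2 ] ≤ r → + 5 ≤ 0ℤ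
  finish-good-arith {_} {a} {b} {_} {e} {f} refl refl p q s t u = fit (p ⊕ q ⊕ s ⊕ t ⊕ u) (solve (a ∷ b ∷ e ∷ f ∷ ℓ ∷ []))

  finish-good-arith₁ : ∀ {r b} → -[1+ 0 ] ≤ r + b → + 2 * r + b ≤ -[1+ 5 ] → -[1+ 2 ] ≤ r → + 2 ≤ 0ℤ
  finish-good-arith₁ {r} {b} p q t = fit (p ⊕ q ⊕ t) (solve (r ∷ b ∷ []))

  finish-good-arith₂ : ∀ {r b c} → -[1+ 0 ] ≤ r + b → b ≡ 0ℤ → + 2 * r + c ≤ -[1+ 5 ] → 0ℤ ≤ c → + 4 ≤ 0ℤ
  finish-good-arith₂ {r} {_} {c} p refl q t = fit (2 ⋆ p ⊕ q ⊕ t) (solve (r ∷ c ∷ []))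

  light-arith : ∀ {r b} → 0ℤ ≤ b → r ≤ r + b
  light-arith {r} {b} p = fit p (solve (r ∷ b ∷ []))

  add-near-arith : ∀ {r u a b b′ c} → r ≡ u + a + c → u + b ≤ + 2 * ℓ + κ → a + b′ + c ≤ 0ℤ → 0ℤ ≤ b′ → r + b ≤ + 2 * ℓ + κ
  add-near-arith {_} {u} {a} {b} {b′} {c} refl p q s = fit (p ⊕ q ⊕ s) (solve (u ∷ a ∷ b ∷ b′ ∷ c ∷ ℓ ∷ κ ∷ []))

  add-near-arith₁ : ∀ {r u a b c} → r ≡ u + a + c → u ≤ + 2 * ℓ + κ → a + b + c ≤ 0ℤ → r + b ≤ + 2 * ℓ + κ
  add-near-arith₁ {_} {u} {a} {b} {c} refl p q = fit (p ⊕ q) (solve (u ∷ a ∷ b ∷ c ∷ ℓ ∷ κ ∷ []))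

  r≤-arith : ∀ {r} → r ≤ κ - 1ℤ → r ≢ κ - 1ℤ → r ≢ κ - + 2 → r ≤ κ - + 3
  r≤-arith {r} p q s = down₂ (stable λ t → s (≤-antisym (down₁ (stable λ u → q (≤-antisym p (up₁ (above u))))) (up₂ (above t))))
    where
    down₁ : r + 1ℤ ≤ κ - 1ℤ → r ≤ κ - + 2
    down₁ p = fit p (solve (r ∷ κ ∷ []))
    up₁ : κ - 1ℤ + 1ℤ ≤ r + 1ℤ → κ - 1ℤ ≤ r
    up₁ p = fit p (solve (r ∷ κ ∷ []))
    down₂ : r + 1ℤ ≤ κ - + 2 → r ≤ κ - + 3
    down₂ p = fit p (solve (r ∷ κ ∷ []))
    up₂ : κ - + 2 + 1ℤ ≤ r + 1ℤ → κ - + 2 ≤ r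
    up₂ p = fit p (solve (r ∷ κ ∷ []))

  gain-arith₂ : ∀ {a b c d} → a + + 2 ≤ b + c + d * (ℓ + + 2) → a + (+ 2 - c) ≤ b + (ℓ + + 2) * d
  gain-arith₂ {a} {b} {c} {d} p = fit p (solve (a ∷ b ∷ c ∷ d ∷ ℓ ∷ []))

  cyclic-arith : + 2 ≡ κ - + 2 → 1ℤ ≤ 0ℤ
  cyclic-arith e = fit (≥-cast e ⊕ κ≥5) (solve (κ ∷ []))

  complete-arith : ∀ {a n} → a ≡ n - 1ℤ → a ≡ κ - + 2 → n ≡ κ - 1ℤ
  complete-arith {_} {n} refl e = ≤-antisym (fit (≤-reflexive e) (solve (n ∷ κ ∷ []))) (fit (≥-cast e) (solve (n ∷ κ ∷ [])))

  E-double-one-more : ∀ {e} → e ≤ 1ℤ - (+ 2 * ℓ + 1ℤ) * + 1 → e ≤ - (+ 4 * ℓ + 1ℤ) + (+ 2 * ℓ + 1ℤ) * 1ℤ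
  E-double-one-more {e} p = fit p (solve (e ∷ ℓ ∷ []))

  Σ-E-double-K : 0ℤ ≤ + 2 * ℓ + 1ℤ
  Σ-E-double-K = fit (2 ⋆ ℓ≥0 ⊕ 0≤+ 1) (solve (ℓ ∷ []))

  start-arith : ∀ {H a o} → H ≡ + 4 * ℓ + 1ℤ → a ≤ - (+ 8 * ℓ + + 2) + (+ 2 * ℓ + 1ℤ) * o → + 2 * H + a ≤ (+ 2 * ℓ + 1ℤ) * o
  start-arith {_} {a} {o} refl p = fit p (solve (a ∷ o ∷ ℓ ∷ []))

  start-arith₁ : (+ 2 * ℓ + 1ℤ) * (1ℤ + 1ℤ) ≤ + 2 * (+ 2 * ℓ + κ) + 1ℤ
  start-arith₁ = fit (2 ⋆ κ≥5 ⊕ 0≤+ 9) (solve (κ ∷ ℓ ∷ []))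

  add-arith₁ : ∀ {H a b w u c o t} → H ≡ + 4 * ℓ + 1ℤ → w ≡ a + b → u ≤ b → w ≤ - (+ 8 * ℓ + + 2) + (+ 2 * ℓ + 1ℤ) * (c + o) → c ≡ 0ℤ → u + (+ 2 * ℓ + 1ℤ) * o ≤ t → + 2 * H + a + + 2 * u ≤ t
  add-arith₁ {_} {a} {b} {_} {u} {_} {o} {t} refl refl p q refl r = fit (p ⊕ q ⊕ r) (solve (a ∷ b ∷ u ∷ o ∷ t ∷ ℓ ∷ []))

  h-top-arith : ∀ κ → κ - + 2 + 1ℤ ≡ κ - 1ℤ
  h-top-arith κ = solve (κ ∷ [])

  cardW-arith : ∀ κ → κ - 1ℤ + 1ℤ ≡ κ
  cardW-arith κ = solve (κ ∷ [])

  low-bound-arith : ∀ {r b s} → r + b ≤ + 2 * ℓ - + 2 + s → 0ℤ ≤ b → s ≤ 1ℤ → r ≤ + 2 * ℓ - 1ℤ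
  low-bound-arith {r} {b} {s} p q t = fit (p ⊕ q ⊕ t) (solve (r ∷ b ∷ s ∷ ℓ ∷ []))

  few-edges-arith : ∀ {r s e} → -[1+ 2 ] ≤ r → r + (ℓ - + 2) * e + + 4 ≤ s → s ≤ + 2 * ℓ - 1ℤ → + 2 + 1ℤ ≤ e → + 2 ≤ 0ℤ
  few-edges-arith {r} {s} {e} p q t u = fit (p ⊕ q ⊕ t ⊕ scale ℓ-2≥0 u ⊕ ℓ≥6) (solve (r ∷ s ∷ e ∷ ℓ ∷ []))

  closed-arith : ∀ {a b c} → a ≡ b + c → a ≤ + 2 → 1ℤ + 1ℤ ≤ b → c ≤ 0ℤ
  closed-arith {_} {b} {c} refl p q = fit (p ⊕ q) (solve (b ∷ c ∷ []))

  third-out-arith : ∀ {a b c} → a ≡ b + c → a ≤ + 2 → 1ℤ + (1ℤ + 1ℤ) ≤ b → 0ℤ ≤ c → 1ℤ ≤ 0ℤ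
  third-out-arith {_} {b} {c} refl p q r = fit (p ⊕ q ⊕ r) (solve (b ∷ c ∷ []))

  halves-arith : ∀ {r s a b e f c g} → s ≡ a + b → r + (ℓ - + 2) * e + + 4 ≤ a → r + (ℓ - + 2) * f + + 4 ≤ b → 1ℤ ≤ e → 1ℤ ≤ f →
    s + c ≤ + 2 * ℓ - + 2 + g → g ≡ 0ℤ → + 2 * r + c ≤ -[1+ 5 ]
  halves-arith {r} {_} {a} {b} {e} {f} {c} refl p q t u z refl = fit (p ⊕ q ⊕ scale ℓ-2≥0 t ⊕ scale ℓ-2≥0 u ⊕ z) (solve (r ∷ a ∷ b ∷ e ∷ f ∷ c ∷ ℓ ∷ []))

  num-2κ-4≥0 : 0ℤ ≤ + 2 * κ - + 4
  num-2κ-4≥0 = fit (2 ⋆ κ≥5 ⊕ 0≤+ 6) (solve (κ ∷ []))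

  all-high-arith : ∀ {t c ν d p} → p ≡ t * ℓ + c → c ≤ 1ℤ → ν ≤ d → t + 1ℤ ≤ d → + 2 * p + (ν - (+ 2 * ℓ + 1ℤ) * d) ≤ -[1+ 9 ]
  all-high-arith {t} {c} {ν} {d} refl p r s = fit (2 ⋆ p ⊕ r ⊕ 2 ⋆ scale (≤-trans (0≤+ 6) ℓ≥6) s ⊕ 2 ⋆ ℓ≥6) (solve (t ∷ c ∷ ν ∷ d ∷ ℓ ∷ []))

  all-high-few-many : ∀ {n} → 1ℤ ≤ n → -[1+ 9 ] * n ≤ -[1+ 9 ]
  all-high-few-many {n} p = fit (10 ⋆ p) (solve (n ∷ []))

  Σ-shift-arith : ∀ a → - a ≡ -[1+ 0 ] * a
  Σ-shift-arith a = solve (a ∷ [])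

  Σ-shift-arith₁ : ∀ a → -[1+ 0 ] * a + a ≡ 0ℤ
  Σ-shift-arith₁ a = solve (a ∷ [])

  sparse-arith₁ : ∀ {a b c r r′ d e} → r ≡ a + b + c → c ≤ - (+ 2 * ℓ) * e → b + (+ 2 - d) ≤ r′ + (ℓ + + 2) * e → r′ + d ≤ -[1+ 1 ] →
    r + + 4 + (ℓ - + 2) * e ≤ a
  sparse-arith₁ {a} {b} {c} {_} {r′} {d} {e} refl p q s = fit (p ⊕ q ⊕ s) (solve (a ∷ b ∷ c ∷ r′ ∷ d ∷ e ∷ ℓ ∷ []))

  nb-complete-arith : ∀ {s a t b n} → s ≡ a + t → a ≡ 0ℤ → t ≡ b → n ≡ 1ℤ + b → s ≡ n - 1ℤ
  nb-complete-arith {t = t} refl refl refl refl = solve (t ∷ [])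

  bump-arith : ∀ s n → s - (+ 2 * ℓ + 1ℤ) * n ≡ 1ℤ - (+ 2 * ℓ + 1ℤ) * (n + 1ℤ) + (+ 2 * ℓ + s) * 1ℤ
  bump-arith s n = solve (s ∷ n ∷ ℓ ∷ [])

  long-arith : ∀ {a b c d e} → a ≤ b → b ≤ c + d → d ≤ e → a - e ≤ c
  long-arith {a} {b} {c} {d} {e} p q r = fit (p ⊕ q ⊕ r) (solve (a ∷ b ∷ c ∷ d ∷ e ∷ []))

  mult-out-arith : ∀ {a b n o} → a + b ≤ n → n ≤ b + o → a ≤ o
  mult-out-arith {a} {b} {n} {o} p q = fit (p ⊕ q) (solve (a ∷ b ∷ n ∷ o ∷ []))

  complete-arith₁ : ∀ {d} → d ≡ κ - + 2 → 1ℤ ≤ d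
  complete-arith₁ refl = fit (κ≥5 ⊕ 0≤+ 2) (solve (κ ∷ []))

  complete-arith₂ : ∀ {a d n} → a ≡ n - 1ℤ → d ≡ κ - + 2 → a ≤ d → 0ℤ ≤ κ - 1ℤ - n
  complete-arith₂ {_} {_} {n} refl refl p = fit p (solve (κ ∷ n ∷ []))

  complete-arith₃ : ∀ {n} → + 2 ≤ n → 0ℤ ≤ κ - 1ℤ - n → + 7 ≤ (κ - (n - 1ℤ)) * n
  complete-arith₃ {n} p q = fit (scale q p ⊕ 2 ⋆ κ≥5 ⊕ 0≤+ 1) (solve (n ∷ κ ∷ []))

  simple-arith : ∀ {a} → a + 1ℤ ≤ 1ℤ → a ≤ 0ℤ
  simple-arith {a} p = fit p (solve (a ∷ []))

  sparse-arith₂ : ∀ {r r′ b c} → r ≡ r′ + (+ 2 * ℓ + c) * 1ℤ → r′ + b ≤ -[1+ 1 ] → r + b ≤ + 2 * ℓ - + 2 + c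
  sparse-arith₂ {_} {r′} {b} {c} refl p = fit p (solve (r′ ∷ b ∷ c ∷ ℓ ∷ []))

  Hmax₅-arith : ∀ ℓ → (+ 5 - 1ℤ) * ℓ + 1ℤ ≡ + 4 * ℓ + 1ℤ
  Hmax₅-arith ℓ = solve (ℓ ∷ [])

  E-bound-arith : 0ℤ ≤ ℓ → 0ℤ ≤ + 2 * ℓ + 1ℤ
  E-bound-arith p = fit (2 ⋆ p ⊕ 0≤+ 1) (solve (ℓ ∷ []))

  E-bound-arith₁ : ∀ {a b n} → a ≤ 1ℤ → (+ 2 * ℓ + 1ℤ) * n ≤ (+ 2 * ℓ + 1ℤ) * b → a - (+ 2 * ℓ + 1ℤ) * b ≤ 1ℤ - (+ 2 * ℓ + 1ℤ) * n
  E-bound-arith₁ {a} {b} {n} p q = fit (p ⊕ q) (solve (a ∷ b ∷ n ∷ ℓ ∷ []))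

  near-arith : ∀ {H a b} → κ ≡ + 5 → H ≡ + 4 * ℓ + 1ℤ → a ≤ 1ℤ - (+ 2 * ℓ + 1ℤ) * + 3 → b ≤ 1ℤ - (+ 2 * ℓ + 1ℤ) * + 3 →
    + 2 * H + a + (+ 2 * H + b) ≤ + 2 * (+ 2 * ℓ + κ) + 1ℤ
  near-arith {_} {a} {b} e refl p q = subst (λ κ → + 2 * (+ 4 * ℓ + 1ℤ) + a + (+ 2 * (+ 4 * ℓ + 1ℤ) + b) ≤ + 2 * (+ 2 * ℓ + κ) + 1ℤ) (sym e)
    (fit (p ⊕ q ⊕ 0≤+ 11) (solve (ℓ ∷ a ∷ b ∷ [])))

  near-arith₁ : ∀ {H a b} → H ≡ + 4 * ℓ + 1ℤ → a ≤ 0ℤ → b ≤ 1ℤ - (+ 2 * ℓ + 1ℤ) * + 3 → + 2 * H + a + + 2 * b ≤ 0ℤ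
  near-arith₁ {_} {a} {b} refl p q = fit (p ⊕ 2 ⋆ q ⊕ 4 ⋆ ℓ≥0 ⊕ 0≤+ 2) (solve (ℓ ∷ a ∷ b ∷ []))

  exactly-arith : ∀ r κ → κ - + 2 + r ≡ r + (κ - + 3) + 1ℤ
  exactly-arith r κ = solve (r ∷ κ ∷ [])

  val-point-arith : (+ 2 * (κ - + 2) * (0ℤ - + 3) - + 2 * (κ - + 3) * 0ℤ - (+ 2 * κ - + 7) * (0ℤ - (1ℤ - 1ℤ))) * 1ℤ + + 6 * (κ - + 2) ≤ 0ℤ
  val-point-arith = fit (≤-refl {0ℤ}) (solve (κ ∷ []))

  val-pair-arith : (+ 2 * (κ - + 2) * (1ℤ - + 3) - + 2 * (κ - + 3) * 0ℤ - (+ 2 * κ - + 7) * (1ℤ - (+ 2 - 1ℤ))) * (+ 2) + + 6 * (κ - + 2) ≤ 0ℤ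
  val-pair-arith = fit (2 ⋆ κ≥5 ⊕ 0≤+ 6) (solve (κ ∷ []))

  by-cut-arith : ∀ {t a c z} → t ≡ a + c → a + z ≤ 0ℤ → c + z ≤ 0ℤ → 0ℤ ≤ z → t + z ≤ 0ℤ
  by-cut-arith {_} {a} {c} {z} refl p q r = fit (p ⊕ q ⊕ r) (solve (a ∷ c ∷ z ∷ []))

  by-cut-vertex-arith : ∀ {t p q a c v b d z} → t ≡ v + (a + c) → p ≡ b + a → q ≡ d + c → v ≤ b + d + z → p + z ≤ 0ℤ → q + z ≤ 0ℤ → t + z ≤ 0ℤ
  by-cut-vertex-arith {_} {_} {_} {a} {c} {v} {b} {d} {z} refl refl refl r s t = fit (r ⊕ s ⊕ t) (solve (a ∷ c ∷ v ∷ b ∷ d ∷ z ∷ []))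

  q≥0-arith : 0ℤ ≤ + 2 * κ - + 7
  q≥0-arith = fit (2 ⋆ κ≥5 ⊕ 0≤+ 3) (solve (κ ∷ []))

  paid-low-κ-3≥0 : 0ℤ ≤ + 2 * (κ - + 3)
  paid-low-κ-3≥0 = fit (2 ⋆ κ≥5 ⊕ 0≤+ 4) (solve (κ ∷ []))

  rho-minimal-arith : ∀ {r b} → r + b ≤ -[1+ 1 ] → 0ℤ ≤ b → r ≤ -[1+ 1 ]
  rho-minimal-arith {r} {b} p q = fit (p ⊕ q) (solve (r ∷ b ∷ []))

  floor-arith : ∀ {a b} → -[1+ 0 ] ≤ a + b → b ≤ + 2 → -[1+ 2 ] ≤ a
  floor-arith {a} {b} p q = fit (p ⊕ q) (solve (a ∷ b ∷ []))

  h-pos-small : ∀ {t} → t + 1ℤ ≤ 1ℤ → t ≤ 0ℤ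
  h-pos-small {t} p = fit p (solve (t ∷ []))

  h-pos-arith : ∀ {t c b} → View t c b → t ≤ 0ℤ → t * ℓ + c + b ≤ -[1+ 1 ]
  h-pos-arith (top refl) p = ⊥-elim (clash 3 (p ⊕ κ≥5) (solve (κ ∷ [])))
  h-pos-arith (sub refl) p = ⊥-elim (clash 2 (p ⊕ κ≥5) (solve (κ ∷ [])))
  h-pos-arith (mid p _) q = ⊥-elim (clash 1 (≤-trans p q) refl)
  h-pos-arith (one refl) (+≤+ ())
  h-pos-arith {t} (low p) q = fit (scale (≤-trans (0≤+ 6) ℓ≥6) p) (solve (t ∷ ℓ ∷ []))

  low-tight-arith : ∀ {a b c n r} → a ≡ b + c → a ≤ n → n ≤ r + c → b ≤ r
  low-tight-arith {_} {b} {c} {n} {r} refl p q = fit (p ⊕ q) (solve (b ∷ c ∷ n ∷ r ∷ []))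

  E-plus-same : ∀ a b c → a - (+ 2 * ℓ + 1ℤ) * b ≡ a - (+ 2 * ℓ + 1ℤ) * b + c * 0ℤ
  E-plus-same a b c = solve (a ∷ b ∷ c ∷ ℓ ∷ [])

  rho-plus-arith : ∀ a b c → a + (b + c) ≡ a + b + c
  rho-plus-arith a b c = solve (a ∷ b ∷ c ∷ [])

  rho-plus-arith₁ : ∀ r c i → + 2 * r + c * (i + i) ≡ + 2 * (r + c * i)
  rho-plus-arith₁ r c i = solve (r ∷ c ∷ i ∷ [])

  out≤1-arith : ∀ {a o} → a ≡ κ - + 2 + o → a ≤ κ - 1ℤ → o ≤ 1ℤ
  out≤1-arith {_} {o} refl p = fit p (solve (κ ∷ o ∷ []))

  cap-mono-arith : ∀ a b κ → κ - + 2 + (a + (b + + 5)) ≡ a + (b + (+ 2 + κ)) + 1ℤ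
  cap-mono-arith a b κ = solve (a ∷ b ∷ κ ∷ [])

  cap-mono-arith₁ : ∀ a b κ → κ - + 2 + (a + b) ≡ a + (b + (κ - + 3)) + 1ℤ
  cap-mono-arith₁ a b κ = solve (a ∷ b ∷ κ ∷ [])

  super-arith : ∀ a b → + 3 + (+ 3 + (a + b)) ≡ a + (b + + 2) + + 4
  super-arith a b = solve (a ∷ b ∷ [])

  super-arith₁ : ∀ a b κ → + 3 + (κ - + 2 + (a + b)) ≡ a + (b + (κ - 1ℤ)) + + 2
  super-arith₁ a b κ = solve (a ∷ b ∷ κ ∷ [])

  super-arith₂ : ∀ a b κ → κ - + 2 + (+ 3 + (a + b)) ≡ a + (b + (κ - 1ℤ)) + + 2
  super-arith₂ a b κ = solve (a ∷ b ∷ κ ∷ [])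

  super-arith₃ : ∀ a b κ → κ - + 2 + (κ - + 2 + (a + b + + 5)) ≡ a + (b + (κ - 1ℤ + κ)) + + 2
  super-arith₃ a b κ = solve (a ∷ b ∷ κ ∷ [])

  -- Change of the potential under an added edge

  module AddedWeight {N : ℕ} (g : Graph N) {x y : Fin N} (x≢y : x ≢ y) where
    open AddedEdge x y x≢y
    open Graphs g using (m; μ)

    -- The drop caused by the new edge is `2ℓ` for a new adjacency and `2ℓ + 1` otherwise, because
    -- only the first edge of a pair brings the summand 1.
    gap : ℤ
    gap = + 2 * ℓ + + sgn (m x y)

    E-plus : ∀ p q → Weights.E g p q ≡ Weights.E (plus g) p q + gap * (on (δ p q) 1ℤ + on (δ q p) 1ℤ)
    E-plus p q = go (δ p q) (δ q p) refl refl
      where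
      bump : ∀ n → + sgn n - (+ 2 * ℓ + 1ℤ) * + n ≡ + sgn (n ℕ.+ 1) - (+ 2 * ℓ + 1ℤ) * + (n ℕ.+ 1) + (+ 2 * ℓ + + sgn n) * 1ℤ
      bump n = trans (bump-arith (+ sgn n) (+ n)) (cong (λ a → a - (+ 2 * ℓ + 1ℤ) * (+ n + 1ℤ) + (+ 2 * ℓ + + sgn n) * 1ℤ) (cong (λ z → + sgn z) (ℕ.+-comm 1 n)))
      Eq : Bool → Bool → Set
      Eq b c = + sgn (m p q) - (+ 2 * ℓ + 1ℤ) * + m p q ≡ + sgn (m p q ℕ.+ (bit b ℕ.+ bit c)) - (+ 2 * ℓ + 1ℤ) * + (m p q ℕ.+ (bit b ℕ.+ bit c)) + gap * (on b 1ℤ + on c 1ℤ)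
      at-xy : m p q ≡ m x y → + sgn (m p q) - (+ 2 * ℓ + 1ℤ) * + m p q ≡ + sgn (m p q ℕ.+ 1) - (+ 2 * ℓ + 1ℤ) * + (m p q ℕ.+ 1) + gap * 1ℤ
      at-xy e = subst (λ n → + sgn n - (+ 2 * ℓ + 1ℤ) * + n ≡ + sgn (n ℕ.+ 1) - (+ 2 * ℓ + 1ℤ) * + (n ℕ.+ 1) + gap * 1ℤ) (sym e) (bump (m x y))
      eq : ∀ b c → δ p q ≡ b → δ q p ≡ c → Eq b c
      eq true true e f = ⊥-elim (x≢y (trans (proj₁ (δ-≡ {p} {q} e)) (sym (proj₂ (δ-≡ {q} {p} f)))))
      eq false false e f = trans (cong (λ n → + sgn n - (+ 2 * ℓ + 1ℤ) * + n) (sym (ℕ.+-identityʳ (m p q)))) (E-plus-same (+ sgn (m p q ℕ.+ 0)) (+ (m p q ℕ.+ 0)) gap)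
      eq true false e f = at-xy (sym (cong₂ m (proj₁ (δ-≡ {p} {q} e)) (proj₂ (δ-≡ {p} {q} e))))
      eq false true e f = at-xy (trans (Graph.m-sym g p q) (sym (cong₂ m (proj₁ (δ-≡ {q} {p} f)) (proj₂ (δ-≡ {q} {p} f)))))
      go : ∀ b c → δ p q ≡ b → δ q p ≡ c → Eq (δ p q) (δ q p)
      go b c e f = subst₂ Eq (sym e) (sym f) (eq b c e f)

    Σ-δ : ∀ Y p → Σₛ Y (λ q → on (δ p q) 1ℤ) ≡ on (⁅ x ⁆ p) (on (Y y) 1ℤ)
    Σ-δ Y p = trans (Σₛ-cong Y λ q _ → on-∧ (⁅ x ⁆ p) (⁅ y ⁆ q) 1ℤ) (trans (Σₛ-on Y (⁅ x ⁆ p) λ q → on (⁅ y ⁆ q) 1ℤ) (cong (on (⁅ x ⁆ p)) (Σₛ-at Y y λ _ → 1ℤ)))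

    Σ-δ′ : ∀ Y p → Σₛ Y (λ q → on (δ q p) 1ℤ) ≡ on (⁅ y ⁆ p) (on (Y x) 1ℤ)
    Σ-δ′ Y p = trans (Σₛ-cong Y λ q _ → trans (on-∧ (⁅ x ⁆ q) (⁅ y ⁆ p) 1ℤ) (on-on (⁅ x ⁆ q) (⁅ y ⁆ p) 1ℤ)) (trans (Σₛ-on Y (⁅ y ⁆ p) λ q → on (⁅ x ⁆ q) 1ℤ) (cong (on (⁅ y ⁆ p)) (Σₛ-at Y x λ _ → 1ℤ)))

    rho-plus : ∀ h S → Weights.rho g h S ≡ Weights.rho (plus g) h S + gap * on (S x) (on (S y) 1ℤ)
    rho-plus h S = *-cancelˡ-≡ (+ 2) _ _ (trans (Weights.rho-double g h S)
      (trans (Σₛ-cong S λ v _ → trans (cong (λ z → + 2 * P (h v) + z) (trans (Σₛ-cong S λ w _ → E-plus v w) (trans (Σₛ-+ S _ _)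
          (cong (λ z → Σₛ S (Weights.E (plus g) v) + z) (trans (Σₛ-* S gap _) (cong (gap *_) (trans (Σₛ-+ S _ _) (cong₂ _+_ (Σ-δ S v) (Σ-δ′ S v)))))))))
        (rho-plus-arith (+ 2 * P (h v)) (Σₛ S (Weights.E (plus g) v)) _))
      (trans (Σₛ-+ S _ _)
      (trans (cong₂ _+_ (sym (Weights.rho-double (plus g) h S)) (trans (Σₛ-* S gap _) (cong (gap *_) (trans (Σₛ-+ S _ _)
          (cong₂ _+_ (Σₛ-at S x λ _ → on (S y) 1ℤ) (trans (Σₛ-at S y λ _ → on (S x) 1ℤ) (on-on (S y) (S x) 1ℤ)))))))
      (rho-plus-arith₁ (Weights.rho (plus g) h S) gap (on (S x) (on (S y) 1ℤ)))))))

  -- Numerical part of the Gallai-type bound and of the discharging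

  opaque
    -- A compromise: bricks need this correction large, low vertices need it small, and cut vertices
    -- need it superadditive for total degree at most `κ - 1`. The value `κ - 5` is the largest that
    -- `paid-low` admits at `h = κ - 1`.
    cap : ℤ → ℤ
    cap d with d ≤? + 2 | d ≤? κ - + 3
    ... | yes _ | _ = 0ℤ
    ... | no _ | yes _ = d - + 2
    ... | no _ | no _ = κ - + 5

  data Cap (d : ℤ) : ℤ → Set where
    cap-lo : d ≤ + 2 → Cap d 0ℤ
    cap-mid : + 3 ≤ d → d ≤ κ - + 3 → Cap d (d - + 2)
    cap-hi : κ - + 2 ≤ d → Cap d (κ - + 5)

  opaque
    unfolding cap

    cap-view : ∀ d → Cap d (cap d)
    cap-view d with d ≤? + 2 | d ≤? κ - + 3
    ... | yes p | _ = cap-lo p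
    ... | no p | yes q = cap-mid (above p) q
    ... | no p | no q = cap-hi (lem (above q))
      where
      lem : κ - + 3 + 1ℤ ≤ d → κ - + 2 ≤ d
      lem r = fit r (solve (κ ∷ d ∷ []))

  cap-≤ : ∀ {d c} → Cap d c → c ≤ κ - + 5
  cap-≤ (cap-lo _) = fit κ≥5 (solve (κ ∷ []))
  cap-≤ {d} (cap-mid _ q) = fit q (solve (κ ∷ d ∷ []))
  cap-≤ (cap-hi _) = ≤-refl

  cap-nonneg : ∀ {d c} → Cap d c → 0ℤ ≤ c
  cap-nonneg (cap-lo _) = ≤-refl
  cap-nonneg {d} (cap-mid p _) = fit (p ⊕ 0≤+ 1) (solve (d ∷ []))
  cap-nonneg (cap-hi _) = fit κ≥5 (solve (κ ∷ []))

  cap-linear : ∀ {d c a} → Cap d c → d ≤ a → + 2 ≤ a → c ≤ a - + 2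
  cap-linear {a = a} (cap-lo _) _ q = fit q (solve (a ∷ []))
  cap-linear {d} {a = a} (cap-mid _ _) p _ = fit p (solve (d ∷ a ∷ []))
  cap-linear {d} {a = a} (cap-hi r) p _ = fit (r ⊕ p ⊕ 0≤+ 1) (solve (d ∷ a ∷ κ ∷ []))

  private
    cap-mono : ∀ {a b c c′} → Cap a c → Cap b c′ → a ≤ b → c ≤ c′
    cap-mono (cap-lo _) w _ = cap-nonneg w
    cap-mono (cap-mid p _) (cap-lo q) r = ⊥-elim (clash 0 (≤-trans p (≤-trans r q)) refl)
    cap-mono {a} {b} (cap-mid _ _) (cap-mid _ _) r = fit r (solve (a ∷ b ∷ []))
    cap-mono v@(cap-mid _ _) (cap-hi _) _ = cap-≤ v
    cap-mono {a} {b} (cap-hi p) (cap-lo q) r = ⊥-elim (clash 0 (p ⊕ r ⊕ q ⊕ κ≥5) (cap-mono-arith a b κ))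
    cap-mono {a} {b} (cap-hi p) (cap-mid _ q) r = ⊥-elim (clash 0 (p ⊕ r ⊕ q) (cap-mono-arith₁ a b κ))
    cap-mono (cap-hi _) (cap-hi _) _ = ≤-refl

    super : ∀ {a b c c₁ c₂} → Cap a c₁ → Cap b c₂ → Cap (a + b) c → 0ℤ ≤ a → 0ℤ ≤ b → a + b ≤ κ - 1ℤ → c₁ + c₂ ≤ c
    super {a} {b} {c} {_} {c₂} (cap-lo _) v w p q r = subst (_≤ c) (sym (+-identityˡ c₂)) (cap-mono v w (fit p (solve (a ∷ b ∷ []))))
    super {a} {b} {c} {c₁} v@(cap-mid _ _) (cap-lo _) w p q r = subst (_≤ c) (sym (+-identityʳ c₁)) (cap-mono v w (fit q (solve (a ∷ b ∷ []))))
    super {a} {b} {c} {c₁} v@(cap-hi _) (cap-lo _) w p q r = subst (_≤ c) (sym (+-identityʳ c₁)) (cap-mono v w (fit q (solve (a ∷ b ∷ []))))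
    super {a} {b} (cap-mid p₁ _) (cap-mid p₂ _) (cap-lo r) _ _ _ = ⊥-elim (clash 3 (p₁ ⊕ p₂ ⊕ r) (super-arith a b))
    super {a} {b} (cap-mid _ _) (cap-mid _ _) (cap-mid _ _) _ _ _ = fit (0≤+ 2) (solve (a ∷ b ∷ []))
    super {a} {b} (cap-mid _ _) (cap-mid _ _) (cap-hi _) _ _ r = fit r (solve (a ∷ b ∷ κ ∷ []))
    super {a} {b} (cap-mid p₁ _) (cap-hi p₂) _ _ _ r = ⊥-elim (clash 1 (p₁ ⊕ p₂ ⊕ r) (super-arith₁ a b κ))
    super {a} {b} (cap-hi p₁) (cap-mid p₂ _) _ _ _ r = ⊥-elim (clash 1 (p₁ ⊕ p₂ ⊕ r) (super-arith₂ a b κ))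
    super {a} {b} (cap-hi p₁) (cap-hi p₂) _ _ _ r = ⊥-elim (clash 1 (p₁ ⊕ p₂ ⊕ r ⊕ κ≥5) (super-arith₃ a b κ))

  -- The contribution of a vertex of degree d with ν neighbours to the Gallai-type bound.
  val : ℤ → ℤ → ℤ
  val d ν = + 2 * (κ - + 2) * (d - + 3) - + 2 * (κ - + 3) * cap d - (+ 2 * κ - + 7) * (d - ν)

  -- The summand -3 occurs twice on the right and once on the left; the surplus `3 * 2(κ - 2)` is
  -- the constant of the bound, which thus survives gluing at a cut vertex. The rest is
  -- superadditivity of `cap`.
  val-join : ∀ {a b ν₁ ν₂} → 0ℤ ≤ a → 0ℤ ≤ b → a + b ≤ κ - 1ℤ → val (a + b) (ν₁ + ν₂) ≤ val a ν₁ + val b ν₂ + + 6 * (κ - + 2)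
  val-join {a} {b} {ν₁} {ν₂} p q r = lem {cap a} {cap b} {cap (a + b)} (super (cap-view a) (cap-view b) (cap-view (a + b)) p q r)
    where
    κ-3≥0 : 0ℤ ≤ + 2 * (κ - + 3)
    κ-3≥0 = fit (2 ⋆ κ≥5 ⊕ 0≤+ 4) (solve (κ ∷ []))
    lem : ∀ {c₁ c₂ c} → c₁ + c₂ ≤ c → + 2 * (κ - + 2) * (a + b - + 3) - + 2 * (κ - + 3) * c - (+ 2 * κ - + 7) * (a + b - (ν₁ + ν₂)) ≤
      (+ 2 * (κ - + 2) * (a - + 3) - + 2 * (κ - + 3) * c₁ - (+ 2 * κ - + 7) * (a - ν₁)) + (+ 2 * (κ - + 2) * (b - + 3) - + 2 * (κ - + 3) * c₂ - (+ 2 * κ - + 7) * (b - ν₂)) + + 6 * (κ - + 2)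
    lem {c₁} {c₂} {c} s = fit (scale κ-3≥0 s) (solve (a ∷ b ∷ ν₁ ∷ ν₂ ∷ c₁ ∷ c₂ ∷ c ∷ κ ∷ []))

  private
    2κ-9≥0 : 0ℤ ≤ + 2 * κ - + 9
    2κ-9≥0 = fit (2 ⋆ κ≥5 ⊕ 0≤+ 1) (solve (κ ∷ []))

    Val : ℤ → ℤ → ℤ → ℤ → ℤ
    Val n r ν c = (+ 2 * (κ - + 2) * (r - + 3) - + 2 * (κ - + 3) * c - (+ 2 * κ - + 7) * (r - ν)) * n + + 6 * (κ - + 2)

    cyclic-num : ∀ {n r c} → Cap r c → + 3 ≤ n → + 2 ≤ r → r ≤ κ - + 3 → Val n r (+ 2) c ≤ 0ℤ
    cyclic-num {n} {r} {c} v p q s = lem (exactly v)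
      where
      exactly : ∀ {c} → Cap r c → c ≡ r - + 2
      exactly (cap-lo t) = subst (λ r → 0ℤ ≡ r - + 2) (≤-antisym q t) refl
      exactly (cap-mid _ _) = refl
      exactly (cap-hi t) = ⊥-elim (clash 0 (t ⊕ s) (exactly-arith r κ))
      lem : c ≡ r - + 2 → Val n r (+ 2) c ≤ 0ℤ
      lem refl = num
        where
        num : (+ 2 * (κ - + 2) * (r - + 3) - + 2 * (κ - + 3) * (r - + 2) - (+ 2 * κ - + 7) * (r - + 2)) * n + + 6 * (κ - + 2) ≤ 0ℤ
        num = fit (scale (0≤* 2κ-9≥0 (r-2≥0 q)) p ⊕ scale num-2κ-4≥0 p ⊕ scale (0≤* 2κ-9≥0 (r-2≥0 q)) (0≤+ 3)) (solve (n ∷ r ∷ κ ∷ []))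
         where
          r-2≥0 : + 2 ≤ r → 0ℤ ≤ r - + 2
          r-2≥0 q = fit q (solve (r ∷ []))

    -- A single vertex and a single edge lie below the range where `cap r` equals `r - 2` and are
    -- checked apart. For a single vertex the bound is an equality.
    complete-num : ∀ {n r c} → Cap r c → 1ℤ ≤ n → n - 1ℤ ≤ r → 0ℤ ≤ r → (1ℤ ≤ r → + 2 ≤ n) → r ≤ κ - + 3 → Val n r (n - 1ℤ) c ≤ 0ℤ
    complete-num {n} {r} v p q r≥0 two s with r ≤? 1ℤ | r ≤? 0ℤ
    ... | yes _ | yes r≤0 = lem v (≤-antisym r≤0 r≥0)
      where
      lem : ∀ {c} → Cap r c → r ≡ 0ℤ → Val n r (n - 1ℤ) c ≤ 0ℤ
      lem (cap-lo _) refl = subst (λ n → Val n 0ℤ (n - 1ℤ) 0ℤ ≤ 0ℤ) (≤-antisym p (fit q (solve (n ∷ [])))) val-point-arith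
      lem (cap-mid (+≤+ ()) _) refl
      lem (cap-hi t) refl = ⊥-elim (clash 2 (t ⊕ κ≥5) (solve (κ ∷ [])))
    ... | yes r≤1 | no r≰0 = lem v (≤-antisym r≤1 (above r≰0))
      where
      lem : ∀ {c} → Cap r c → r ≡ 1ℤ → Val n r (n - 1ℤ) c ≤ 0ℤ
      lem (cap-lo _) refl = subst (λ n → Val n 1ℤ (n - 1ℤ) 0ℤ ≤ 0ℤ) (≤-antisym (two ≤-refl) (fit q (solve (n ∷ [])))) val-pair-arith
      lem (cap-mid (+≤+ (s≤s ())) _) refl
      lem (cap-hi t) refl = ⊥-elim (clash 1 (t ⊕ κ≥5) (solve (κ ∷ [])))
    ... | no r≰1 | _ = lem (exactly v) (n ≤? + 2)
      where
      r≥2 : + 2 ≤ r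
      r≥2 = above r≰1
      exactly : ∀ {c} → Cap r c → c ≡ r - + 2
      exactly (cap-lo t) = subst (λ r → 0ℤ ≡ r - + 2) (≤-antisym r≥2 t) refl
      exactly (cap-mid _ _) = refl
      exactly (cap-hi t) = ⊥-elim (clash 0 (t ⊕ s) (exactly-arith r κ))
      slack : 0ℤ ≤ r - (n - 1ℤ)
      slack = fit q (solve (r ∷ n ∷ []))
      lem : ∀ {c} → c ≡ r - + 2 → Dec (n ≤ + 2) → Val n r (n - 1ℤ) c ≤ 0ℤ
      lem refl (yes n≤2) = subst (λ n → Val n r (n - 1ℤ) (r - + 2) ≤ 0ℤ) (≤-antisym (two (≤-trans (+≤+ (s≤s z≤n)) r≥2)) n≤2) num
        where
        num : (+ 2 * (κ - + 2) * (r - + 3) - + 2 * (κ - + 3) * (r - + 2) - (+ 2 * κ - + 7) * (r - (+ 2 - 1ℤ))) * (+ 2) + + 6 * (κ - + 2) ≤ 0ℤ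
        num = fit (2 ⋆ scale 2κ-9≥0 r≥2 ⊕ 2 ⋆ κ≥5) (solve (r ∷ κ ∷ []))
      lem refl (no n≰2) = num
        where
        num : (+ 2 * (κ - + 2) * (r - + 3) - + 2 * (κ - + 3) * (r - + 2) - (+ 2 * κ - + 7) * (r - (n - 1ℤ))) * n + + 6 * (κ - + 2) ≤ 0ℤ
        num = fit (2 ⋆ 0≤* n-3≥0 room ⊕ 0≤* (0≤* 2κ-9≥0 slack) (≤-trans (0≤+ 1) p)) (solve (r ∷ n ∷ κ ∷ []))
         where
          n-3≥0 : 0ℤ ≤ n - + 3
          n-3≥0 = fit (above n≰2) (solve (n ∷ []))
          room : 0ℤ ≤ κ - + 2 - n
          room = fit (q ⊕ s) (solve (r ∷ n ∷ κ ∷ []))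

  private
    2κ-7≥0 : 0ℤ ≤ + 2 * κ - + 7
    2κ-7≥0 = q≥0-arith

    2κ-4≥0′ : 0ℤ ≤ + 2 * (κ - + 2)
    2κ-4≥0′ = fit (2 ⋆ κ≥5 ⊕ 0≤+ 6) (solve (κ ∷ []))

    corr≤1 : ∀ {t c b} → View t c b → c ≤ 1ℤ
    corr≤1 (top _) = ≤-refl
    corr≤1 (sub _) = -≤+
    corr≤1 (mid _ _) = -≤+
    corr≤1 (one _) = -≤+
    corr≤1 (low _) = -≤+

    -- Every charge must be at most 0, and the charge of one chosen vertex must leave room for its bonus.
    Paid : ℤ → ℤ → Set
    Paid a b = a ≤ 0ℤ × a + + 2 * (+ 2 * κ - + 7) * b ≤ + 2 * κ + 1ℤ

    paid-low : ∀ {h c b d p} → View h c b → Cap d p → d ≤ h → 1ℤ ≤ h →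
      Paid (+ 2 * (+ 2 * κ - + 7) * c - + 2 * (κ - + 2) * h + + 6 * (κ - + 2) + + 2 * (κ - + 3) * p) b
    paid-low {p = p} (top refl) v r s = num , subst (_≤ + 2 * κ + 1ℤ) (sym (trans (cong (λ z → A + z) (*-zeroʳ (+ 2 * (+ 2 * κ - + 7)))) (+-identityʳ A))) (≤-trans num (≤-trans (0≤+ 11) (fit (2 ⋆ κ≥5) (solve (κ ∷ [])))))
      where
      A : ℤ
      A = + 2 * (+ 2 * κ - + 7) * 1ℤ - + 2 * (κ - + 2) * (κ - 1ℤ) + + 6 * (κ - + 2) + + 2 * (κ - + 3) * p
      num : + 2 * (+ 2 * κ - + 7) * 1ℤ - + 2 * (κ - + 2) * (κ - 1ℤ) + + 6 * (κ - + 2) + + 2 * (κ - + 3) * p ≤ 0ℤ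
      num = fit (scale paid-low-κ-3≥0 (cap-≤ v)) (solve (κ ∷ p ∷ []))
    paid-low {p = p} (sub refl) v r s = fit (scale paid-low-κ-3≥0 (cap-≤ v) ⊕ 6 ⋆ κ≥5 ⊕ 0≤+ 6) (solve (κ ∷ p ∷ [])) , fit (scale paid-low-κ-3≥0 (cap-≤ v) ⊕ 0≤+ 5) (solve (κ ∷ p ∷ []))
    paid-low {h = h} {p = p} (mid t _) v r s = fit (scale paid-low-κ-3≥0 (cap-linear v r t) ⊕ 2 ⋆ t ⊕ 2 ⋆ κ≥5) (solve (κ ∷ p ∷ h ∷ []))
        , fit (scale paid-low-κ-3≥0 (cap-linear v r t) ⊕ 2 ⋆ t ⊕ 0≤+ 5) (solve (κ ∷ p ∷ h ∷ []))
    paid-low {p = p} (one refl) v r s = fit (scale paid-low-κ-3≥0 none′ ⊕ 4 ⋆ κ≥5) (solve (κ ∷ p ∷ [])) , fit (scale paid-low-κ-3≥0 none′ ⊕ 2 ⋆ κ≥5 ⊕ 0≤+ 5) (solve (κ ∷ p ∷ []))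
      where
      none′ : p ≤ + 2 - + 2
      none′ = cap-linear v (≤-trans r (+≤+ (s≤s z≤n))) ≤-refl
    paid-low (low t) v r s = ⊥-elim (clash 0 (≤-trans s t) refl)

    -- Once `ℓ` is eliminated through `quadratic`, the charge decreases with the degree, so degree
    -- `h + 1` is the worst case. At `h = κ - 1` the bound is then exactly 0; this is the origin of
    -- the value of λ.
    paid-high : ∀ {h c b d} → View h c b → 1ℤ ≤ h → h + 1ℤ ≤ d → Paid (+ 2 * (+ 2 * κ - + 7) * (h * ℓ + c - ℓ * d) + + 2 * (κ - + 2) * d) b
    paid-high {h} {c} {b} {d} w h≥1 hd = ≤-trans reduce (proj₁ (level w)) , ≤-trans (reduce ⊕ ≤-refl {+ 2 * (+ 2 * κ - + 7) * b}) (proj₂ (level w))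
      where
      t≥0 : 0ℤ ≤ d - h - 1ℤ
      t≥0 = fit hd (solve (h ∷ d ∷ []))
      t+1≥0 : 0ℤ ≤ d - h
      t+1≥0 = fit (hd ⊕ 0≤+ 1) (solve (h ∷ d ∷ []))
      square : + 5 * κ ≤ κ * κ
      square = fit (scale {c = κ} (≤-trans (0≤+ 5) κ≥5) κ≥5) (solve (κ ∷ []))
      slope : 0ℤ ≤ κ * κ - κ - + 5
      slope = fit (square ⊕ 4 ⋆ κ≥5 ⊕ 0≤+ 15) (solve (κ ∷ []))
      reduce : + 2 * (+ 2 * κ - + 7) * (h * ℓ + c - ℓ * d) + + 2 * (κ - + 2) * d ≤ + 2 * (+ 2 * κ - + 7) * c + + 2 * (κ - + 2) * (h + 1ℤ) - + 2 * (κ * κ - + 7)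
      reduce = fit (2 ⋆ scale t+1≥0 quadratic ⊕ 2 ⋆ 0≤* slope t≥0) (solve (h ∷ c ∷ d ∷ κ ∷ ℓ ∷ []))
      level : ∀ {h c b} → View h c b → Paid (+ 2 * (+ 2 * κ - + 7) * c + + 2 * (κ - + 2) * (h + 1ℤ) - + 2 * (κ * κ - + 7)) b
      level (top refl) = fit (≤-refl {0ℤ}) (solve (κ ∷ [])) , fit (2 ⋆ κ≥5 ⊕ 0≤+ 11) (solve (κ ∷ []))
      level (sub refl) = fit (10 ⋆ κ≥5 ⊕ 0≤+ 18) (solve (κ ∷ [])) , fit (4 ⋆ κ≥5 ⊕ 0≤+ 17) (solve (κ ∷ []))
      level {h} (mid _ r) = fit (scale 2κ-4≥0′ r ⊕ 12 ⋆ κ≥5 ⊕ 0≤+ 24) (solve (κ ∷ h ∷ [])) , fit (scale 2κ-4≥0′ r ⊕ 10 ⋆ κ≥5 ⊕ 0≤+ 29) (solve (κ ∷ h ∷ []))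
      level (one refl) = fit (2 ⋆ square ⊕ 14 ⋆ κ≥5 ⊕ 0≤+ 36) (solve (κ ∷ [])) , fit (2 ⋆ square ⊕ 12 ⋆ κ≥5 ⊕ 0≤+ 41) (solve (κ ∷ []))
      level {h} (low r) = fit (scale 2κ-4≥0′ r ⊕ 2 ⋆ square ⊕ 16 ⋆ κ≥5 ⊕ 0≤+ 42) (solve (κ ∷ h ∷ [])) , fit (scale 2κ-4≥0′ r ⊕ 2 ⋆ square ⊕ 18 ⋆ κ≥5 ⊕ 0≤+ 53) (solve (κ ∷ h ∷ []))

  -- A minimal counterexample and the potentials of its subsets

  Goal : ∀ {N} → ℕ → Sub N → Set
  Goal {N} K X = ∀ {g : Graph N} (Γ : Conflicts g (suc K)) l (h : Fin N → ℤ) → (∀ v → v ∈ X → h v ≤ len l v) →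
    (∀ v → h v ≤ κ - 1ℤ) → (∀ Y → Y ⊆ X → ¬ Weights.Bad g h Y) → ¬ Weights.Exceptional g X → Colouring.Colourable Γ X l

  record Counterexample {N : ℕ} (K : ℕ) (X : Sub N) : Set where
    field
      minimal : ∀ Y → Y ⊂ X → Goal K Y
      {g} : Graph N
      Γ : Conflicts g (suc K)
      l : Lists N (suc K)
      h : Fin N → ℤ
      long : ∀ v → v ∈ X → h v ≤ len l v
      hκ : ∀ v → h v ≤ κ - 1ℤ
      sparse : ∀ Y → Y ⊆ X → ¬ Weights.Bad g h Y
      plain : ¬ Weights.Exceptional g X
      uncol : ¬ Colouring.Colourable Γ X l

  module Critical {N K : ℕ} {X : Sub N} (I : Counterexample K X) where
    open Counterexample I public
    open Bricks Γ public
    open Weights g public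

    proper-col : ∀ {Y} → Y ⊂ X → Colourable Y l
    proper-col {Y} s = minimal Y s Γ l h (λ v → long v ∘ proj₁ s v) hκ (λ Z t → sparse Z (⊆-trans t (proj₁ s))) (plain ∘ Exceptional-⊆ (proj₁ s))

    part-⊂ : ∀ {Y Z} → Part X Y Z → Nonempty Z → Y ⊂ X
    part-⊂ p (z , zZ) = part-left p , z , part-right p z zZ , part-disjoint (part-sym p) zZ

    ne : Nonempty X
    ne = case any? (λ v → X v Bool.≟ true) of λ where
      (yes p) → p
      (no n) → ⊥-elim (uncol ((λ _ → zero) , colours (λ v x → ⊥-elim (n (v , x))) λ v w x → ⊥-elim (n (v , x))))

    -- A colouring of Y leaves an uncolourable residue on Z, which by minimality contains a bad set Y′;
    -- adding Y′ to Y lowers the potential.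
    grow : ∀ {Y Z} → Part X Y Z → Nonempty Y → Nonempty Z →
      (∀ {Y′ Z′ Y″} → Part Z Y′ Z′ → Nonempty Y′ → Part Y″ Y Y′ → rho h Y″ + + 4 + (ℓ - + 2) * edges Y Y′ ≤ rho h Y → ⊥) → ⊥
    grow {Y} {Z} part neY neZ k = uncol (combine part col (minimal Z Z⊂X Γ (resid Y φ l) h′ long′ hκ′ sparse′ (plain ∘ Exceptional-⊆ (proj₁ Z⊂X))))
      where
      coloured : Colourable Y l
      coloured = proper-col (part-⊂ part neZ)
      φ : Fin N → Fin (suc K)
      φ = proj₁ coloured
      col : Colours Y l φ
      col = proj₂ coloured
      Z⊂X : Z ⊂ X
      Z⊂X = part-⊂ (part-sym part) neY
      h′ : Fin N → ℤ
      h′ v = h v - deg Y v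
      long′ : ∀ v → v ∈ Z → h′ v ≤ len (resid Y φ l) v
      long′ v vZ = absurd-arith (long v (proj₁ Z⊂X v vZ)) (resid-len Y φ l v)
      hκ′ : ∀ v → h′ v ≤ κ - 1ℤ
      hκ′ v = absurd-arith₁ (hκ v) (deg-nonneg Y v)
      sparse′ : ∀ Y′ → Y′ ⊆ Z → ¬ Bad h′ Y′
      sparse′ Y′ s (neY′ , bad) = go (any? (λ v → (Y′ v Bool.≟ true) ×-dec (1ℤ ≤? deg Y v)))
        where
        same : (¬ ∃ λ v → v ∈ Y′ × 1ℤ ≤ deg Y v) → ∀ w → w ∈ Y′ → h w ≡ h′ w
        same n w wY′ = lem (≤-antisym (stable λ q → n (w , wY′ , above q)) (deg-nonneg Y w))
          where
          lem : ∀ {d} → d ≡ 0ℤ → h w ≡ h w - d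
          lem refl = sym (+-identityʳ (h w))
        partY : Part (λ v → Y v ∨ Y′ v) Y Y′
        partY = part-∨ λ v vY′ → part-disjoint (part-sym part) (s v vY′)
        gain : ∀ {u} → u ∈ Y′ → 1ℤ ≤ deg Y u → rho h Y′ + (+ 2 - bonus (h′ u)) ≤ rho h′ Y′ + (ℓ + + 2) * edges Y Y′
        gain {u} uY′ pos = ≤-trans (rho-gain {h} {h′} Y′ {λ v → (ℓ + + 2) * deg Y v} {+ 2 - bonus (h′ u)}
            (λ v _ → subst (λ z → P (h v) ≤ P (h′ v) + z) (*-comm (deg Y v) (ℓ + + 2)) (P-weak (hκ v) (deg-nonneg Y v)))
            uY′ (gain-arith₂ {P (h u)} {P (h′ u)} {bonus (h′ u)} {deg Y u} (P-gain (hκ u) pos)))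
          (≤-reflexive (cong (λ z → rho h′ Y′ + z) (trans (Σₛ-* Y′ (ℓ + + 2) (deg Y)) (cong ((ℓ + + 2) *_) (edges-swap Y′ Y)))))
        go : Dec (∃ λ v → v ∈ Y′ × 1ℤ ≤ deg Y v) → ⊥
        -- Without edges from `Y` the values of `h` on `Y′` are unchanged, and `Y′` would be bad
        -- from the outset.
        go (no n) = sparse Y′ (⊆-trans s (proj₁ Z⊂X)) (bad-cong (same n) (neY′ , bad))
        go (yes (u , uY′ , pos)) = k (part-∖ s) neY′ partY (sparse-arith₁ {rho h Y} {rho h Y′} {r′ = rho h′ Y′} {d = bonus (h′ u)} (rho-part partY h) (cross-≤ Y Y′) (gain uY′ pos) (bad u uY′))

    -- Repeated growth of `Y` until `Z` is exhausted. Edges from `Y` to the absorbed set are paid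
    -- for when it is absorbed; those from `Y` to what remains are among the edges from the enlarged
    -- set and are paid for later.
    rho-cut : ∀ {Y Z} → Part X Y Z → Nonempty Y → Nonempty Z → rho h X + (ℓ - + 2) * edges Y Z + + 4 ≤ rho h Y
    rho-cut {Y} {Z} part neY neZ = ⊂-rec (λ Z → ∀ Y → Part X Y Z → Nonempty Y → Nonempty Z → rho h X + (ℓ - + 2) * edges Y Z + + 4 ≤ rho h Y)
        step Z Y part neY neZ
      where
      step : ∀ Z → (∀ Z′ → Z′ ⊂ Z → ∀ Y → Part X Y Z′ → Nonempty Y → Nonempty Z′ → rho h X + (ℓ - + 2) * edges Y Z′ + + 4 ≤ rho h Y) →
        ∀ Y → Part X Y Z → Nonempty Y → Nonempty Z → rho h X + (ℓ - + 2) * edges Y Z + + 4 ≤ rho h Y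
      step Z rec Y part neY neZ = stable λ neg → grow part neY neZ λ {Y′} {Z′} {Y″} pz neY′ py small → neg (next pz neY′ py small)
        where
        next : ∀ {Y′ Z′ Y″} → Part Z Y′ Z′ → Nonempty Y′ → Part Y″ Y Y′ → rho h Y″ + + 4 + (ℓ - + 2) * edges Y Y′ ≤ rho h Y →
          rho h X + (ℓ - + 2) * edges Y Z + + 4 ≤ rho h Y
        next {Y′} {Z′} {Y″} pz neY′ py small = go (any? (λ v → Z′ v Bool.≟ true))
          where
          go : Dec (∃ λ v → v ∈ Z′) → rho h X + (ℓ - + 2) * edges Y Z + + 4 ≤ rho h Y
          go (yes neZ′) = rho-cut-arith {rho h X} (rec Z′ (part-right pz , proj₁ neY′ , part-left pz _ (proj₂ neY′) , part-disjoint pz (proj₂ neY′)) Y″ (part-merge part pz py)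
                (proj₁ neY , part-left py _ (proj₂ neY)) neZ′) small (edges-partʳ pz Y) (edges-part py Z′) (0≤* ℓ-2≥0 (edges-nonneg Y′ Z′))
          go (no none′) = rho-cut-arith₁ {e₁ = edges Y Y′} (rho-ext h (part-all (part-merge part pz py) none′)) small (edges-partʳ pz Y)
                (trans (edges-swap Y Z′) (∑-zero λ v → cong (λ b → on b (deg Y v)) (≢true λ e → none′ (v , e))))

    -- The lower bound against which the final contradictions are measured: `X` itself is not bad.
    witness : (∀ v → v ∈ X → -[1+ 0 ] ≤ rho h X + bonus (h v) → ⊥) → ⊥
    witness k = sparse X (λ _ x → x) (ne , λ v vX → stable λ q → k v vX (above q))

    floor : -[1+ 2 ] ≤ rho h X
    floor = stable λ q → witness λ v vX p → q (floor-arith p (bonus≤2 (view (h v) (hκ v))))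

    -- Otherwise the vertex alone would be a bad set: its potential is at most -2 and its bonus is
    -- 0.
    h-pos : ∀ {v} → v ∈ X → 1ℤ ≤ h v
    h-pos {v} vX = stable λ q → sparse ⁅ v ⁆ (λ w e → subst (_∈ X) (⁅⁆-≡ e) vX) ((v , ∈⁅⁆ v) , λ w e →
      subst (λ w → rho h ⁅ v ⁆ + bonus (h w) ≤ -[1+ 1 ]) (⁅⁆-≡ e)
        (≤-trans (≤-reflexive (cong (_+ bonus (h v)) (trans (rho-single h v) (P-def (h v))))) (h-pos-arith (view (h v) (hκ v)) (h-pos-small (above q)))))

    h≤deg : ∀ {v} → v ∈ X → h v ≤ deg X v
    h≤deg {v} vX = stable λ q → uncol (extend vX (λ r → q (≤-trans (long v vX) r)) (proper-col (⊝-⊂ X vX)))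

    low-tight : ∀ {D φ} → D ⊆ X → (∀ {v} → v ∈ D → deg X v ≤ h v) → Colours (X ∖ D) l φ → Tight D (resid (X ∖ D) φ l)
    low-tight {D} {φ} s few col = tight (λ c → uncol (combine (part-sym (part-∖ s)) col c)) λ v vD →
      low-tight-arith (deg-part (part-∖ s) v) (≤-trans (few vD) (long v (s v vD))) (resid-len (X ∖ D) φ l v)

    rest-col : ∀ {D} → D ⊆ X → Nonempty D → Colourable (X ∖ D) l
    rest-col s n = proper-col (part-⊂ (part-sym (part-∖ s)) n)
    open Blocks g using (Complete; TwoNeighbours; two-neighbours; complete-or-cyclic; pendant-conn)

    -- 2-connected sets of low vertices

    record LowBrick (D : Sub N) : Set where
      field
        D⊆X : D ⊆ X
        few : ∀ {v} → v ∈ D → deg X v ≤ h v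
        nonempty : Nonempty D
        two : TwoConn D

    module Brick {D : Sub N} (brick : LowBrick D) where
      open LowBrick brick public

      rest-tight : ∀ {φ} → Colours (X ∖ D) l φ → Tight D (resid (X ∖ D) φ l)
      rest-tight = low-tight D⊆X few

      some-rest : Colourable (X ∖ D) l
      some-rest = rest-col D⊆X nonempty

      private
        some-tight : Tight D (resid (X ∖ D) (proj₁ some-rest) l)
        some-tight = rest-tight (proj₂ some-rest)

      -- By `mult-≤`, `u` has at least as many edges to `w` as to `v`.
      link : ∀ {v u w} → v ∈ D → u ∈ D → w ∈ D → v ~ u → v ~ w → u ≢ w → Conn (D ⊝ w ⊝ u) → u ~ w
      link {v} {u} {w} vD uD wD vu vw u≢w c e = clash 0 (≤-trans (~-pos vu) (≤-trans
        (mult-≤ some-tight vD uD wD (~-≢ vu) u≢w vw (conn⊝ two v vD) (conn⊝ two w wD) c)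
        (≤-reflexive (cong +_ (trans (m-sym w u) e))))) refl

      shape : (Complete D → ⊥) → ((∀ v → v ∈ D → TwoNeighbours D v) → ⊥) → ⊥
      shape = complete-or-cyclic two link

      nb-complete : Complete D → ∀ {v} → v ∈ D → nb D v ≡ card D - 1ℤ
      nb-complete c {v} vD = nb-complete-arith {b = card (D ⊝ v)} (Σₛ-remove D vD (adj v)) (cong (λ z → + sgn z) (m-irr v)) (Σₛ-cong (D ⊝ v) λ w q → adj-one (c vD (∧-left q) (⊝-≢ D q))) (card-remove D vD)

      module _ {v : Fin N} (t : TwoNeighbours D v) where
        open TwoNeighbours t

        stranger : ∀ w → w ∈ D → a ≢ w → b ≢ w → m v w ≡ 0
        stranger w wD p q = decidable-stable (m v w ℕ.≟ 0) λ e → case only wD e of λ { (inj₁ r) → p (sym r) ; (inj₂ r) → q (sym r) }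

        nb-two : nb D v ≡ + 2
        nb-two = trans (Σₛ-pair D a∈ b∈ a≢b λ w wD p q → cong (λ z → + sgn z) (stranger w wD p q)) (cong₂ _+_ (adj-one a~) (adj-one b~))

        deg-two : deg D v ≡ μ v a + μ v b
        deg-two = Σₛ-pair D a∈ b∈ a≢b λ w wD p q → cong +_ (stranger w wD p q)

        card-two : v ∈ D → + 3 ≤ card D
        card-two vD = deg-vw-three (card-remove D vD) (card-remove (D ⊝ v) (⊝-intro D a∈ (~-≢ a~))) (card-pos (D ⊝ v ⊝ a) (⊝-intro (D ⊝ v) (⊝-intro D b∈ (~-≢ b~)) a≢b))

        -- `path-mult-≤` in both directions. Deleting one neighbour leaves `v` pendant at the other,
        -- so deleting `v` as well keeps the rest connected.
        even-split : (∀ {u} → u ∈ D → deg D v ≡ deg D u) → v ∈ D → μ v a ≡ μ v b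
        even-split _ vD = ≤-antisym
          (path-mult-≤ two some-tight b∈ vD a∈ (a≢b ∘ sym) b~ a~ (trans (m-sym b a) a≁b) (trans deg-two (+-comm (μ v a) (μ v b)))
            (pendant-conn (conn⊝ two b b∈) (⊝-intro D vD (~-≢ (~-sym b~))) λ cD vc → case only (∧-left cD) vc of λ { (inj₁ e) → e ; (inj₂ e) → ⊥-elim (⊝-≢ D cD (sym e)) }))
          (path-mult-≤ two some-tight a∈ vD b∈ a≢b a~ b~ a≁b deg-two
            (pendant-conn (conn⊝ two a a∈) (⊝-intro D vD (~-≢ (~-sym a~))) λ cD vc → case only (∧-left cD) vc of λ { (inj₂ e) → e ; (inj₁ e) → ⊥-elim (⊝-≢ D cD (sym e)) }))

      complete-mult : Complete D → ∀ {v u w} → v ∈ D → u ∈ D → w ∈ D → v ≢ u → u ≢ w → v ≢ w → μ v u ≤ μ w u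
      complete-mult c {v} {u} {w} vD uD wD v≢u u≢w v≢w = mult-≤ some-tight vD uD wD v≢u u≢w (c vD wD v≢w) (conn⊝ two v vD) (conn⊝ two w wD)
        λ { (cut part (a , aA) (b , bB) apart) → c (∧-left (∧-left (part-left part a aA))) (∧-left (∧-left (part-right part b bB)))
              (λ { refl → tf bB (part-disjoint part aA) }) (apart aA bB) }

      -- `complete-mult` moves one end of an edge without lowering its multiplicity, and two moves
      -- reach every pair.
      complete-double : Complete D → ∀ {v w} → v ∈ D → w ∈ D → v ≢ w → + 2 ≤ μ v w → ∀ {x y} → x ∈ D → y ∈ D → x ≢ y → + 2 ≤ μ x y
      complete-double c {v} {w} vD wD v≢w vw {x} {y} xD yD x≢y = case y Fin.≟ w of λ
        { (yes refl) → toW xD x≢y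
        ; (no y≢w) → case x Fin.≟ w of λ
          { (yes refl) → subst (+ 2 ≤_) (μ-sym y x) (toW yD y≢w)
          ; (no x≢w) → ≤-trans (toW yD y≢w) (≤-trans (≤-reflexive (μ-sym y w)) (≤-trans (complete-mult c wD yD xD (y≢w ∘ sym) (x≢y ∘ sym) (x≢w ∘ sym)) ≤-refl)) } }
        where
        toW : ∀ {x} → x ∈ D → x ≢ w → + 2 ≤ μ x w
        toW {x} xD x≢w = case x Fin.≟ v of λ
          { (yes refl) → vw ; (no x≢v) → ≤-trans vw (complete-mult c vD wD xD v≢w (x≢w ∘ sym) (x≢v ∘ sym)) }

      some-double : ∀ {v} → nb D v + 1ℤ ≤ deg D v → ∃ λ w → w ∈ D × + 2 ≤ μ v w
      some-double {v} p = decidable-stable (any? (λ w → (D w Bool.≟ true) ×-dec (+ 2 ≤? μ v w))) λ n → ⊥-elim (clash 0 (≤-trans p (Σₛ-mono D λ w wD → lem (m v w) λ q → n (w , wD , q))) refl)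
        where
        lem : ∀ n → ¬ + 2 ≤ + n → + n ≤ + sgn n
        lem zero _ = ≤-refl
        lem (suc zero) _ = ≤-refl
        lem (suc (suc n)) q = ⊥-elim (q (+≤+ (s≤s (s≤s z≤n))))

      nb≤deg : ∀ v → nb D v ≤ deg D v
      nb≤deg v = Σₛ-mono D λ w _ → adj≤μ v w

      card≥2 : ∀ {v} → v ∈ D → 1ℤ ≤ deg D v → + 2 ≤ card D
      card≥2 {v} vD p = let (w , wD , q) = Σₛ-some D p in subst (+ 2 ≤_) (sym (card-remove D vD)) (≤-refl {1ℤ} ⊕ card-pos (D ⊝ v) (⊝-intro D wD (pos-≢ q)))

      deg≤h : ∀ {v} → v ∈ D → deg D v ≤ h v
      deg≤h vD = ≤-trans (deg-⊆ D⊆X _) (few vD)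

      not-bad : ∀ {b} → (∀ {v} → v ∈ D → bonus (h v) ≤ b) → ¬ (+ 2 * rho h D ≤ -[1+ 2 ] - + 2 * b)
      not-bad {b} p q = sparse D D⊆X (nonempty , λ v vD → half-≤ (lem q (p vD)))
        where
        lem : ∀ {r c} → + 2 * r ≤ -[1+ 2 ] - + 2 * b → c ≤ b → + 2 * (r + c) ≤ + 2 * -[1+ 1 ] + 1ℤ
        lem {r} {c} s t = fit (s ⊕ 2 ⋆ t) (solve (r ∷ c ∷ b ∷ []))

      module Top (full : ∀ {v} → v ∈ D → deg D v ≡ κ - 1ℤ) where
        private
          h-top : ∀ {v} → v ∈ D → h v ≡ κ - 1ℤ
          h-top {v} vD = ≤-antisym (hκ v) (subst (_≤ h v) (full vD) (deg≤h vD))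

          no-bonus : ∀ {v} → v ∈ D → bonus (h v) ≤ 0ℤ
          no-bonus vD = ≤-reflexive (trans (cong bonus (h-top vD)) (proj₂ P-top))

          -- The terms with `ℓ` cancel: twice the potential of `D` is `(ν + 3 - κ)` times its
          -- cardinality, and no bonus is available at `h = κ - 1`.
          big : ∀ ν → (∀ {v} → v ∈ D → nb D v ≡ ν) → ¬ (+ 3 ≤ (κ - + 3 - ν) * card D)
          big ν p q = not-bad no-bonus (lem (rho-const {h} {D} λ v vD → trans (cong P (h-top vD)) (proj₁ P-top) , p vD , full vD) q)
            where
            lem : ∀ {r n} → + 2 * r ≡ (+ 2 * ((κ - 1ℤ) * ℓ + 1ℤ) + (ν - (+ 2 * ℓ + 1ℤ) * (κ - 1ℤ))) * n → + 3 ≤ (κ - + 3 - ν) * n → + 2 * r ≤ -[1+ 2 ] - + 2 * 0ℤ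
            lem {r} {n} e s = fit (≤-reflexive e ⊕ s) (solve (r ∷ n ∷ ν ∷ κ ∷ ℓ ∷ []))

          pos : ∀ {v} → v ∈ D → 1ℤ ≤ deg D v
          pos {v} vD = pos-arith (full vD)

          cyclic : (∀ v → v ∈ D → TwoNeighbours D v) → ⊥
          cyclic c = case κ ℤ≟ + 5 of λ
            { (yes e) → plain (doubled e D D⊆X nonempty λ v vD → let open TwoNeighbours (c v vD) in
                a , b , a∈ , b∈ , a≢b , cyclic-twos e (full vD) (deg-two (c v vD)) (even-split (c v vD) (λ uD → trans (full vD) (sym (full uD))) vD)
                , subst (+ 2 ≤_) (even-split (c v vD) (λ uD → trans (full vD) (sym (full uD))) vD) (cyclic-twos e (full vD) (deg-two (c v vD)) (even-split (c v vD) (λ uD → trans (full vD) (sym (full uD))) vD)))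
            ; (no ne) → big (+ 2) (λ {v} vD → nb-two (c v vD)) (lem (six ne) (card-two (c _ (proj₂ nonempty)) (proj₂ nonempty))) }
            where
            lem : ∀ {n} → + 6 ≤ κ → + 3 ≤ n → + 3 ≤ (κ - + 3 - + 2) * n
            lem {n} p q = ≤-trans q (fit (scale {c = n} (≤-trans (0≤+ 3) q) p) (solve (n ∷ κ ∷ [])))

          -- With `κ` vertices this is the excluded clique, with two vertices a bundle of `κ - 1`
          -- edges. In the remaining cases some edge, hence every edge, is multiple, which bounds
          -- the number of vertices; for `κ = 5` the outcome is exceptional, for larger `κ` the
          -- potential is too small.
          complete : Complete D → ⊥
          complete c = case n ℤ≟ κ of λ
            { (yes e) → plain (clique D D⊆X e c)
            ; (no ne) → case n ≤? + 2 of λ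
              { (yes q) → small (≤-antisym q (card≥2 vD (pos vD)))
              ; (no q) → large (some-double {v} (lt ne)) (above q) } }
            where
            v : Fin N
            v = proj₁ nonempty
            vD : v ∈ D
            vD = proj₂ nonempty
            n : ℤ
            n = card D
            nbn : ∀ {v} → v ∈ D → nb D v ≡ n - 1ℤ
            nbn = nb-complete c
            lt : n ≢ κ → nb D v + 1ℤ ≤ deg D v
            lt ne = above λ q → ne (lt-arith (nbn vD) (full vD) (≤-antisym q (nb≤deg v)))
            small : n ≡ + 2 → ⊥
            small e = case κ ℤ≟ + 5 of λ
                { (yes e₅) → plain (heavy e₅ (D⊆X v vD) (D⊆X w wD) (subst (+ 4 ≤_) deg-vw (four e₅ (full vD))))
                ; (no ne) → big 1ℤ (λ xD → trans (nbn xD) (cong (_- 1ℤ) e)) (subst (λ n → + 3 ≤ (κ - + 3 - 1ℤ) * n) (sym e) (small-arith (six ne))) }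
              where
              w : Fin N
              w = proj₁ (Σₛ-some D (pos vD))
              wD : w ∈ D
              wD = proj₁ (proj₂ (Σₛ-some D (pos vD)))
              q : 1ℤ ≤ μ v w
              q = proj₂ (proj₂ (Σₛ-some D (pos vD)))
              v≢w : v ≢ w
              v≢w = pos-≢ q
              four : κ ≡ + 5 → ∀ {d} → d ≡ κ - 1ℤ → + 4 ≤ d
              four refl refl = ≤-refl
              deg-vw : deg D v ≡ μ v w
              deg-vw = trans (Σₛ-pair D vD wD v≢w λ z zD v≢z w≢z → ⊥-elim (clash 0 (≤-trans
                (deg-vw-three (card-remove D vD) (card-remove (D ⊝ v) (⊝-intro D wD v≢w)) (card-pos (D ⊝ v ⊝ w) (⊝-intro (D ⊝ v) (⊝-intro D zD v≢z) w≢z))) (≤-reflexive e)) refl))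
                (trans (cong (λ z → + z + μ v w) (m-irr v)) (+-identityˡ _))
            large : (∃ λ w → w ∈ D × + 2 ≤ μ v w) → + 3 ≤ n → ⊥
            large (w , wD , q) n≥3 = case κ ℤ≟ + 5 of λ
                { (yes e) → plain (doubled e D D⊆X nonempty twice)
                ; (no ne) → big (n - 1ℤ) nbn (lem₂ (six ne) (large-arith {n} half (six ne) n≥3)) }
              where
              v≢w : v ≢ w
              v≢w = pos-≢ (≤-trans (+≤+ (s≤s z≤n)) q)
              dbl : ∀ {x y} → x ∈ D → y ∈ D → x ≢ y → + 2 ≤ μ x y
              dbl = complete-double c vD wD v≢w q
              half : + 2 * (n - 1ℤ) ≤ κ - 1ℤ
              half = ≤-trans (≤-reflexive (trans (cong (+ 2 *_) (half-arith (card-remove D vD))) (sym (Σₛ-const (D ⊝ v) (+ 2)))))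
                (≤-trans (Σₛ-mono (D ⊝ v) λ y yD → dbl vD (∧-left yD) (⊝-≢ D yD)) (≤-reflexive (trans (sym (deg-⊝ D vD)) (full vD))))
              lem₂ : + 6 ≤ κ → n + 1ℤ ≤ κ - + 2 → + 3 ≤ (κ - + 3 - (n - 1ℤ)) * n
              lem₂ r s = ≤-trans n≥3 (go {n} s (≤-trans (0≤+ 3) n≥3))
                where
                go : ∀ {n} → n + 1ℤ ≤ κ - + 2 → 0ℤ ≤ n → n ≤ (κ - + 3 - (n - 1ℤ)) * n
                go {n} s t = fit (scale {c = n} t s) (solve (n ∷ κ ∷ []))
              twice : ∀ x → x ∈ D → ∃ λ a → ∃ λ b → a ∈ D × b ∈ D × a ≢ b × + 2 ≤ μ x a × + 2 ≤ μ x b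
              twice x xD = pick₁ (card-some (D ⊝ x) (one′ (card-remove D xD)))
                where
                one′ : ∀ {y} → n ≡ 1ℤ + y → 1ℤ ≤ y
                one′ {y} e = fit (n≥3 ⊕ ≤-reflexive e ⊕ 0≤+ 1) (one-arith n y)
                two′ : ∀ {y z} → n ≡ 1ℤ + y → y ≡ 1ℤ + z → 1ℤ ≤ z
                two′ {_} {z} e refl = fit (n≥3 ⊕ ≤-reflexive e) (two-arith n z)
                pick₁ : Nonempty (D ⊝ x) → ∃ λ a → ∃ λ b → a ∈ D × b ∈ D × a ≢ b × + 2 ≤ μ x a × + 2 ≤ μ x b
                pick₁ (a , aD) = pick₂ (card-some (D ⊝ x ⊝ a) (two′ (card-remove D xD) (card-remove (D ⊝ x) aD)))
                  where
                  pick₂ : Nonempty (D ⊝ x ⊝ a) → ∃ λ a → ∃ λ b → a ∈ D × b ∈ D × a ≢ b × + 2 ≤ μ x a × + 2 ≤ μ x b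
                  pick₂ (b , bD) = a , b , ∧-left aD , ∧-left (∧-left bD) , ⊝-≢ (D ⊝ x) bD , dbl xD (∧-left aD) (⊝-≢ D aD) , dbl xD (∧-left (∧-left bD)) (⊝-≢ D (∖-left (D ⊝ x) ⁅ a ⁆ bD))

        no-top : ⊥
        no-top = shape complete cyclic

    -- Bricks that are regular of degree κ - 2

    module Submaximal {D : Sub N} (brick : LowBrick D) (full : ∀ {v} → v ∈ D → deg D v ≡ κ - + 2) where
      open Brick brick

      Out : Sub N
      Out = X ∖ D

      partD : Part X D Out
      partD = part-∖ D⊆X

      Out⊂X : Out ⊂ X
      Out⊂X = part-⊂ (part-sym partD) nonempty

      out : Fin N → ℤ
      out = deg Out

      h-out : ∀ {v} → v ∈ D → h v ≡ κ - + 2 + out v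
      h-out {v} vD = trans (≤-antisym (h≤deg (D⊆X v vD)) (few vD)) (trans (deg-part partD v) (cong (_+ out v) (full vD)))

      out≤1 : ∀ {v} → v ∈ D → out v ≤ 1ℤ
      out≤1 {v} vD = out≤1-arith (h-out vD) (hκ v)

      left-lists : (Fin N → Fin (suc K)) → Lists N (suc K)
      left-lists φ = resid Out φ l

      -- By `reg` the colour `b` at `w` already has `μ w v` conflicts inside the list of `v`, the
      -- most that `R-deg` allows, so none lies outside the list.
      saturated : ∀ {L} → Tight D L → ∀ {v w} → v ∈ D → w ∈ D → v ≢ w → ∀ {a b} → L w b ≡ true → R v w a b ≡ true → L v a ≡ true
      saturated {L} t {v} {w} vD wD v≢w {a} {b} Lb ab = ≢false λ La → clash 0 (≤-trans (reg t wD vD (v≢w ∘ sym) (conn⊝ two w wD) Lb ⊕ ≤-refl {1ℤ})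
        (≤-trans (count-gain {f = λ c → L v c ∧ R w v b c} {g = R w v b} (λ c → ∧-right {L v c}) {a} (cong (_∧ R w v b a) La) (trans (R-sym w v b a) ab)) (R-deg w v b))) refl

      record Outer (v x : Fin N) : Set where
        field
          x∈ : x ∈ Out
          once : m v x ≡ 1
          only : ∀ {z} → z ∈ Out → v ~ z → z ≡ x

        v~x : v ~ x
        v~x e = case trans (sym once) e of λ ()

      outer : ∀ {v} → v ∈ D → 1ℤ ≤ out v → ∃ (Outer v)
      outer {v} vD p = let (x , xO , q) = Σₛ-some Out p in x , record { x∈ = xO ; once = +-injective (≤-antisym (≤-trans (deg-term Out xO) (out≤1 vD)) q)
          ; only = λ {z} zO vz → decidable-stable (z Fin.≟ x) λ ne → clash 0
              (≤-trans (q ⊕ ~-pos vz) (≤-trans (≤-refl {μ v x} ⊕ deg-term (Out ⊝ x) (⊝-intro Out zO (ne ∘ sym))) (≤-trans (≥-cast (deg-remove Out xO v)) (out≤1 vD)))) refl }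

      hitter : ∀ φ {v a} → l v a ≡ true → left-lists φ v a ≡ false → ∃ λ z → z ∈ Out × R z v (φ z) a ≡ true
      hitter φ {v} {a} la ra = decidable-stable (any? (λ z → (Out z Bool.≟ true) ×-dec (R z v (φ z) a Bool.≟ true))) λ n → ⊥-elim (tf (resid-intro Out φ l {v} {a} la λ z zO → ≢true λ e → n (z , zO , e)) ra)

      killed : ∀ {v x} → Outer v x → ∀ φ {a} → l v a ≡ true → left-lists φ v a ≡ false → R x v (φ x) a ≡ true
      killed {v} {x} o φ {a} la ra = let (z , zO , e) = hitter φ la ra in
        subst (λ z → R z v (φ z) a ≡ true) (Outer.only o zO λ q → tf e (R-none (trans (m-sym z v) q) (φ z) a)) e

      some-killed : ∀ {v x} → v ∈ D → Outer v x → ∀ {φ} → Colours Out l φ → ∃ λ a → l v a ≡ true × left-lists φ v a ≡ false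
      some-killed {v} {x} vD o {φ} col = count-excess {f = l v} {g = left-lists φ v}
        (lem (exact (conn two) (rest-tight col) vD) (full vD) (h-out vD) (≤-trans (~-pos (Outer.v~x o)) (deg-term Out (Outer.x∈ o))) (long v (D⊆X v vD)))
        where
        lem : ∀ {r d a o n} → r ≤ d → d ≡ κ - + 2 → a ≡ κ - + 2 + o → 1ℤ ≤ o → a ≤ n → r + 1ℤ ≤ n
        lem {r} {o = o} {n} p refl refl q s = fit (p ⊕ q ⊕ s) (solve (r ∷ o ∷ n ∷ κ ∷ []))

      -- If the colour of x always kills a, then deleting the colours in conflict with a at x
      -- costs only one colour of x and leaves X ∖ D uncolourable.
      reduce : ∀ {v x a} → v ∈ D → Outer v x → (∀ {ψ} → Colours Out l ψ → R x v (ψ x) a ≡ true) → ⊥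
      reduce {v} {x} {a} vD o always = contra (minimal Out Out⊂X Γ l′ h′ long′ hκ′ sparse′ (plain ∘ Exceptional-⊆ (proj₁ Out⊂X)))
        where
        l′ : Lists N (suc K)
        l′ z c = l z c ∧ not (⁅ x ⁆ z ∧ R x v c a)
        h′ : Fin N → ℤ
        h′ z = h z - on (⁅ x ⁆ z) 1ℤ
        μ1 : μ x v ≡ 1ℤ
        μ1 = cong +_ (trans (m-sym x v) (Outer.once o))
        long′ : ∀ z → z ∈ Out → h′ z ≤ len l′ z
        long′ z zO = long-arith (long z (∧-left zO)) (≤-trans (∑-mono λ c → bits (l z c) (⁅ x ⁆ z ∧ R x v c a)) (≤-reflexive (∑-+ _ _))) (few′ (⁅ x ⁆ z))
          where
          bits : ∀ p q → on p 1ℤ ≤ on (p ∧ not q) 1ℤ + on q 1ℤ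
          bits true true = ≤-refl
          bits true false = ≤-refl
          bits false true = 0≤+ 1
          bits false false = ≤-refl
          few′ : ∀ b → count (λ c → b ∧ R x v c a) ≤ on b 1ℤ
          few′ true = ≤-trans (R-deg′ x v a) (≤-reflexive μ1)
          few′ false = ≤-reflexive (∑-zero {suc K} λ _ → refl)
        hκ′ : ∀ z → h′ z ≤ κ - 1ℤ
        hκ′ z = absurd-arith₁ (hκ z) (on-nonneg (⁅ x ⁆ z) (0≤+ 1))
        sparse′ : ∀ S → S ⊆ Out → ¬ Bad h′ S
        sparse′ S s bad = go (S x) refl
          where
          go : ∀ b → S x ≡ b → ⊥
          go false eq = sparse S (⊆-trans s (proj₁ Out⊂X)) (bad-cong (λ z zS → lem (∉⁅⁆ (λ { refl → tf zS eq }))) bad)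
            where
            lem : ∀ {z} → ⁅ x ⁆ z ≡ false → h z ≡ h z - on (⁅ x ⁆ z) 1ℤ
            lem {z} e = sym (trans (cong (λ b → h z - on b 1ℤ) e) (+-identityʳ (h z)))
          -- The edge from `x` to `v` leaves `S`, so `rho-cut` gives ρ(S) at least `ℓ - 1`. Badness
          -- after lowering `h x` by one gives at most `ℓ - 2`.
          go true eq = clash 0 (arith {edges S (X ∖ S)} {bonus (h x - 1ℤ)} {rho h S} {rho h′ S} floor
              (rho-cut (part-∖ (⊆-trans s (proj₁ Out⊂X))) (x , eq) (v , v∉S))
              (≤-trans (≤-trans (≥-cast μ1) (edges-term S (X ∖ S) eq v∉S)) ≤-refl) gain
              (subst (λ b → rho h′ S + bonus (h x - on b 1ℤ) ≤ -[1+ 1 ]) (∈⁅⁆ x) (proj₂ bad x eq))) refl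
            where
            v∉S : v ∈ X ∖ S
            v∉S = ∖-intro X S (D⊆X v vD) (≢true λ vS → tf vD (∖-right X D (s v vS)))
            gain : rho h S + (+ 2 - bonus (h x - 1ℤ)) ≤ rho h′ S + (ℓ + + 2)
            gain = ≤-trans (rho-gain {h} {h′} S {λ z → on (⁅ x ⁆ z) (ℓ + + 2)} {+ 2 - bonus (h x - 1ℤ)} (λ z _ → all z (⁅ x ⁆ z) refl) eq
                (subst (λ b → P (h x) + (+ 2 - bonus (h x - 1ℤ)) ≤ P (h x - on b 1ℤ) + on b (ℓ + + 2)) (sym (∈⁅⁆ x)) (gain-arith {P (h x)} {P (h x - 1ℤ)} {bonus (h x - 1ℤ)} (P-gain (hκ x) (≤-refl {1ℤ})))))
                (+-monoʳ-≤ (rho h′ S) (≤-reflexive (trans (∑-cong λ z → on-on (S z) (⁅ x ⁆ z) (ℓ + + 2)) (trans (Σₛ-point x λ z → on (S z) (ℓ + + 2)) (cong (λ b → on b (ℓ + + 2)) eq)))))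
              where
              all : ∀ z b → ⁅ x ⁆ z ≡ b → P (h z) ≤ P (h z - on (⁅ x ⁆ z) 1ℤ) + on (⁅ x ⁆ z) (ℓ + + 2)
              all z true e = subst (λ b → P (h z) ≤ P (h z - on b 1ℤ) + on b (ℓ + + 2)) (sym e) (gain-arith₁ {P (h z)} {P (h z - 1ℤ)} (P-weak (hκ z) (0≤+ 1)))
              all z false e = subst (λ b → P (h z) ≤ P (h z - on b 1ℤ) + on b (ℓ + + 2)) (sym e)
                (≤-reflexive (sym (trans (+-identityʳ (P (h z - 0ℤ))) (cong P (+-identityʳ (h z))))))
            arith : ∀ {e b r r′} → -[1+ 2 ] ≤ rho h X → rho h X + (ℓ - + 2) * e + + 4 ≤ r → 1ℤ ≤ e → r + (+ 2 - b) ≤ r′ + (ℓ + + 2) → r′ + b ≤ -[1+ 1 ] → 1ℤ ≤ 0ℤ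
            arith {e} {b} {r} {r′} p q s t u = total (rho h X) p q
              where
              total : ∀ z → -[1+ 2 ] ≤ z → z + (ℓ - + 2) * e + + 4 ≤ r → 1ℤ ≤ 0ℤ
              total z p q = fit (p ⊕ q ⊕ scale ℓ-2≥0 s ⊕ t ⊕ u) (solve (z ∷ e ∷ b ∷ r ∷ r′ ∷ ℓ ∷ []))
        contra : Colourable Out l′ → ⊥
        contra (ψ , colours p q) = tf (always (colours (λ z zO → ∧-left (p z zO)) q))
          (trans (cong (_∧ R x v (ψ x) a) (sym (∈⁅⁆ x))) (not-elim (∧-right {l x (ψ x)} (p x (Outer.x∈ o)))))

      -- If v is joined to w by more edges than w sends outwards, the colour killed at v is always the same.
      mult-out : ∀ {v w x} → v ∈ D → w ∈ D → v ~ w → Outer v x → μ v w ≤ out w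
      mult-out {v} {w} {x} vD wD vw o = stable λ big → main (above big)
        where
        main : out w + 1ℤ ≤ μ v w → ⊥
        -- Let `φ` kill `a`. If `ψ` spared it, `a` would conflict with `μ v w` colours that `ψ`
        -- leaves at `w`. By `saturated` all of them are killed under `φ`, but only `out w` colours
        -- can be.
        main big = let (a , la , ra) = some-killed vD o col in reduce vD o λ {ψ} colψ → killed o ψ la (≢true λ Lψ → clash 0 (≤-trans big
                (≤-trans (reg (rest-tight colψ) vD wD (~-≢ vw) (conn⊝ two v vD) Lψ)
                (≤-trans (count-mono {g = λ d → l w d ∧ not (left-lists φ w d)} λ d e → ∧-intro (∧-left (∧-left {left-lists ψ w d} e))
                  (not-intro (≢true λ Ld → tf (saturated (rest-tight col) vD wD (~-≢ vw) {a} {d} Ld (∧-right {left-lists ψ w d} e)) ra)))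
                (mult-out-arith (≤-trans (≥-cast (∑-+ _ _)) (∑-mono λ d → bits (l w d) (not (some λ z → Out z ∧ R z w (φ z) d)))) (resid-len Out φ l w))))) refl)
          where
          φ : Fin N → Fin (suc K)
          φ = proj₁ some-rest
          col : Colours Out l φ
          col = proj₂ some-rest
          bits : ∀ p q → on (p ∧ not (p ∧ q)) 1ℤ + on (p ∧ q) 1ℤ ≤ on p 1ℤ
          bits true true = ≤-refl
          bits true false = ≤-refl
          bits false q = ≤-refl

      -- Here `h = κ - 2` on `D`, and twice its potential is `(ν - κ)` times its cardinality. This
      -- is at most -7, which suffices against the largest bonus 2.
      closed-brick : (∀ {v} → v ∈ D → out v ≤ 0ℤ) → ⊥
      closed-brick z = shape complete cyclic
        where
        h-sub : ∀ {v} → v ∈ D → h v ≡ κ - + 2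
        h-sub {v} vD = trans (h-out vD) (trans (cong (λ o → κ - + 2 + o) (≤-antisym (z vD) (deg-nonneg Out v))) (+-identityʳ _))
        big : ∀ ν → (∀ {v} → v ∈ D → nb D v ≡ ν) → ¬ (+ 7 ≤ (κ - ν) * card D)
        big ν p q = not-bad {+ 2} (λ {v} _ → bonus≤2 (view (h v) (hκ v)))
            (lem (rho-const {h} {D} λ v vD → trans (cong P (h-sub vD)) (proj₁ P-sub) , p vD , full vD) q)
          where
          lem : ∀ {r n} → + 2 * r ≡ (+ 2 * ((κ - + 2) * ℓ - 1ℤ) + (ν - (+ 2 * ℓ + 1ℤ) * (κ - + 2))) * n → + 7 ≤ (κ - ν) * n → + 2 * r ≤ -[1+ 2 ] - + 2 * + 2
          lem {r} {n} e s = fit (≤-reflexive e ⊕ s) (solve (r ∷ n ∷ ν ∷ κ ∷ ℓ ∷ []))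
        cyclic : (∀ v → v ∈ D → TwoNeighbours D v) → ⊥
        cyclic c = big (+ 2) (λ {v} vD → nb-two (c v vD)) (lem (card-two (c _ (proj₂ nonempty)) (proj₂ nonempty)))
          where
          lem : ∀ {n} → + 3 ≤ n → + 7 ≤ (κ - + 2) * n
          lem {n} p = fit (scale {c = n} (≤-trans (0≤+ 3) p) κ≥5 ⊕ 3 ⋆ p ⊕ 0≤+ 2) (solve (n ∷ κ ∷ []))
        complete : Complete D → ⊥
        complete c = let (v , vD) = nonempty in big (card D - 1ℤ) (nb-complete c) (complete-arith₃ {card D} (card≥2 vD (complete-arith₁ (full vD))) (complete-arith₂ (nb-complete c vD) (full vD) (nb≤deg v)))

      record Simple : Set where
        field
          outers : ∀ {v} → v ∈ D → ∃ (Outer v)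
          complete : Complete D
          card-D : card D ≡ κ - 1ℤ
          one-fold : ∀ {v w} → v ∈ D → w ∈ D → v ≢ w → m v w ≡ 1

      -- Either no edge leaves `D`, or `mult-out` passes leaving edges on to all vertices and makes
      -- all inner edges simple. Each vertex then has `κ - 2`, thus more than two, neighbours in
      -- `D`, which rules out the cycle.
      simple : (Simple → ⊥) → ⊥
      simple k = go (any? (λ v → (D v Bool.≟ true) ×-dec (1ℤ ≤? out v)))
        where
        go : Dec (∃ λ v → v ∈ D × 1ℤ ≤ out v) → ⊥
        go (no n) = closed-brick λ {v} vD → simple-arith (above λ q → n (v , vD , q))
        go (yes (v₀ , v₀D , p₀)) = shape complete cyclic
          where
          pos : ∀ {v} → v ∈ D → 1ℤ ≤ out v
          pos {v} vD = does⇒ (1ℤ ≤? out v) (spread (conn two) (λ v → does (1ℤ ≤? out v)) v₀D (dec-true (1ℤ ≤? out v₀) p₀)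
            (λ {v} {w} vD wD vw e → dec-true (1ℤ ≤? out w) (≤-trans (~-pos vw) (mult-out vD wD vw (proj₂ (outer vD (does⇒ (1ℤ ≤? out v) e)))))) v vD)
          one-edge : ∀ {v w} → v ∈ D → w ∈ D → v ~ w → μ v w ≤ 1ℤ
          one-edge vD wD vw = ≤-trans (mult-out vD wD vw (proj₂ (outer vD (pos vD)))) (out≤1 wD)
          nb-full : ∀ {v} → v ∈ D → nb D v ≡ κ - + 2
          nb-full {v} vD = trans (≤-antisym (nb≤deg v) (Σₛ-mono D λ w wD → case m v w ℕ.≟ 0 of λ
            { (yes e) → subst (λ n → + n ≤ + sgn n) (sym e) ≤-refl
            ; (no ne) → ≤-trans (one-edge vD wD ne) (≥-cast (adj-one ne)) })) (full vD)
          cyclic : (∀ v → v ∈ D → TwoNeighbours D v) → ⊥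
          cyclic c = clash 0 (cyclic-arith (trans (sym (nb-two (c v₀ v₀D))) (nb-full v₀D))) refl
          complete : Complete D → ⊥
          complete c = k record { outers = λ vD → outer vD (pos vD) ; complete = c ; card-D = complete-arith (nb-complete c v₀D) (nb-full v₀D)
            ; one-fold = λ vD wD ne → +-injective (≤-antisym (one-edge vD wD (c vD wD ne)) (~-pos (c vD wD ne))) }

      -- The colours of x and y determine each other, through the colours killed at v and w.
      determines : ∀ {v w x y} → v ∈ D → w ∈ D → v ~ w → Outer v x → Outer w y → ∀ {φ ψ} → Colours Out l φ → Colours Out l ψ →
        φ x ≡ ψ x → φ y ≡ ψ y
      determines {v} {w} {x} {y} vD wD vw ov ow {φ} {ψ} colφ colψ same = main (some-killed wD ow colφ)
        where
        main : (∃ λ b → l w b ≡ true × left-lists φ w b ≡ false) → φ y ≡ ψ y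
        main (b , lb , rb) = count-one {f = λ c → R y w c b} (≤-trans (R-deg′ y w b) (≤-reflexive (cong +_ (trans (m-sym y w) (Outer.once ow)))))
            {φ y} {ψ y} (killed ow φ lb rb) (killed ow ψ lb (≢true stays))
          where
          stays : left-lists ψ w b ≡ true → ⊥
          stays ψb = found (count-some {f = λ e → left-lists ψ v e ∧ R w v b e} (≤-trans (~-pos (~-sym vw)) (reg (rest-tight colψ) wD vD (~-≢ (~-sym vw)) (conn⊝ two w wD) ψb)))
            where
            found : (∃ λ e → left-lists ψ v e ∧ R w v b e ≡ true) → ⊥
            found (e , q) = tf (subst (λ c → R x v c e ≡ true) same xe) (resid-avoids Out ψ l {v} {e} ψe (Outer.x∈ ov))
              where
              ψe : left-lists ψ v e ≡ true
              ψe = ∧-left {left-lists ψ v e} {R w v b e} q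
              be : R w v b e ≡ true
              be = ∧-right {left-lists ψ v e} {R w v b e} q
              φe : left-lists φ v e ≡ false
              φe = ≢true λ Le → tf (saturated (rest-tight colφ) wD vD (~-≢ (~-sym vw)) {b} {e} Le be) rb
              xe : R x v (φ x) e ≡ true
              xe = killed ov φ {e} (∧-left {l v e} ψe) φe

      seen : ∀ x y c d → Dec (∃ λ φ → Colours Out l φ × φ x ≡ c × φ y ≡ d)
      seen x y c d = search (λ φ → colours? Out l φ ×-dec ((φ x Fin.≟ c) ×-dec (φ y Fin.≟ d)))
        λ φ ψ e (p , q , r) → colours-ext Out l φ ψ e p , trans (sym (e x)) q , trans (sym (e y)) r

      -- A bad set of the graph with the added edge, as seen in the original graph: `gap` is added
      -- to the bound -2.
      record Joined (x y : Fin N) (S : Sub N) : Set where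
        field
          S⊆ : S ⊆ Out
          x∈S : x ∈ S
          y∈S : y ∈ S
          bound : ∀ {v} → v ∈ S → rho h S + bonus (h v) ≤ + 2 * ℓ - + 2 + + sgn (m x y)

      -- Joining x and y by one further edge that forbids all pairs of colours they take in colourings of Out
      -- makes Out uncolourable.
      gadget : ∀ {v w x y} → v ∈ D → w ∈ D → v ~ w → Outer v x → Outer w y → (x≢y : x ≢ y) →
        (∀ S → Joined x y S → ⊥) → ¬ ¬ Weights.Exceptional (AddedEdge.plus x y x≢y g) Out
      gadget {v} {w} {x} {y} vD wD vw ov ow x≢y noJoined noExc =
          contra (minimal Out Out⊂X (conflicts Γ C row col) l h (λ z → long z ∘ ∧-left) hκ sparse′ noExc)
        where
        open AddedEdge x y x≢y
        open AddedWeight g x≢y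
        Seen : Fin (suc K) → Fin (suc K) → Set
        Seen c d = ∃ λ φ → Colours Out l φ × φ x ≡ c × φ y ≡ d
        C : Fin (suc K) → Fin (suc K) → Bool
        C c d = does (seen x y c d)
        found : ∀ {c d} → C c d ≡ true → Seen c d
        found {c} {d} = does⇒ (seen x y c d)
        -- By `determines` the pairs taken by `x` and `y` form a partial matching, so a single edge
        -- can carry them.
        row : ∀ c → count (C c) ≤ 1ℤ
        row c = count-≤1 {f = C c} λ i j p q → both (found p) (found q)
          where
          both : ∀ {i j} → Seen c i → Seen c j → i ≡ j
          both (φ , p , q , r) (ψ , p′ , q′ , r′) = trans (sym r) (trans (determines vD wD vw ov ow p p′ (trans q (sym q′))) r′)
        col : ∀ d → count (λ c → C c d) ≤ 1ℤ
        col d = count-≤1 {f = λ c → C c d} λ i j p q → both (found p) (found q)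
          where
          both : ∀ {i j} → Seen i d → Seen j d → i ≡ j
          both (φ , p , q , r) (ψ , p′ , q′ , r′) = trans (sym q) (trans (determines wD vD (~-sym vw) ow ov p p′ (trans r (sym r′))) q′)
        sparse′ : ∀ S → S ⊆ Out → ¬ Weights.Bad (plus g) h S
        sparse′ S s (ne , bad) = go (S x) (S y) refl refl
          where
          unchanged : on (S x) (on (S y) 1ℤ) ≡ 0ℤ → ⊥
          unchanged e = sparse S (⊆-trans s (proj₁ Out⊂X)) (ne , λ v vS → subst (λ r → r + bonus (h v) ≤ -[1+ 1 ])
            (sym (trans (rho-plus h S) (trans (cong (λ z → Weights.rho (plus g) h S + gap * z) e) (trans (cong (λ z → Weights.rho (plus g) h S + z) (*-zeroʳ gap)) (+-identityʳ (Weights.rho (plus g) h S)))))) (bad v vS))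
          go : ∀ a b → S x ≡ a → S y ≡ b → ⊥
          go true true ex ey = noJoined S record { S⊆ = s ; x∈S = ex ; y∈S = ey ; bound = λ {v} vS →
            sparse-arith₂ {rho h S} {Weights.rho (plus g) h S} {bonus (h v)} {+ sgn (m x y)} (trans (rho-plus h S) (cong₂ (λ a b → Weights.rho (plus g) h S + gap * on a (on b 1ℤ)) ex ey)) (bad v vS) }
          go false b ex ey = unchanged (cong (λ a → on a (on (S y) 1ℤ)) ex)
          go true false ex ey = unchanged (trans (cong (λ b → on (S x) (on b 1ℤ)) ey) (on-zero (S x)))
        contra : ∃ (Colouring.Colours (conflicts Γ C row col) Out l) → ⊥
        contra (ψ , col′) = tf {δ x y ∧ C (ψ x) (ψ y)} (cong₂ _∧_ δ-xy (dec-true (seen x y (ψ x) (ψ y)) (ψ , colours (Colouring.listed col′) (λ v w vO wO → proj₁ (∨-false {R v w (ψ v) (ψ w)} (Colouring.proper col′ v w vO wO))) , refl , refl)))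
          (proj₁ (∨-false {δ x y ∧ C (ψ x) (ψ y)} (proj₂ (∨-false {R x y (ψ x) (ψ y)} (Colouring.proper col′ x y (Outer.x∈ ov) (Outer.x∈ ow))))))

      -- A subset of Out that would be exceptional with one more edge between x and y.
      record Near (x y : Fin N) (W : Sub N) : Set where
        field
          W⊆ : W ⊆ Out
          x∈W : x ∈ W
          y∈W : y ∈ W
          linked : ∀ S → x ∈ S → S y ≡ false → (∀ {p q} → p ∈ W → q ∈ W → p ∈ S → S q ≡ false → m p q ≡ 0) → ⊥
          start : ∀ {v} → v ∈ W → rho h W + bonus (h v) ≤ + 2 * ℓ + κ
          add : ∀ U → x ∈ U → U y ≡ false → ∀ {v} → v ∈ W ∖ U → rho h (W ∖ U) + bonus (h v) + cross (W ∖ U) U ≤ 0ℤ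

      -- Sets that become exceptional through the added edge

      module _ {x y : Fin N} (x≢y : x ≢ y) where
        open AddedEdge x y x≢y
        open AddedWeight g x≢y

        open Graph (plus g) using () renaming (m to m′)

        off-edge : ∀ {W} → (W x ≡ false) ⊎ (W y ≡ false) → ∀ {p q} → p ∈ W → q ∈ W → m′ p q ≡ m p q
        off-edge {W} off {p} {q} pW qW = plus-same {g} (≢true λ e → miss (δ-≡ {p} {q} e) pW qW) (≢true λ e → miss (δ-≡ {q} {p} e) qW pW)
          where
          miss : ∀ {p q} → x ≡ p × y ≡ q → p ∈ W → q ∈ W → ⊥
          miss (refl , refl) pW qW = case off of λ { (inj₁ e) → tf pW e ; (inj₂ e) → tf qW e }

        private
          finish : ∀ W {v} → v ∈ W → Σₛ W (λ v → + 2 * Hmax + Σₛ W (E v)) ≤ + 2 * (+ 2 * ℓ + κ) + 1ℤ → rho h W + bonus (h v) ≤ + 2 * ℓ + κ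
          finish W vW p = half-≤ (≤-trans (hat₀ hκ W vW) p)

          finish⁺ : ∀ A U {v} → v ∈ A → Σₛ A (λ v → + 2 * Hmax + Σₛ A (E v) + + 2 * Σₛ U (E v)) ≤ 1ℤ → rho h A + bonus (h v) + cross A U ≤ 0ℤ
          finish⁺ A U vA p = half-≤ (≤-trans (hat hκ A U vA) p)

        module CliqueCase {W : Sub N} (s : W ⊆ Out) (cW : card W ≡ κ) (k : ∀ {u w} → u ∈ W → w ∈ W → u ≢ w → m′ u w ≢ 0) (xW : x ∈ W) (yW : y ∈ W) where
          private
            joined : ∀ {p q} → p ∈ W → q ∈ W → p ≢ q → δ p q ≡ false → δ q p ≡ false → p ~ q
            joined {p} {q} pW qW ne e f r = k pW qW ne (trans (plus-same {g} {p} {q} e f) r)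

            -- Adjacency in the original graph is known for all pairs but `x y`; this pair and the
            -- diagonal are credited back.
            pt : ∀ {p q} → p ∈ W → q ∈ W → E p q ≤ - (+ 2 * ℓ) * (1ℤ + -[1+ 0 ] * (on (⁅ p ⁆ q) 1ℤ + (on (δ p q) 1ℤ + on (δ q p) 1ℤ)))
            pt {p} {q} pW qW = go (⁅ p ⁆ q) (δ p q) (δ q p) refl refl refl
              where
              go : ∀ a b c → ⁅ p ⁆ q ≡ a → δ p q ≡ b → δ q p ≡ c → E p q ≤ - (+ 2 * ℓ) * (1ℤ + -[1+ 0 ] * (on a 1ℤ + (on b 1ℤ + on c 1ℤ)))
              go true true true _ _ _ = fit (E≤0 p q ⊕ 4 ⋆ ℓ≥0) (pt-arith (E p q) ℓ)
              go true true false _ _ _ = fit (E≤0 p q ⊕ 2 ⋆ ℓ≥0) (pt-arith₁ (E p q) ℓ)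
              go true false true _ _ _ = fit (E≤0 p q ⊕ 2 ⋆ ℓ≥0) (pt-arith₁ (E p q) ℓ)
              go true false false _ _ _ = fit (E≤0 p q) (pt-arith₂ (E p q) ℓ)
              go false true true _ _ _ = fit (E≤0 p q ⊕ 2 ⋆ ℓ≥0) (pt-arith₁ (E p q) ℓ)
              go false true false _ _ _ = fit (E≤0 p q) (pt-arith₂ (E p q) ℓ)
              go false false true _ _ _ = fit (E≤0 p q) (pt-arith₂ (E p q) ℓ)
              go false false false e f₁ f₂ = fit (E-≤ p q ⊕ scale ℓ≥0 (2 ⋆ ~-pos (joined pW qW (⁅⁆-≢ e) f₁ f₂))) (pt-arith₃ (E p q) (μ p q) ℓ)

            pen : Sub N → Fin N → ℤ
            pen Y p = on (Y p) 1ℤ + (on (⁅ x ⁆ p) (on (Y y) 1ℤ) + on (⁅ y ⁆ p) (on (Y x) 1ℤ))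

            Σ-E-clique : ∀ {Y p} → Y ⊆ W → p ∈ W → Σₛ Y (E p) ≤ - (+ 2 * ℓ) * (card Y + -[1+ 0 ] * pen Y p)
            Σ-E-clique {Y} {p} t pW = ≤-trans (Σₛ-mono Y λ q qY → pt pW (t q qY)) (≤-reflexive (trans (Σₛ-* Y (- (+ 2 * ℓ)) _)
              (cong (- (+ 2 * ℓ) *_) (trans (Σₛ-+ Y _ _) (cong (λ z → card Y + z) (trans (Σₛ-* Y -[1+ 0 ] _) (cong (-[1+ 0 ] *_)
                (trans (Σₛ-+ Y _ _) (cong₂ _+_ (Σₛ-at Y p λ _ → 1ℤ) (trans (Σₛ-+ Y _ _) (cong₂ _+_ (Σ-δ Y p) (Σ-δ′ Y p))))))))))))

          near : Near x y W
          near = record { W⊆ = s ; x∈W = xW ; y∈W = yW ; linked = linked ; start = λ vW → finish W vW total ; add = add }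
            where
            third : ∃ λ w → w ∈ W ⊝ x ⊝ y
            third = card-some (W ⊝ x ⊝ y) (lem cW (card-remove W xW) (card-remove (W ⊝ x) (⊝-intro W yW x≢y)))
              where
              lem : ∀ {a b c} → a ≡ κ → a ≡ 1ℤ + b → b ≡ 1ℤ + c → 1ℤ ≤ c
              lem {c = c} refl e refl = fit (κ≥5 ⊕ ≤-reflexive e ⊕ 0≤+ 2) (solve (κ ∷ c ∷ []))
            linked : ∀ S → x ∈ S → S y ≡ false → (∀ {p q} → p ∈ W → q ∈ W → p ∈ S → S q ≡ false → m p q ≡ 0) → ⊥
            linked S xS yS none′ = go (S w) refl
              where
              w : Fin N
              w = proj₁ third
              w∈ : w ∈ W ⊝ x ⊝ y
              w∈ = proj₂ third
              wW : w ∈ W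
              wW = ∧-left (∧-left {(W ⊝ x) w} w∈)
              x≢w : x ≢ w
              x≢w = ⊝-≢ W (∖-left (W ⊝ x) ⁅ y ⁆ w∈)
              y≢w : y ≢ w
              y≢w = ⊝-≢ (W ⊝ x) w∈
              go : ∀ b → S w ≡ b → ⊥
              go true eq = joined wW yW (y≢w ∘ sym) (≢true λ e → x≢w (proj₁ (δ-≡ {w} {y} e))) (≢true λ e → x≢y (proj₁ (δ-≡ {y} {w} e))) (none′ wW yW eq yS)
              go false eq = joined xW wW x≢w (≢true λ e → y≢w (proj₂ (δ-≡ {x} {w} e))) (≢true λ e → x≢y (sym (proj₂ (δ-≡ {w} {x} e)))) (none′ xW wW xS eq)
            -- A clique of `κ` vertices of top potential has potential `κ`; without the edge between
            -- `x` and `y` it has `2ℓ + κ`, the constant in `Near`.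
            total : Σₛ W (λ v → + 2 * Hmax + Σₛ W (E v)) ≤ + 2 * (+ 2 * ℓ + κ) + 1ℤ
            total = ≤-trans (Σₛ-mono W λ v vW → ≤-trans (+-monoʳ-≤ (+ 2 * Hmax) (Σ-E-clique (λ _ z → z) vW)) (≤-reflexive (shape′ v vW)))
                (≤-trans (≤-reflexive (trans (Σₛ-+ W _ _) (cong₂ _+_ (trans (Σₛ-const W c₀) (cong (c₀ *_) cW)) (trans (Σₛ-* W (+ 2 * ℓ) _) (cong (λ z → + 2 * ℓ * z)
                  (trans (Σₛ-+ W _ _) (cong₂ _+_ (trans (Σₛ-at W x λ _ → 1ℤ) (cong (λ b → on b 1ℤ) xW)) (trans (Σₛ-at W y λ _ → 1ℤ) (cong (λ b → on b 1ℤ) yW)))))))))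
                total-arith)
              where
              c₀ : ℤ
              c₀ = + 2 * ((κ - 1ℤ) * ℓ + 1ℤ) - + 2 * ℓ * (κ - 1ℤ)
              shape′ : ∀ v → v ∈ W → + 2 * Hmax + - (+ 2 * ℓ) * (card W + -[1+ 0 ] * pen W v) ≡ c₀ + + 2 * ℓ * (on (⁅ x ⁆ v) 1ℤ + on (⁅ y ⁆ v) 1ℤ)
              shape′ v vW = trans (cong₂ (λ c p → + 2 * Hmax + - (+ 2 * ℓ) * (c + -[1+ 0 ] * p)) cW
                  (cong₂ _+_ (cong (λ b → on b 1ℤ) vW) (cong₂ (λ a b → on (⁅ x ⁆ v) (on a 1ℤ) + on (⁅ y ⁆ v) (on b 1ℤ)) yW xW))) (shape-arith (on (⁅ x ⁆ v) 1ℤ) (on (⁅ y ⁆ v) 1ℤ))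
            add : ∀ U → x ∈ U → U y ≡ false → ∀ {v} → v ∈ W ∖ U → rho h (W ∖ U) + bonus (h v) + cross (W ∖ U) U ≤ 0ℤ
            add U xU yU {v} vA = finish⁺ A U vA (≤-trans (Σₛ-mono A λ u uA → ≤-trans
                  (≤-trans (≤-reflexive (add-arith (+ 2 * Hmax) (Σₛ A (E u)) (+ 2 * Σₛ U (E u)))) (≤-refl {+ 2 * Hmax} ⊕ Σ-E-clique (λ z p → ∧-left p) (∧-left uA) ⊕ 2 ⋆ ≤-trans (Σ-E-⊆ {B} {U} (λ z p → ∧-right {W z} p) u) (Σ-E-clique (λ z p → ∧-left p) (∧-left uA))))
                  (≤-reflexive (shape′ u uA)))
                (≤-trans (≤-reflexive (trans (Σₛ-+ A _ _) (cong₂ _+_ (Σₛ-const A c₀) (trans (Σₛ-* A (+ 4 * ℓ) _) (cong (λ z → + 4 * ℓ * z) (trans (Σₛ-at A y λ _ → 1ℤ) (cong (λ b → on b 1ℤ) yA)))))))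
                (num {card A} {card B} (card-pos A vA) (card-pos B {x} (∧-intro xW xU)) (trans (sym cW) (Σₛ-part (part-∩ W U) _)))))
              where
              A B : Sub N
              A = W ∖ U
              B z = W z ∧ U z
              yA : y ∈ A
              yA = ∖-intro W U yW yU
              xA : A x ≡ false
              xA = trans (cong (λ b → W x ∧ not b) xU) (and-not (W x))
                where
                and-not : ∀ b → b ∧ false ≡ false
                and-not true = refl
                and-not false = refl
              c₀ : ℤ
              c₀ = + 2 * ((κ - 1ℤ) * ℓ + 1ℤ) - + 2 * ℓ * (card A - 1ℤ) - + 4 * ℓ * card B
              shape′ : ∀ u → u ∈ A → + 2 * Hmax + (- (+ 2 * ℓ) * (card A + -[1+ 0 ] * pen A u) + + 2 * (- (+ 2 * ℓ) * (card B + -[1+ 0 ] * pen B u)))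
                ≡ c₀ + + 4 * ℓ * on (⁅ y ⁆ u) 1ℤ
              shape′ u uA = trans (cong₂ (λ a b → + 2 * Hmax + (- (+ 2 * ℓ) * (card A + -[1+ 0 ] * a) + + 2 * (- (+ 2 * ℓ) * (card B + -[1+ 0 ] * b)))) penA penB)
                  (shape-arith₁ (card A) (card B) (on (⁅ y ⁆ u) 1ℤ))
                where
                notx : ⁅ x ⁆ u ≡ false
                notx = ∉⁅⁆ λ { refl → tf uA xA }
                notU : U u ≡ false
                notU = ∖-right W U uA
                penA : pen A u ≡ 1ℤ
                penA = trans (cong₂ (λ a b → on a 1ℤ + (on b (on (A y) 1ℤ) + on (⁅ y ⁆ u) (on (A x) 1ℤ))) uA notx)
                  (cong (λ z → 1ℤ + (0ℤ + z)) (trans (cong (λ b → on (⁅ y ⁆ u) (on b 1ℤ)) xA) (on-zero (⁅ y ⁆ u))))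
                penB : pen B u ≡ on (⁅ y ⁆ u) 1ℤ
                penB = trans (cong₂ (λ a b → on (W u ∧ a) 1ℤ + (on b (on (B y) 1ℤ) + on (⁅ y ⁆ u) (on (W x ∧ U x) 1ℤ))) notU notx)
                  (trans (cong₂ (λ a b → on a 1ℤ + (0ℤ + on (⁅ y ⁆ u) (on b 1ℤ))) (and-false (W u)) (∧-intro xW xU)) (trans (+-identityˡ _) (+-identityˡ _)))
                  where
                  and-false : ∀ b → b ∧ false ≡ false
                  and-false true = refl
                  and-false false = refl
              num : ∀ {α β} → 1ℤ ≤ α → 1ℤ ≤ β → κ ≡ α + β → (+ 2 * ((κ - 1ℤ) * ℓ + 1ℤ) - + 2 * ℓ * (α - 1ℤ) - + 4 * ℓ * β) * α + + 4 * ℓ * 1ℤ ≤ 1ℤ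
              num {α} {β} p q e = subst (λ κ → (+ 2 * ((κ - 1ℤ) * ℓ + 1ℤ) - + 2 * ℓ * (α - 1ℤ) - + 4 * ℓ * β) * α + + 4 * ℓ * 1ℤ ≤ 1ℤ) (sym e)
                  (go (0≤* (num-pred p) (num-pred q)) (subst (+ 5 ≤_) e κ≥5))
                where
                -- The left-hand side of the goal is `2α - 2ℓ(αβ - 2)`, and `αβ` is at least 4 when
                -- `α + β` is at least 5.
                go : 0ℤ ≤ (α - 1ℤ) * (β - 1ℤ) → + 5 ≤ α + β → (+ 2 * ((α + β - 1ℤ) * ℓ + 1ℤ) - + 2 * ℓ * (α - 1ℤ) - + 4 * ℓ * β) * α + + 4 * ℓ * 1ℤ ≤ 1ℤ
                go t u = fit (2 ⋆ scale (pos₃ t u) ℓ≥6 ⊕ 12 ⋆ t ⊕ 10 ⋆ u ⊕ 2 ⋆ q ⊕ 0≤+ 17) (solve (α ∷ β ∷ ℓ ∷ []))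
                  where
                  pos₃ : 0ℤ ≤ (α - 1ℤ) * (β - 1ℤ) → + 5 ≤ α + β → 0ℤ ≤ α * β - + 2
                  pos₃ t u = fit (t ⊕ u ⊕ 0≤+ 2) (solve (α ∷ β ∷ []))

      private
        Hmax₅ : κ ≡ + 5 → Hmax ≡ + 4 * ℓ + 1ℤ
        Hmax₅ e = trans (cong (λ κ → (κ - 1ℤ) * ℓ + 1ℤ) e) (Hmax₅-arith ℓ)

        E-bound : ∀ n {p q} → + n ≤ μ p q → E p q ≤ 1ℤ - (+ 2 * ℓ + 1ℤ) * + n
        E-bound n {p} {q} r = E-bound-arith₁ {adj p q} {μ p q} {+ n} (sgn≤1 (m p q)) (scale (E-bound-arith ℓ≥0) r)
          where
          sgn≤1 : ∀ n → + sgn n ≤ 1ℤ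
          sgn≤1 zero = 0≤+ 1
          sgn≤1 (suc n) = ≤-refl

      module HeavyCase {x y : Fin N} (x≢y : x ≢ y) (e₅ : κ ≡ + 5) (xO : x ∈ Out) (yO : y ∈ Out) (xy : + 3 ≤ μ x y) where

        private
          W : Sub N
          W v = ⁅ x ⁆ v ∨ ⁅ y ⁆ v

          members : ∀ {v} → v ∈ W → x ≡ v ⊎ y ≡ v
          members {v} vW = go (⁅ x ⁆ v) refl vW
            where
            go : ∀ b → ⁅ x ⁆ v ≡ b → b ∨ ⁅ y ⁆ v ≡ true → x ≡ v ⊎ y ≡ v
            go true e _ = inj₁ (⁅⁆-≡ e)
            go false _ e = inj₂ (⁅⁆-≡ e)

          x∈ : x ∈ W
          x∈ = cong (_∨ ⁅ y ⁆ x) (∈⁅⁆ x)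

          y∈ : y ∈ W
          y∈ = trans (cong (⁅ x ⁆ y ∨_) (∈⁅⁆ y)) (∨-true (⁅ x ⁆ y))
            where
            ∨-true : ∀ b → b ∨ true ≡ true
            ∨-true true = refl
            ∨-true false = refl

          Eyx : E y x ≤ 1ℤ - (+ 2 * ℓ + 1ℤ) * + 3
          Eyx = E-bound 3 {y} {x} (≤-trans xy (≤-reflexive (μ-sym x y)))

        near : Near x y W
        near = record
          { W⊆ = λ v vW → case members vW of λ { (inj₁ refl) → xO ; (inj₂ refl) → yO }
          ; x∈W = x∈ ; y∈W = y∈
          ; linked = λ S xS yS none′ → clash 2 (≤-trans xy (≤-reflexive (cong +_ (none′ x∈ y∈ xS yS)))) refl
          ; start = λ {v} vW → half-≤ (≤-trans (hat₀ hκ W vW) (≤-trans (≤-reflexive (Σₛ-pair W x∈ y∈ x≢y {λ v → + 2 * Hmax + Σₛ W (E v)}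
              λ w wW p q → ⊥-elim (case members wW of λ { (inj₁ e) → p e ; (inj₂ e) → q e })))
              (near-arith {Hmax} {Σₛ W (E x)} {Σₛ W (E y)} e₅ (Hmax₅ e₅) (≤-trans (Σ-E-term W y∈) (E-bound 3 {x} {y} xy)) (≤-trans (Σ-E-term W x∈) Eyx))))
          ; add = λ U xU yU {v} vA → half-≤ (≤-trans (hat hκ (W ∖ U) U vA) (≤-trans (Σₛ-mono (W ∖ U) {g = λ _ → 0ℤ} λ u uA →
              case members (∧-left uA) of λ
                { (inj₁ refl) → ⊥-elim (tf xU (∖-right W U uA))
                ; (inj₂ refl) → near-arith₁ {Hmax} {Σₛ (W ∖ U) (E u)} {Σₛ U (E u)} (Hmax₅ e₅) (Σ-E≤0 (W ∖ U) u) (≤-trans (Σ-E-term U xU) Eyx) })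
              (≤-trans (≤-reflexive (∑-zero λ u → on-zero ((W ∖ U) u))) (0≤+ 1)))) }

      module DoubledCase {x y : Fin N} (x≢y : x ≢ y) (e₅ : κ ≡ + 5) {W : Sub N} (s : W ⊆ Out)
        (pairs : ∀ v → v ∈ W → ∃ λ a → ∃ λ b → a ∈ W × b ∈ W × a ≢ b × + 2 ≤ Graphs.μ (AddedEdge.plus x y x≢y g) v a × + 2 ≤ Graphs.μ (AddedEdge.plus x y x≢y g) v b)
        (xW : x ∈ W) (yW : y ∈ W) (xy : x ~ y) where
        open AddedEdge x y x≢y
        open AddedWeight g x≢y

        private
          -- A double edge that uses the added edge is only known to be an edge of the original
          -- graph; `2ℓ + 1` is credited for the missing one.
          E-double : ∀ {p q} → + 2 ≤ Graphs.μ (plus g) p q → E p q ≤ - (+ 4 * ℓ + 1ℤ) + (+ 2 * ℓ + 1ℤ) * (on (δ p q) 1ℤ + on (δ q p) 1ℤ)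
          E-double {p} {q} r = go (δ p q) (δ q p) refl refl
            where
            atxy : ∀ {p q} → p ~ q → E p q ≤ 1ℤ - (+ 2 * ℓ + 1ℤ) * + 1
            atxy e = E-bound 1 (~-pos e)
            go : ∀ b c → δ p q ≡ b → δ q p ≡ c → E p q ≤ - (+ 4 * ℓ + 1ℤ) + (+ 2 * ℓ + 1ℤ) * (on b 1ℤ + on c 1ℤ)
            go true true e f = ⊥-elim (x≢y (trans (proj₁ (δ-≡ {p} {q} e)) (sym (proj₂ (δ-≡ {q} {p} f)))))
            go true false e f = E-double-one-more (atxy (subst₂ _~_ (proj₁ (δ-≡ {p} {q} e)) (proj₂ (δ-≡ {p} {q} e)) xy))
            go false true e f = E-double-one-more (atxy (~-sym (subst₂ _~_ (proj₁ (δ-≡ {q} {p} f)) (proj₂ (δ-≡ {q} {p} f)) xy)))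
            go false false e f = E-double-arith (E-bound 2 {p} {q} (≤-trans r (≤-reflexive (cong +_ (plus-same {g} {p} {q} e f)))))

          two-terms : ∀ {v a b} → a ∈ W → b ∈ W → a ≢ b → Σₛ W (E v) ≤ E v a + E v b
          two-terms {v} {a} {b} aW bW ne = ≤-trans (≤-reflexive (Σₛ-remove W aW (E v))) (≤-refl {E v a} ⊕ Σ-E-term (W ⊝ a) (⊝-intro W bW ne))

          at-most : ∀ (z : Fin N) c {a b : Fin N} → a ≢ b → on (c ∧ ⁅ z ⁆ a) 1ℤ + on (c ∧ ⁅ z ⁆ b) 1ℤ ≤ on c 1ℤ
          at-most z false ne = ≤-refl
          at-most z true {a} {b} ne = go (⁅ z ⁆ a) (⁅ z ⁆ b) refl refl
            where
            go : ∀ p q → ⁅ z ⁆ a ≡ p → ⁅ z ⁆ b ≡ q → on p 1ℤ + on q 1ℤ ≤ 1ℤ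
            go true true e f = ⊥-elim (ne (trans (sym (⁅⁆-≡ e)) (⁅⁆-≡ f)))
            go true false _ _ = ≤-refl
            go false true _ _ = ≤-refl
            go false false _ _ = 0≤+ 1

          ∧-swap : ∀ a b → a ∧ b ≡ b ∧ a
          ∧-swap true true = refl
          ∧-swap true false = refl
          ∧-swap false true = refl
          ∧-swap false false = refl

          Σ-E-double : ∀ {v} → v ∈ W → Σₛ W (E v) ≤ - (+ 8 * ℓ + + 2) + (+ 2 * ℓ + 1ℤ) * (on (⁅ x ⁆ v) 1ℤ + on (⁅ y ⁆ v) 1ℤ)
          Σ-E-double {v} vW = go (pairs v vW)
            where
            lem : ∀ {s a b p q r t u w} → s ≤ a + b → a ≤ - (+ 4 * ℓ + 1ℤ) + (+ 2 * ℓ + 1ℤ) * (p + q) → b ≤ - (+ 4 * ℓ + 1ℤ) + (+ 2 * ℓ + 1ℤ) * (r + t) →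
              p + r ≤ u → q + t ≤ w → s ≤ - (+ 8 * ℓ + + 2) + (+ 2 * ℓ + 1ℤ) * (u + w)
            lem {s} {a} {b} {p} {q} {r} {t} {u} {w} g₁ g₂ g₃ g₄ g₅ = fit (g₁ ⊕ g₂ ⊕ g₃ ⊕ scale Σ-E-double-K (g₄ ⊕ g₅)) (solve (s ∷ a ∷ b ∷ p ∷ q ∷ r ∷ t ∷ u ∷ w ∷ ℓ ∷ []))
            go : (∃ λ a → ∃ λ b → a ∈ W × b ∈ W × a ≢ b × + 2 ≤ Graphs.μ (plus g) v a × + 2 ≤ Graphs.μ (plus g) v b) → _
            go (a , b , aW , bW , ne , p , q) = lem {Σₛ W (E v)} {E v a} {E v b} {on (δ v a) 1ℤ} {on (δ a v) 1ℤ} {on (δ v b) 1ℤ} {on (δ b v) 1ℤ}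
              (two-terms aW bW ne) (E-double p) (E-double q) (at-most y (⁅ x ⁆ v) ne)
              (subst₂ (λ i j → on i 1ℤ + on j 1ℤ ≤ on (⁅ y ⁆ v) 1ℤ) (∧-swap (⁅ y ⁆ v) (⁅ x ⁆ a)) (∧-swap (⁅ y ⁆ v) (⁅ x ⁆ b)) (at-most x (⁅ y ⁆ v) ne))

        near : Near x y W
        near = record { W⊆ = s ; x∈W = xW ; y∈W = yW ; linked = λ S xS yS none′ → xy (none′ xW yW xS yS) ; start = start ; add = add }
          where
          start : ∀ {v} → v ∈ W → rho h W + bonus (h v) ≤ + 2 * ℓ + κ
          start vW = half-≤ (≤-trans (hat₀ hκ W vW) (≤-trans (Σₛ-mono W λ v vW → start-arith {Hmax} {Σₛ W (E v)} (Hmax₅ e₅) (Σ-E-double vW))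
              (≤-trans (≤-reflexive (trans (Σₛ-* W (+ 2 * ℓ + 1ℤ) _) (cong (λ z → (+ 2 * ℓ + 1ℤ) * z) (trans (Σₛ-+ W _ _)
                (cong₂ _+_ (trans (Σₛ-at W x λ _ → 1ℤ) (cong (λ b → on b 1ℤ) xW)) (trans (Σₛ-at W y λ _ → 1ℤ) (cong (λ b → on b 1ℤ) yW)))))))
                start-arith₁)))
          add : ∀ U → x ∈ U → U y ≡ false → ∀ {v} → v ∈ W ∖ U → rho h (W ∖ U) + bonus (h v) + cross (W ∖ U) U ≤ 0ℤ
          add U xU yU {v} vA = half-≤ (≤-trans (hat hκ A U vA) (≤-trans (Σₛ-mono A term) (≤-reflexive (trans (Σₛ-at A y λ _ → 1ℤ) (cong (λ b → on b 1ℤ) (∖-intro W U yW yU))))))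
            where
            A B : Sub N
            A = W ∖ U
            B z = W z ∧ U z
            term : ∀ u → u ∈ A → + 2 * Hmax + Σₛ A (E u) + + 2 * Σₛ U (E u) ≤ on (⁅ y ⁆ u) 1ℤ
            term u uA = add-arith₁ {Hmax} {Σₛ A (E u)} {Σₛ B (E u)} {Σₛ W (E u)} {Σₛ U (E u)} {on (⁅ x ⁆ u) 1ℤ} {on (⁅ y ⁆ u) 1ℤ} (Hmax₅ e₅) (Σₛ-part (part-∩ W U) (E u))
                (Σ-E-⊆ {B} {U} (λ z p → ∧-right {W z} p) u) (Σ-E-double (∧-left uA))
                (cong (λ b → on b 1ℤ) (∉⁅⁆ λ { refl → tf xU (∖-right W U uA) })) (go (⁅ y ⁆ u) refl)
              where
              go : ∀ b → ⁅ y ⁆ u ≡ b → Σₛ U (E u) + (+ 2 * ℓ + 1ℤ) * on b 1ℤ ≤ on b 1ℤ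
              go false _ = term-arith {Σₛ U (E u)} (Σ-E≤0 U u)
              go true e = term-arith₁ {Σₛ U (E u)} (≤-trans (Σ-E-term U xU) (E-bound 1 {u} {x} (~-pos (subst (_~ x) (⁅⁆-≡ e) (~-sym xy)))))

      -- `Out` is not exceptional in the original graph, so the exceptional structure has to use the
      -- added edge.
      exceptional-near : ∀ {x y} (x≢y : x ≢ y) → x ∈ Out → y ∈ Out → Weights.Exceptional (AddedEdge.plus x y x≢y g) Out → ∃ (Near x y)
      exceptional-near {x} {y} x≢y xO yO = λ where
          (Weights.clique W s c k) → clique-case W s c k (W x) (W y) refl refl
          (Weights.heavy e pO qO r) → heavy-case e pO qO r _ _ refl refl
          (Weights.doubled e W s ne d) → doubled-case e W s ne d (W x) (W y) refl refl
        where
        open AddedEdge x y x≢y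
        open Graph (plus g) using () renaming (m to m′)
        unexceptional : ¬ Exceptional Out
        unexceptional = plain ∘ Exceptional-⊆ (proj₁ Out⊂X)
        clique-case : ∀ W → W ⊆ Out → card W ≡ κ → (∀ {u w} → u ∈ W → w ∈ W → u ≢ w → m′ u w ≢ 0) → ∀ a b → W x ≡ a → W y ≡ b → ∃ (Near x y)
        clique-case W s c k true true ex ey = W , CliqueCase.near x≢y s c k ex ey
        clique-case W s c k false b ex ey = ⊥-elim (unexceptional (clique W s c λ p q ne e → k p q ne (trans (off-edge x≢y (inj₁ ex) p q) e)))
        clique-case W s c k true false ex ey = ⊥-elim (unexceptional (clique W s c λ p q ne e → k p q ne (trans (off-edge x≢y (inj₂ ey) p q) e)))
        heavy-case : κ ≡ + 5 → ∀ {p q} → p ∈ Out → q ∈ Out → + 4 ≤ + m′ p q → ∀ a b → δ p q ≡ a → δ q p ≡ b → ∃ (Near x y)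
        heavy-case e {p} {q} pO qO r true true f f′ = ⊥-elim (x≢y (trans (proj₁ (δ-≡ {p} {q} f)) (sym (proj₂ (δ-≡ {q} {p} f′)))))
        heavy-case e {p} {q} pO qO r false false f f′ = ⊥-elim (unexceptional (heavy e pO qO (≤-trans r (≤-reflexive (cong +_ (plus-same {g} {p} {q} f f′))))))
        heavy-case e {p} {q} pO qO r true false f f′ = _ , HeavyCase.near x≢y e xO yO (subst₂ (λ a b → + 3 ≤ μ a b) (sym (proj₁ (δ-≡ {p} {q} f))) (sym (proj₂ (δ-≡ {p} {q} f))) (drop r f f′))
          where
          drop : + 4 ≤ + m′ p q → δ p q ≡ true → δ q p ≡ false → + 3 ≤ μ p q
          drop r f f′ = less (m p q) (subst (λ n → + 4 ≤ + n) (cong₂ (λ a b → m p q ℕ.+ (bit a ℕ.+ bit b)) f f′) r)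
            where
            less : ∀ n → + 4 ≤ + (n ℕ.+ 1) → + 3 ≤ + n
            less n r = fit r (less-solve-it (+ n))
        heavy-case e {p} {q} pO qO r false true f f′ = heavy-case e qO pO (subst (λ n → + 4 ≤ + n) (Graph.m-sym (plus g) p q) r) true false f′ f
        doubled-case : κ ≡ + 5 → ∀ W → W ⊆ Out → Nonempty W →
          (∀ v → v ∈ W → ∃ λ a → ∃ λ b → a ∈ W × b ∈ W × a ≢ b × + 2 ≤ + m′ v a × + 2 ≤ + m′ v b) → ∀ a b → W x ≡ a → W y ≡ b → ∃ (Near x y)
        doubled-case e W s ne d a b ex ey = go a b ex ey (m x y ℕ.≟ 0)
          where
          same : (∀ {p q} → p ∈ W → q ∈ W → + 2 ≤ + m′ p q → + 2 ≤ μ p q) → ∃ (Near x y)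
          same f = ⊥-elim (unexceptional (doubled e W s ne λ v vW → conv vW (d v vW)))
            where
            conv : ∀ {v} → v ∈ W → (∃ λ a → ∃ λ b → a ∈ W × b ∈ W × a ≢ b × + 2 ≤ + m′ v a × + 2 ≤ + m′ v b) → ∃ λ a → ∃ λ b → a ∈ W × b ∈ W × a ≢ b × + 2 ≤ μ v a × + 2 ≤ μ v b
            conv vW (a , b , aW , bW , n , p , q) = a , b , aW , bW , n , f vW aW p , f vW bW q
          go : ∀ a b → W x ≡ a → W y ≡ b → Dec (m x y ≡ 0) → ∃ (Near x y)
          go true true ex ey (no xy) = W , DoubledCase.near x≢y e s d ex ey xy
          go false b ex ey _ = same λ pW qW r → ≤-trans r (≤-reflexive (cong +_ (off-edge x≢y (inj₁ ex) pW qW)))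
          go true false ex ey _ = same λ pW qW r → ≤-trans r (≤-reflexive (cong +_ (off-edge x≢y (inj₂ ey) pW qW)))
          -- If `x` and `y` were not adjacent, the new edge is simple, and no double edge depends on
          -- it.
          go true true ex ey (yes z) = same λ {p} {q} _ _ r → thin r _ _ refl refl
            where
            thin : ∀ {p q} → + 2 ≤ + m′ p q → ∀ a b → δ p q ≡ a → δ q p ≡ b → + 2 ≤ μ p q
            thin {p} {q} r false false f f′ = ≤-trans r (≤-reflexive (cong +_ (plus-same {g} {p} {q} f f′)))
            thin {p} {q} r true true f f′ = ⊥-elim (x≢y (trans (proj₁ (δ-≡ {p} {q} f)) (sym (proj₂ (δ-≡ {q} {p} f′)))))
            thin {p} {q} r true false f f′ = ⊥-elim (clash 0 (subst (λ n → + 2 ≤ + n) (cong₂ ℕ._+_ mpq (cong₂ (λ a b → bit a ℕ.+ bit b) f f′)) r) refl)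
              where
              mpq : m p q ≡ 0
              mpq = subst₂ (λ a b → m a b ≡ 0) (proj₁ (δ-≡ {p} {q} f)) (proj₂ (δ-≡ {p} {q} f)) z
            thin {p} {q} r false true f f′ = ⊥-elim (clash 0 (subst (λ n → + 2 ≤ + n) (cong₂ ℕ._+_ mpq (cong₂ (λ a b → bit a ℕ.+ bit b) f f′)) r) refl)
              where
              mpq : m p q ≡ 0
              mpq = trans (m-sym p q) (subst₂ (λ a b → m a b ≡ 0) (proj₁ (δ-≡ {q} {p} f′)) (proj₂ (δ-≡ {q} {p} f′)) z)

      -- The outside neighbours of a simple complete brick

      module Conclusion (simple-D : Simple) where
        open Simple simple-D

        private
          D∌ : ∀ {z} → z ∈ Out → D z ≡ false
          D∌ = ∖-right X D

          unique : ∀ {v x y} → Outer v x → Outer v y → x ≡ y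
          unique o o′ = Outer.only o′ (Outer.x∈ o) (Outer.v~x o)

          once′ : ∀ {v x} → Outer v x → 1ℤ ≤ μ x v
          once′ {v} {x} o = ~-pos (~-sym (Outer.v~x o))

          h-top : ∀ {v} → v ∈ D → h v ≡ κ - 1ℤ
          h-top {v} vD = trans (h-out vD) (trans (cong (λ o → κ - + 2 + o) (≤-antisym (out≤1 vD) (≤-trans (~-pos (Outer.v~x o)) (deg-term Out (Outer.x∈ o))))) (h-top-arith κ))
            where
            o : Outer v (proj₁ (outers vD))
            o = proj₂ (outers vD)

          bonus-D : ∀ {v} → v ∈ D → bonus (h v) ≡ 0ℤ
          bonus-D vD = trans (cong bonus (h-top vD)) (proj₂ P-top)

          bonus-pos : ∀ v → 0ℤ ≤ bonus (h v)
          bonus-pos v = bonus≥0 (view (h v) (hκ v))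

          two-≤ : ∀ Y {f : Fin N → ℤ} → (∀ v → 0ℤ ≤ f v) → ∀ {v w} → v ∈ Y → w ∈ Y → v ≢ w → f v + f w ≤ Σₛ Y f
          two-≤ Y {f} p {v} {w} vY wY ne = ≤-trans (≤-refl {f v} ⊕ Σₛ-term (Y ⊝ v) p (⊝-intro Y wY ne)) (≥-cast (Σₛ-remove Y vY f))

          three-≤ : ∀ Y {f : Fin N → ℤ} → (∀ v → 0ℤ ≤ f v) → ∀ {v w u} → v ∈ Y → w ∈ Y → u ∈ Y → v ≢ w → v ≢ u → w ≢ u → f v + (f w + f u) ≤ Σₛ Y f
          three-≤ Y {f} p {v} vY wY uY ne₁ ne₂ ne₃ = ≤-trans (≤-refl {f v} ⊕ two-≤ (Y ⊝ v) p (⊝-intro Y wY ne₁) (⊝-intro Y uY ne₂) ne₃) (≥-cast (Σₛ-remove Y vY f))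

        -- `D` and `x` together would be a copy of the excluded clique.
        not-all-same : ∀ x → (∀ {v} → v ∈ D → Outer v x) → x ∈ Out → ⊥
        not-all-same x o xO = plain (clique W W⊆X cardW adjacent)
          where
          W : Sub N
          W v = D v ∨ ⁅ x ⁆ v
          part : Part W D ⁅ x ⁆
          part = part-∨ λ v e → subst (λ v → D v ≡ false) (⁅⁆-≡ e) (D∌ xO)
          W⊆X : W ⊆ X
          W⊆X v vW = case part-either part vW of λ { (inj₁ vD) → D⊆X v vD ; (inj₂ e) → subst (_∈ X) (⁅⁆-≡ e) (∧-left xO) }
          cardW : card W ≡ κ
          cardW = trans (Σₛ-part part _) (trans (cong₂ _+_ card-D (Σₛ-point x λ _ → 1ℤ)) (cardW-arith κ))
          adjacent : ∀ {u w} → u ∈ W → w ∈ W → u ≢ w → u ~ w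
          adjacent {u} {w} uW wW ne = go (part-either part uW) (part-either part wW)
            where
            go : (u ∈ D) ⊎ (u ∈ ⁅ x ⁆) → (w ∈ D) ⊎ (w ∈ ⁅ x ⁆) → u ~ w
            go (inj₁ uD) (inj₁ wD) = complete uD wD ne
            go (inj₁ uD) (inj₂ e) = subst (u ~_) (⁅⁆-≡ e) (Outer.v~x (o uD))
            go (inj₂ e) (inj₁ wD) = ~-sym (subst (w ~_) (⁅⁆-≡ e) (Outer.v~x (o wD)))
            go (inj₂ e) (inj₂ f) = ⊥-elim (ne (trans (sym (⁅⁆-≡ e)) (⁅⁆-≡ f)))

        -- Enlarges a set by one outside neighbour after another, by induction on the vertices of
        -- `D` not yet treated. Both enlargement arguments below, for `Good` and for `Hat`, are
        -- instances.
        cover : (Good : Sub N → Set) →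
          (∀ {U v y} → Good U → v ∈ D → Outer v y → U y ≡ false → (∀ {U′} → Good U′ → U ⊆ U′ → y ∈ U′ → ⊥) → ⊥) →
          ∀ {U} → Good U → (∀ {U′} → Good U′ → (∀ {v y} → v ∈ D → Outer v y → y ∈ U′) → ⊥) → ⊥
        cover Good step {U} good k = ⊂-rec Claim claim D (λ _ z → z) U good λ vD nD → ⊥-elim (tf vD nD)
          where
          Claim : Sub N → Set
          Claim M = M ⊆ D → ∀ U → Good U → (∀ {v y} → v ∈ D → M v ≡ false → Outer v y → y ∈ U) → ⊥
          claim : ∀ M → (∀ M′ → M′ ⊂ M → Claim M′) → Claim M
          claim M rec M⊆D U good covered = go (any? λ v → M v Bool.≟ true)
            where
            go : Dec (∃ λ v → v ∈ M) → ⊥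
            go (no n) = k good λ {v} vD o → covered vD (≢true λ e → n (v , e)) o
            go (yes (v , vM)) = next (outers (M⊆D v vM))
              where
              next : ∃ (Outer v) → ⊥
              next (y , o) = by (U y) refl
                where
                rest : ∀ {U′} → Good U′ → U ⊆ U′ → y ∈ U′ → ⊥
                rest {U′} good′ s yU′ = rec (M ⊝ v) (⊝-⊂ M vM) (⊆-trans (⊝-⊆ M v) M⊆D) U′ good′ λ {u} {z} uD nM o′ → back u z uD nM o′ (v Fin.≟ u)
                  where
                  back : ∀ u z → u ∈ D → (M ⊝ v) u ≡ false → Outer u z → Dec (v ≡ u) → z ∈ U′
                  back u z uD nM o′ (yes refl) = subst (_∈ U′) (unique o o′) yU′
                  back u z uD nM o′ (no ne) = s z (covered uD (≢true λ e → tf (⊝-intro M e ne) nM) o′)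
                by : ∀ b → U y ≡ b → ⊥
                by true e = rest good (λ _ z → z) e
                by false e = step good (M⊆D v vM) o e rest

        module Joins {v w x y : Fin N} (vD : v ∈ D) (wD : w ∈ D) (v≢w : v ≢ w) (ov : Outer v x) (ow : Outer w y) (x≢y : x ≢ y)
          {S : Sub N} (j : Joined x y S) where
          open Joined j

          S⊆X : S ⊆ X
          S⊆X z zS = ∧-left (S⊆ z zS)

          D⊆ : D ⊆ X ∖ S
          D⊆ z zD = ∖-intro X S (D⊆X z zD) (≢true λ e → tf zD (D∌ (S⊆ z e)))

          low-bound : rho h S ≤ + 2 * ℓ - 1ℤ
          low-bound = low-bound-arith {rho h S} {bonus (h x)} (bound x∈S) (bonus-pos x) (sgn≤1 (m x y))
            where
            sgn≤1 : ∀ n → + sgn n ≤ 1ℤ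
            sgn≤1 zero = 0≤+ 1
            sgn≤1 (suc n) = ≤-refl

          -- With three edges, `rho-cut` and ρ(X) ≥ -3 would give `3(ℓ - 2) + 1` as a lower bound
          -- for ρ(S), which is at most `2ℓ - 1`; this fails for `ℓ` at least 6.
          few-edges : edges S (X ∖ S) ≤ + 2
          few-edges = stable λ big → clash 1 (few-edges-arith {rho h X} {rho h S} {edges S (X ∖ S)} floor (rho-cut (part-∖ S⊆X) (x , x∈S) (v , D⊆ v vD)) low-bound (above big)) refl

          split-edges : edges S (X ∖ S) ≡ Σₛ D (deg S) + edges S (X ∖ S ∖ D)
          split-edges = trans (edges-partʳ (part-∖ D⊆) S) (cong (_+ edges S (X ∖ S ∖ D)) (edges-swap S D))

          outer-deg : ∀ {u z} → Outer u z → z ∈ S → 1ℤ ≤ deg S u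
          outer-deg o zS = ≤-trans (~-pos (Outer.v~x o)) (deg-term S zS)

          -- The edges to `v` and `w` already exhaust the two edges that may leave `S`.
          closed : ∀ {p q} → p ∈ S → q ∈ Out → S q ≡ false → m p q ≡ 0
          closed {p} {q} pS qO qS = μ-zero (≤-trans (edges-term S (X ∖ S ∖ D) pS (∖-intro (X ∖ S) D (∖-intro X S (∧-left qO) qS) (D∌ qO)))
            (closed-arith split-edges few-edges (≤-trans (outer-deg ov x∈S ⊕ outer-deg ow y∈S) (two-≤ D (deg-nonneg S) vD wD v≢w))))

          third-out : ∀ {u z} → u ∈ D → Outer u z → v ≢ u → w ≢ u → S z ≡ false
          third-out uD o v≢u w≢u = ≢true λ zS → clash 0 (third-out-arith split-edges few-edges
              (≤-trans (outer-deg ov x∈S ⊕ outer-deg ow y∈S ⊕ outer-deg o zS) (three-≤ D (deg-nonneg S) vD wD uD v≢w v≢u w≢u)) (edges-nonneg S (X ∖ S ∖ D))) refl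

          -- A second such set S′ for v cuts S into two parts without edges between them, each
          -- joined to the rest of X by a single edge.
          halves : ∀ {S′} → x ∈ S′ → S′ y ≡ false → (∀ {p q} → p ∈ S′ → q ∈ Out → S′ q ≡ false → m p q ≡ 0) →
            ∀ {u} → u ∈ S → + 2 * rho h X + bonus (h u) ≤ -[1+ 5 ]
          halves {S′} xS′ yS′ closed′ {u} uS = halves-arith {rho h X} {rho h S} {rho h Q} {rho h P′} {edges Q (X ∖ Q)} {edges P′ (X ∖ P′)} {bonus (h u)} {+ sgn (m x y)}
              (trans (rho-part (part-∩ S S′) h) (trans (cong (λ z → rho h Q + rho h P′ + z) no-cross) (+-identityʳ _)))
              (rho-cut (part-∖ Q⊆X) (y , yQ) (w , w∉Q)) (rho-cut (part-∖ P⊆X) (x , xP) (v , v∉P))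
              (≤-trans (once′ ow) (edges-term Q (X ∖ Q) yQ w∉Q)) (≤-trans (once′ ov) (edges-term P′ (X ∖ P′) xP v∉P))
              (bound uS) (cong (λ n → + sgn n) (closed′ xS′ (S⊆ y y∈S) yS′))
            where
            P′ Q : Sub N
            P′ z = S z ∧ S′ z
            Q = S ∖ S′
            yQ : y ∈ Q
            yQ = ∖-intro S S′ y∈S yS′
            xP : x ∈ P′
            xP = ∧-intro x∈S xS′
            Q⊆X : Q ⊆ X
            Q⊆X z p = S⊆X z (∧-left p)
            P⊆X : P′ ⊆ X
            P⊆X z p = S⊆X z (∧-left p)
            v∉P : v ∈ X ∖ P′
            v∉P = ∖-intro X P′ (D⊆X v vD) (≢true λ e → tf (∧-left e) (∖-right X S (D⊆ v vD)))
            w∉Q : w ∈ X ∖ Q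
            w∉Q = ∖-intro X Q (D⊆X w wD) (≢true λ e → tf (∧-left e) (∖-right X S (D⊆ w wD)))
            no-cross : cross Q P′ ≡ 0ℤ
            no-cross = trans (Σₛ-cong Q λ q qQ → trans (Σₛ-cong P′ {g = λ _ → 0ℤ} λ p pP → E-none (trans (m-sym q p)
                (closed′ (∧-right {S p} pP) (S⊆ q (∧-left qQ)) (∖-right S S′ qQ)))) (∑-zero λ p → on-zero (P′ p)))
              (∑-zero λ q → on-zero (Q q))

        module NoJoin {v w x y : Fin N} (vD : v ∈ D) (wD : w ∈ D) (v≢w : v ≢ w) (ov : Outer v x) (ow : Outer w y) (x≢y : x ≢ y)
          {S : Sub N} (j : Joined x y S) where
          open Joined j
          private
            module S = Joins vD wD v≢w ov ow x≢y j

            -- The gadget is applied to `v` and `u`. A near set is impossible, because `S` has no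
            -- edge to the rest of `Out` and separates `x` from `z`. So the result is a second
            -- joined set, and each of the two sets halves the other.
            another : ∀ {u z} → u ∈ D → Outer u z → S z ≡ false →
              (∀ {S′} → Joined x z S′ → S′ y ≡ false → (∀ {p q} → p ∈ S′ → q ∈ Out → S′ q ≡ false → m p q ≡ 0) →
                 (∀ {a} → a ∈ S → + 2 * rho h X + bonus (h a) ≤ -[1+ 5 ]) → (∀ {a} → a ∈ S′ → + 2 * rho h X + bonus (h a) ≤ -[1+ 5 ]) → ⊥) → ⊥
            another {u} {z} uD oz zS k = gadget vD uD (complete vD uD v≢u) ov oz x≢z
                (λ S′ j′ → let module S′ = Joins vD uD v≢u ov oz x≢z j′
                               yS′ = S′.third-out wD ow v≢w (w≢u ∘ sym)
                           in k j′ yS′ S′.closed (S.halves (Joined.x∈S j′) yS′ S′.closed) (S′.halves x∈S zS S.closed))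
                (λ exc → let (W , near) = exceptional-near x≢z (Outer.x∈ ov) (Outer.x∈ oz) exc
                         in Near.linked near S x∈S zS λ {p} {q} pW qW pS qS → S.closed pS (Near.W⊆ near q qW) qS)
              where
              x≢z : x ≢ z
              x≢z refl = tf x∈S zS
              v≢u : v ≢ u
              v≢u refl = x≢z (unique ov oz)
              w≢u : w ≢ u
              w≢u refl = tf y∈S (subst (λ z → S z ≡ false) (unique oz ow) zS)

            record Good (U : Sub N) : Set where
              field
                U⊆ : U ⊆ Out
                S⊆U : S ⊆ U
                closed : ∀ {p q} → p ∈ U → q ∈ Out → U q ≡ false → m p q ≡ 0
                poor : ∀ {a} → a ∈ U → + 2 * rho h X + bonus (h a) ≤ -[1+ 5 ]

            grow-good : ∀ {U u z} → Good U → u ∈ D → Outer u z → U z ≡ false → (∀ {U′} → Good U′ → U ⊆ U′ → z ∈ U′ → ⊥) → ⊥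
            grow-good {U} {u} {z} G uD oz zU k = another uD oz (≢true λ e → tf (S⊆U z e) zU) λ {S′} j′ _ closed′ _ poor′ →
                let U′ : Sub N
                    U′ = λ a → U a ∨ S′ a
                    either : ∀ {a} → a ∈ U′ → (a ∈ U) ⊎ (a ∈ S′)
                    either {a} = ∨-either (U a)
                in k {U′} record
                  { U⊆ = λ a aU → case either aU of λ { (inj₁ e) → U⊆ a e ; (inj₂ e) → Joined.S⊆ j′ a e }
                  ; S⊆U = λ a aS → cong (_∨ S′ a) (S⊆U a aS)
                  ; closed = λ {p} {q} pU qO qU → case either pU of λ { (inj₁ e) → closed e qO (proj₁ (∨-false {U q} qU)) ; (inj₂ e) → closed′ e qO (proj₂ (∨-false {U q} qU)) }
                  ; poor = λ {a} aU → case either aU of λ { (inj₁ e) → poor e ; (inj₂ e) → poor′ e } }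
                  (λ a aU → cong (_∨ S′ a) aU) (∨-rightᵗ (U z) (Joined.y∈S j′))
              where
              open Good G
              ∨-either : ∀ a {b} → a ∨ b ≡ true → (a ≡ true) ⊎ (b ≡ true)
              ∨-either true _ = inj₁ refl
              ∨-either false e = inj₂ e
              ∨-rightᵗ : ∀ a {b} → b ≡ true → a ∨ b ≡ true
              ∨-rightᵗ true _ = refl
              ∨-rightᵗ false e = e

            -- `D` and `U` together have no edge to the rest of `X`. If the witness lies in the
            -- rest, the potentials of the two sides add up and `rho-cut` gives ρ(X) ≤ -8. In `D`
            -- its bonus is 0, in `U` it is limited by `poor`; both contradict the lower bounds for
            -- ρ(X).
            finish-good : ∀ {U} → Good U → (∀ {u z} → u ∈ D → Outer u z → z ∈ U) → ⊥
            finish-good {U} G covered = witness λ a aX p → go a aX p (Y a) refl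
              where
              open Good G
              Y : Sub N
              Y z = D z ∨ U z
              partY : Part Y D U
              partY = part-∨ λ z zU → D∌ (U⊆ z zU)
              Y⊆X : Y ⊆ X
              Y⊆X z zY = case part-either partY zY of λ { (inj₁ e) → D⊆X z e ; (inj₂ e) → ∧-left (U⊆ z e) }
              separate : ∀ {p q} → p ∈ Y → q ∈ X ∖ Y → m p q ≡ 0
              separate {p} {q} pY qX = go (part-either partY pY)
                where
                qD : D q ≡ false
                qD = proj₁ (∨-false {D q} (∖-right X Y qX))
                qU : U q ≡ false
                qU = proj₂ (∨-false {D q} (∖-right X Y qX))
                qO : q ∈ Out
                qO = ∖-intro X D (∧-left qX) qD
                go : (p ∈ D) ⊎ (p ∈ U) → m p q ≡ 0
                go (inj₂ e) = closed e qO qU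
                go (inj₁ e) = decidable-stable (m p q ℕ.≟ 0) λ pq → let (z , o) = outers e in tf (covered e o) (subst (λ z → U z ≡ false) (Outer.only o qO pq) qU)
              no-cross : cross Y (X ∖ Y) ≡ 0ℤ
              no-cross = trans (Σₛ-cong Y λ q qQ → trans (Σₛ-cong (X ∖ Y) {g = λ _ → 0ℤ} λ p pP → E-none (separate qQ pP)) (∑-zero λ p → on-zero ((X ∖ Y) p)))
                (∑-zero λ q → on-zero (Y q))
              go : ∀ a → a ∈ X → -[1+ 0 ] ≤ rho h X + bonus (h a) → ∀ b → Y a ≡ b → ⊥
              go a aX p true e = case part-either partY e of λ
                { (inj₁ aD) → clash 3 (finish-good-arith₂ {rho h X} {bonus (h a)} {bonus (h x)} p (bonus-D aD) (poor (S⊆U x x∈S)) (bonus-pos x)) refl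
                ; (inj₂ aU) → clash 1 (finish-good-arith₁ {rho h X} {bonus (h a)} p (poor aU) floor) refl }
              go a aX p false e = clash 4 (finish-good-arith {rho h X} {rho h Y} {rho h (X ∖ Y)} {e = edges Y (X ∖ Y)} {edges (X ∖ Y) Y} (rho-part (part-∖ Y⊆X) h) no-cross
                  (rho-cut (part-∖ Y⊆X) (v , part-left partY v vD) (a , ∖-intro X Y aX e)) (rho-cut (part-sym (part-∖ Y⊆X)) (a , ∖-intro X Y aX e) (v , part-left partY v vD))
                  (0≤* ℓ-2≥0 (edges-nonneg Y (X ∖ Y))) (0≤* ℓ-2≥0 (edges-nonneg (X ∖ Y) Y)) floor) refl

          none-joined : ⊥
          none-joined = pick (card-some (D ⊝ v ⊝ w) (lem card-D (card-remove D vD) (card-remove (D ⊝ v) (⊝-intro D wD v≢w))))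
            where
            lem : ∀ {a b c} → a ≡ κ - 1ℤ → a ≡ 1ℤ + b → b ≡ 1ℤ + c → 1ℤ ≤ c
            lem {c = c} refl e refl = fit (κ≥5 ⊕ ≤-reflexive e ⊕ 0≤+ 1) (solve (κ ∷ c ∷ []))
            pick : ∃ (λ u → u ∈ D ⊝ v ⊝ w) → ⊥
            pick (u , u∈) = let uD = ∧-left (∧-left {(D ⊝ v) u} u∈) ; (z , oz) = outers uD in
              another uD oz (S.third-out uD oz (⊝-≢ D (∖-left (D ⊝ v) ⁅ w ⁆ u∈)) (⊝-≢ (D ⊝ v) u∈)) λ _ _ _ poor _ →
                cover Good grow-good record { U⊆ = S⊆ ; S⊆U = λ _ z → z ; closed = S.closed ; poor = poor } finish-good

        private
          get-near : ∀ {v w x y} → v ∈ D → w ∈ D → Outer v x → Outer w y → x ≢ y → (∀ {W} → Near x y W → ⊥) → ⊥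
          get-near {v} {w} {x} {y} vD wD ov ow x≢y k = gadget vD wD (complete vD wD v≢w) ov ow x≢y
              (λ S j → NoJoin.none-joined vD wD v≢w ov ow x≢y j) λ exc → k (proj₂ (exceptional-near x≢y (Outer.x∈ ov) (Outer.x∈ ow) exc))
            where
            v≢w : v ≢ w
            v≢w refl = x≢y (unique ov ow)

        impossible : ⊥
        impossible = main (proj₂ nonempty) (outers (proj₂ nonempty))
          where
          main : ∀ {v} → v ∈ D → ∃ (Outer v) → ⊥
          main {v} vD (x , ov) = not-all-same x (λ {w} wD → same wD (outers wD)) (Outer.x∈ ov)
            where
            -- The bound is the one for a single near set. Adding further near sets does not exceed
            -- it, by `Near.add`.
            record Hat (U : Sub N) : Set where
              field
                U⊆ : U ⊆ Out
                x∈U : x ∈ U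
                light : ∀ {a} → a ∈ U → rho h U + bonus (h a) ≤ + 2 * ℓ + κ

            light₀ : ∀ {U} → Hat U → rho h U ≤ + 2 * ℓ + κ
            light₀ {U} H = ≤-trans (light-arith {rho h U} (bonus-pos x)) (Hat.light H (Hat.x∈U H))

            add-near : ∀ {U w y} → Hat U → w ∈ D → Outer w y → U y ≡ false → (∀ {U′} → Hat U′ → U ⊆ U′ → y ∈ U′ → ⊥) → ⊥
            add-near {U} {w} {y} H wD ow yU k = get-near vD wD ov ow (λ { refl → tf x∈U yU }) λ {W} near →
                let A : Sub N
                    A = W ∖ U
                    U′ : Sub N
                    U′ = λ a → U a ∨ A a
                    part : Part U′ U A
                    part = part-∨ λ a aA → ∖-right W U aA
                    yA : y ∈ A
                    yA = ∖-intro W U (Near.y∈W near) yU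
                    rho′ : rho h U′ ≡ rho h U + rho h A + cross A U
                    rho′ = trans (rho-part part h) (cong (λ z → rho h U + rho h A + z) (cross-swap U A))
                in k {U′} record
                  { U⊆ = λ a aU → case part-either part aU of λ { (inj₁ e) → U⊆ a e ; (inj₂ e) → Near.W⊆ near a (∧-left e) }
                  ; x∈U = part-left part x x∈U
                  ; light = λ {a} aU → case part-either part aU of λ
                      { (inj₁ e) → add-near-arith {rho h U′} {rho h U} {rho h A} {bonus (h a)} {bonus (h y)} rho′ (light e) (Near.add near U x∈U yU yA) (bonus-pos y)
                      ; (inj₂ e) → add-near-arith₁ {rho h U′} {rho h U} {rho h A} {bonus (h a)} rho′ (light₀ H) (Near.add near U x∈U yU e) } }
                  (part-left part) (part-right part y yA)
              where
              open Hat H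

            -- ρ(D) is `(ℓ + 1)(κ - 1)`, and the `κ - 1` edges from `D` to `U` cost `2ℓ` each.
            -- Together with the `2ℓ + κ` for `U` this is `2κ - 1 - ℓ(κ - 3)`, at most -3, so the
            -- union is bad.
            finish-hat : ∀ {U} → Hat U → (∀ {w y} → w ∈ D → Outer w y → y ∈ U) → ⊥
            finish-hat {U} H covered = sparse Y Y⊆X ((v , part-left part v vD) , λ a aY → ≤-trans (≤-reflexive (cong (_+ bonus (h a)) (rho-part part h)))
                (case part-either part aY of λ
                  { (inj₁ aD) → lem {rho h D} {rho h U} {cross D U} {bonus (h a)} rho-D (subst (λ b → rho h U + b ≤ + 2 * ℓ + κ) (sym (bonus-D aD)) (≤-trans (≤-reflexive (+-identityʳ _)) (light₀ H))) crossed
                  ; (inj₂ aU) → lem {rho h D} {rho h U} {cross D U} {bonus (h a)} rho-D (light aU) crossed }))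
              where
              open Hat H
              Y : Sub N
              Y z = D z ∨ U z
              part : Part Y D U
              part = part-∨ λ z zU → D∌ (U⊆ z zU)
              Y⊆X : Y ⊆ X
              Y⊆X z zY = case part-either part zY of λ { (inj₁ e) → D⊆X z e ; (inj₂ e) → ∧-left (U⊆ z e) }
              rho-D : + 2 * rho h D ≡ (+ 2 * ((κ - 1ℤ) * ℓ + 1ℤ) + ((κ - 1ℤ - 1ℤ) - (+ 2 * ℓ + 1ℤ) * (κ - + 2))) * (κ - 1ℤ)
              rho-D = trans (rho-const {h} {D} λ a aD → trans (cong P (h-top aD)) (proj₁ P-top) , trans (nb-complete complete aD) (cong (_- 1ℤ) card-D) , full aD)
                (cong (λ z → (+ 2 * ((κ - 1ℤ) * ℓ + 1ℤ) + ((κ - 1ℤ - 1ℤ) - (+ 2 * ℓ + 1ℤ) * (κ - + 2))) * z) card-D)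
              crossed : cross D U ≤ - (+ 2 * ℓ) * (κ - 1ℤ)
              crossed = ≤-trans (cross-≤ D U) (crossed-arith (edges D U) (≤-trans (≥-cast card-D) (Σₛ-mono D λ w wD → let (y , o) = outers wD in
                  ≤-trans (~-pos (Outer.v~x o)) (deg-term U (covered wD o)))))
              lem : ∀ {d u c b} → + 2 * d ≡ (+ 2 * ((κ - 1ℤ) * ℓ + 1ℤ) + ((κ - 1ℤ - 1ℤ) - (+ 2 * ℓ + 1ℤ) * (κ - + 2))) * (κ - 1ℤ) → u + b ≤ + 2 * ℓ + κ →
                c ≤ - (+ 2 * ℓ) * (κ - 1ℤ) → d + u + c + b ≤ -[1+ 1 ]
              lem {d} {u} {c} {b} p q r = unscale {d + u + c + b} { -[1+ 1 ]} {+ 2} (+≤+ (s≤s z≤n))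
                (fit (≤-reflexive p ⊕ 2 ⋆ q ⊕ 2 ⋆ r ⊕ scale (0≤* (0≤+ 2) finish-hat-κ-3≥0) ℓ≥6 ⊕ 8 ⋆ κ≥5 ⊕ 0≤+ 2) (solve (d ∷ u ∷ c ∷ b ∷ κ ∷ ℓ ∷ [])))

            same : ∀ {w} → w ∈ D → ∃ (Outer w) → Outer w x
            same {w} wD (y , ow) = go (x Fin.≟ y)
              where
              go : Dec (x ≡ y) → Outer w x
              go (yes refl) = ow
              go (no x≢y) = ⊥-elim (get-near vD wD ov ow x≢y λ {W} near →
                cover Hat add-near record { U⊆ = Near.W⊆ near ; x∈U = Near.x∈W near ; light = Near.start near } finish-hat)

    no-submaximal-brick : ∀ {D} (brick : LowBrick D) → (∀ {v} → v ∈ D → deg D v ≡ κ - + 2) → ⊥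
    no-submaximal-brick brick full = Submaximal.simple brick full λ s → Submaximal.Conclusion.impossible brick full s

    -- The Gallai-type bound for low vertices

    weight : Sub N → ℤ
    weight T = Σₛ T λ v → val (deg T v) (nb T v)

    private
      κ-2≥0 : 0ℤ ≤ + 6 * (κ - + 2)
      κ-2≥0 = fit (6 ⋆ κ≥5 ⊕ 0≤+ 18) (solve (κ ∷ []))

      -- The two excluded regularities leave degree at most `κ - 3`, the range of `complete-num` and
      -- `cyclic-num`.
      brick-weight : ∀ {D} → LowBrick D → weight D + + 6 * (κ - + 2) ≤ 0ℤ
      brick-weight {D} brick = go nonempty
        where
        open Brick brick
        go : Nonempty D → weight D + + 6 * (κ - + 2) ≤ 0ℤ
        go (v , vD) = stable λ neg → shape (λ c → neg (complete c)) λ c → neg (cyclic c)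
          where
          r n : ℤ
          r = deg D v
          n = card D
          same : ∀ {u} → u ∈ D → deg D u ≡ r
          same uD = regular two (rest-tight (proj₂ some-rest)) vD uD
          r≤ : r ≤ κ - + 3
          r≤ = r≤-arith (≤-trans (deg≤h vD) (hκ v)) (λ e → Top.no-top λ uD → trans (same uD) e) λ e → no-submaximal-brick brick λ uD → trans (same uD) e
          total : ∀ {ν} → (∀ {u} → u ∈ D → nb D u ≡ ν) → weight D + + 6 * (κ - + 2) ≡ Val n r ν (cap r)
          total {ν} e = cong (_+ + 6 * (κ - + 2)) (trans (Σₛ-cong D λ u uD → cong₂ val (same uD) (e uD)) (Σₛ-const D (val r ν)))
          complete : Complete D → weight D + + 6 * (κ - + 2) ≤ 0ℤ
          complete c = subst (_≤ 0ℤ) (sym (total (nb-complete c))) (complete-num (cap-view r) (card-pos D vD)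
            (subst (_≤ r) (nb-complete c vD) (nb≤deg v)) (deg-nonneg D v) (card≥2 vD) r≤)
          cyclic : (∀ u → u ∈ D → TwoNeighbours D u) → weight D + + 6 * (κ - + 2) ≤ 0ℤ
          cyclic c = subst (_≤ 0ℤ) (sym (total λ {u} uD → nb-two (c u uD))) (cyclic-num (cap-view r) (card-two (c v vD) vD)
            (subst (_≤ r) (nb-two (c v vD)) (nb≤deg v)) r≤)

      nb-part : ∀ {T A C} → Part T A C → ∀ v → nb T v ≡ nb A v + nb C v
      nb-part p v = Σₛ-part p (adj v)

      nb-⊝ : ∀ T {v} → v ∈ T → nb T v ≡ nb (T ⊝ v) v
      nb-⊝ T {v} p = trans (Σₛ-remove T p (adj v)) (trans (cong (λ z → + sgn z + nb (T ⊝ v) v) (m-irr v)) (+-identityˡ _))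

      far-deg : ∀ {C v} → (∀ {c} → c ∈ C → m v c ≡ 0) → deg C v ≡ 0ℤ
      far-deg {C} f = trans (Σₛ-cong C λ c q → cong +_ (f q)) (∑-zero λ c → on-zero (C c))

      far-nb : ∀ {C v} → (∀ {c} → c ∈ C → m v c ≡ 0) → nb C v ≡ 0ℤ
      far-nb {C} f = trans (Σₛ-cong C λ c q → cong (λ z → + sgn z) (f q)) (∑-zero λ c → on-zero (C c))

      val-far : ∀ {T A C} → Part T A C → ∀ {v} → (∀ {c} → c ∈ C → m v c ≡ 0) → val (deg T v) (nb T v) ≡ val (deg A v) (nb A v)
      val-far {T} {A} {C} p {v} f = cong₂ val (trans (deg-part p v) (trans (cong (λ z → deg A v + z) (far-deg f)) (+-identityʳ _)))
        (trans (nb-part p v) (trans (cong (λ z → nb A v + z) (far-nb f)) (+-identityʳ _)))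

      Bound : Sub N → Set
      Bound T = T ⊆ X → (∀ {v} → v ∈ T → deg X v ≤ h v) → Nonempty T → weight T + + 6 * (κ - + 2) ≤ 0ℤ

      by-cut : ∀ {T} → (∀ Y → Y ⊂ T → Bound Y) → T ⊆ X → (∀ {v} → v ∈ T → deg X v ≤ h v) → Cut T → weight T + + 6 * (κ - + 2) ≤ 0ℤ
      by-cut {T} rec s few (cut {A} {C} part (a , aA) (c , cC) apart) =
        by-cut-arith {weight T} {weight A} {weight C} whole
          (rec A (part-left part , c , part-right part c cC , part-disjoint (part-sym part) cC) (⊆-trans (part-left part) s) (few ∘ part-left part _) (a , aA))
          (rec C (part-right part , a , part-left part a aA , part-disjoint part aA) (⊆-trans (part-right part) s) (few ∘ part-right part _) (c , cC)) κ-2≥0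
        where
        whole : weight T ≡ weight A + weight C
        whole = trans (Σₛ-part part _) (cong₂ _+_ (Σₛ-cong A λ v vA → val-far part (apart vA))
          (Σₛ-cong C λ v vC → val-far (part-sym part) λ {b} bA → trans (m-sym v b) (apart bA vC)))

      -- The cut vertex belongs to both pieces; `val-join` pays for splitting its degree between
      -- them.
      by-cut-vertex : ∀ {T} → (∀ Y → Y ⊂ T → Bound Y) → T ⊆ X → (∀ {v} → v ∈ T → deg X v ≤ h v) → ∀ {x} → x ∈ T → Cut (T ⊝ x) →
        weight T + + 6 * (κ - + 2) ≤ 0ℤ
      by-cut-vertex {T} rec s few {x} xT (cut {A} {C} part (a , aA) (c , cC) apart) =
        by-cut-vertex-arith {weight T} {weight A⁺} {weight C⁺} {Σₛ A f} {Σₛ C f} {f x} {val (deg A⁺ x) (nb A⁺ x)} {val (deg C⁺ x) (nb C⁺ x)}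
          (trans (Σₛ-remove T xT f) (cong (λ z → f x + z) (Σₛ-part part f))) (side x∉A partA restA) (side x∉C partC restC) join
          (rec A⁺ (A⁺⊆ , c , C⊆ c cC , c∉A⁺) (⊆-trans A⁺⊆ s) (few ∘ A⁺⊆ _) (x , part-left partA x (∈⁅⁆ x)))
          (rec C⁺ (C⁺⊆ , a , A⊆ a aA , a∉C⁺) (⊆-trans C⁺⊆ s) (few ∘ C⁺⊆ _) (x , part-left partC x (∈⁅⁆ x)))
        where
        f : Fin N → ℤ
        f v = val (deg T v) (nb T v)
        A⁺ C⁺ : Sub N
        A⁺ v = ⁅ x ⁆ v ∨ A v
        C⁺ v = ⁅ x ⁆ v ∨ C v
        A⊆ : A ⊆ T
        A⊆ v vA = ∧-left (part-left part v vA)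
        C⊆ : C ⊆ T
        C⊆ v vC = ∧-left (part-right part v vC)
        x∉A : A x ≡ false
        x∉A = ≢true λ e → ⊝-≢ T (part-left part x e) refl
        x∉C : C x ≡ false
        x∉C = ≢true λ e → ⊝-≢ T (part-right part x e) refl
        partA : Part A⁺ ⁅ x ⁆ A
        partA = part-∨ λ v vA → ∉⁅⁆ (⊝-≢ T (part-left part v vA))
        partC : Part C⁺ ⁅ x ⁆ C
        partC = part-∨ λ v vC → ∉⁅⁆ (⊝-≢ T (part-right part v vC))
        A⁺⊆ : A⁺ ⊆ T
        A⁺⊆ v p = case part-either partA p of λ { (inj₁ e) → subst (_∈ T) (⁅⁆-≡ e) xT ; (inj₂ e) → A⊆ v e }
        C⁺⊆ : C⁺ ⊆ T
        C⁺⊆ v p = case part-either partC p of λ { (inj₁ e) → subst (_∈ T) (⁅⁆-≡ e) xT ; (inj₂ e) → C⊆ v e }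
        c∉A⁺ : A⁺ c ≡ false
        c∉A⁺ = ≢true λ p → case part-either partA p of λ { (inj₁ e) → ⊝-≢ T (part-right part c cC) (⁅⁆-≡ e) ; (inj₂ e) → tf cC (part-disjoint part e) }
        a∉C⁺ : C⁺ a ≡ false
        a∉C⁺ = ≢true λ p → case part-either partC p of λ { (inj₁ e) → ⊝-≢ T (part-left part a aA) (⁅⁆-≡ e) ; (inj₂ e) → tf e (part-disjoint part aA) }
        TA : Part T A⁺ C
        TA v = regroup (part-⊝ T xT v) (part v) (partA v)
          where
          regroup : ∀ {t b r a c a′} → Split t b r → Split r a c → Split a′ b a → Split t a′ c
          regroup left none left = left
          regroup right left right = left
          regroup right right none = right
          regroup none none none = none
        TC : Part T C⁺ A
        TC v = regroup (part-⊝ T xT v) (part v) (partC v)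
          where
          regroup : ∀ {t b r a c c′} → Split t b r → Split r a c → Split c′ b c → Split t c′ a
          regroup left none left = left
          regroup right left none = right
          regroup right right right = left
          regroup none none none = none
        restA : ∀ v → v ∈ A → f v ≡ val (deg A⁺ v) (nb A⁺ v)
        restA v vA = val-far TA (apart vA)
        restC : ∀ v → v ∈ C → f v ≡ val (deg C⁺ v) (nb C⁺ v)
        restC v vC = val-far TC λ {b} bA → trans (m-sym v b) (apart bA vC)
        side : ∀ {Z Z⁺} → Z x ≡ false → Part Z⁺ ⁅ x ⁆ Z → (∀ v → v ∈ Z → f v ≡ val (deg Z⁺ v) (nb Z⁺ v)) → weight Z⁺ ≡ val (deg Z⁺ x) (nb Z⁺ x) + Σₛ Z f
        side {Z} {Z⁺} _ p e = trans (Σₛ-part p _) (cong₂ _+_ (Σₛ-point x λ v → val (deg Z⁺ v) (nb Z⁺ v)) (sym (Σₛ-cong Z e)))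
        at-x : ∀ {Z⁺ Z} → Part Z⁺ ⁅ x ⁆ Z → deg Z⁺ x ≡ deg Z x × nb Z⁺ x ≡ nb Z x
        at-x {Z⁺} {Z} p = trans (deg-part p x) (trans (cong (_+ deg Z x) (trans (Σₛ-point x (μ x)) (cong +_ (m-irr x)))) (+-identityˡ _))
          , trans (nb-part p x) (trans (cong (_+ nb Z x) (trans (Σₛ-point x (adj x)) (cong (λ z → + sgn z) (m-irr x)))) (+-identityˡ _))
        degs : deg T x ≡ deg A⁺ x + deg C⁺ x
        degs = trans (deg-⊝ T xT) (trans (deg-part part x) (sym (cong₂ _+_ (proj₁ (at-x partA)) (proj₁ (at-x partC)))))
        nbs : nb T x ≡ nb A⁺ x + nb C⁺ x
        nbs = trans (nb-⊝ T xT) (trans (nb-part part x) (sym (cong₂ _+_ (proj₂ (at-x partA)) (proj₂ (at-x partC)))))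
        join : f x ≤ val (deg A⁺ x) (nb A⁺ x) + val (deg C⁺ x) (nb C⁺ x) + + 6 * (κ - + 2)
        join = subst (_≤ val (deg A⁺ x) (nb A⁺ x) + val (deg C⁺ x) (nb C⁺ x) + + 6 * (κ - + 2)) (sym (cong₂ val degs nbs))
          (val-join (deg-nonneg A⁺ x) (deg-nonneg C⁺ x) (subst (_≤ κ - 1ℤ) degs (≤-trans (deg-⊆ s x) (≤-trans (few xT) (hκ x)))))

    gallai : ∀ T → T ⊆ X → (∀ {v} → v ∈ T → deg X v ≤ h v) → Nonempty T → weight T + + 6 * (κ - + 2) ≤ 0ℤ
    gallai = ⊂-rec Bound λ T rec s few ne′ → cases stable (by-cut rec s few) λ conn →
      stable λ neg → neg (brick-weight record { D⊆X = s ; few = few ; nonempty = ne′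
        ; two = record { conn = conn ; conn⊝ = λ x xT c → neg (by-cut-vertex rec s few xT c) } })

    -- Discharging between low and high vertices

    private
      T U : Sub N
      T v = X v ∧ does (deg X v ≤? h v)
      U = X ∖ T

      T⊆X : T ⊆ X
      T⊆X v = ∧-left

      few : ∀ {v} → v ∈ T → deg X v ≤ h v
      few {v} e = does⇒ (deg X v ≤? h v) (∧-right {X v} e)

      high : ∀ {v} → v ∈ X → T v ≡ false → h v + 1ℤ ≤ deg X v
      high {v} vX e = above λ p → tf (∧-intro vX (dec-true (deg X v ≤? h v) p)) e

      part : Part X T U
      part = part-∖ T⊆X

      f : Fin N → ℤ
      f v = + 2 * P (h v) + (nb X v - (+ 2 * ℓ + 1ℤ) * deg X v)

      Σf : Σₛ X f ≡ + 2 * rho h X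
      Σf = trans (Σₛ-cong X λ v _ → cong (λ z → + 2 * P (h v) + z) (sym (Σ-E X v))) (sym (rho-double h X))

      nb≤ : ∀ Y v → nb Y v ≤ deg Y v
      nb≤ Y v = Σₛ-mono Y λ w _ → adj≤μ v w

      -- Each vertex has degree at least `h + 1` and contributes at most `2 - 2ℓ`, hence at most
      -- -10, to 2ρ(X), which is at least -6.
      all-high : ¬ Nonempty T → ⊥
      all-high none′ = clash 3 (≤-trans (2 ⋆ floor) (≤-trans (≤-reflexive (sym Σf)) (≤-trans (Σₛ-mono X {g = λ _ → -[1+ 9 ]} λ v vX →
          all-high-arith {h v} {corr (h v)} {nb X v} {deg X v} (P-def (h v)) (corr≤1 (view (h v) (hκ v))) (nb≤ X v) (high vX (≢true λ e → none′ (v , e))))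
          (≤-trans (≤-reflexive (Σₛ-const X -[1+ 9 ])) (all-high-few-many (card-pos X (proj₂ ne))))))) refl

      -- Along each edge between `T` and `U` one unit passes from the low to the high end, so the
      -- total is 0. High vertices are far enough below 0 to take it.
      shift : Fin N → ℤ
      shift v = if T v then - deg U v else deg T v

      -- The factor `2κ - 7` clears the denominator in the bound for λ; a unit moved weighs
      -- `2(κ - 2)`, the coefficient of `d - 3` in `val`.
      charge base : Fin N → ℤ
      charge v = (+ 2 * κ - + 7) * f v + + 2 * (κ - + 2) * shift v
      base v = on (T v) (val (deg T v) (nb T v))

      Σ-shift : Σₛ X shift ≡ 0ℤ
      Σ-shift = trans (Σₛ-part part shift) (trans (cong₂ _+_
          (trans (Σₛ-cong T λ v e → trans (cong (λ b → if b then - deg U v else deg T v) e) (Σ-shift-arith (deg U v))) (Σₛ-* T -[1+ 0 ] (deg U)))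
          (trans (Σₛ-cong U λ v e → cong (λ b → if b then - deg U v else deg T v) (∖-right X T e)) (edges-swap U T)))
        (Σ-shift-arith₁ (edges T U)))

      Σ-charge : Σₛ X charge ≡ (+ 2 * κ - + 7) * (+ 2 * rho h X)
      Σ-charge = trans (Σₛ-+ X _ _) (trans (cong₂ _+_ (trans (Σₛ-* X (+ 2 * κ - + 7) f) (cong ((+ 2 * κ - + 7) *_) Σf))
        (trans (Σₛ-* X (+ 2 * (κ - + 2)) shift) (trans (cong (+ 2 * (κ - + 2) *_) Σ-shift) (*-zeroʳ (+ 2 * (κ - + 2)))))) (+-identityʳ _))

      Σ-base : Σₛ X base ≡ weight T
      Σ-base = ∑-cong λ v → lem (X v) (does (deg X v ≤? h v)) (val (deg T v) (nb T v))
        where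
        lem : ∀ a b z → on a (on (a ∧ b) z) ≡ on (a ∧ b) z
        lem true b z = refl
        lem false b z = refl

      -- The second inequality carries the bonus of `v` in addition; it is invoked only at the
      -- witness, through `Σₛ-gain`.
      pays : ∀ v → v ∈ X → charge v ≤ base v × charge v + (+ 2 * (+ 2 * κ - + 7) * bonus (h v) - (+ 2 * κ + 1ℤ)) ≤ base v
      pays v vX = go (T v) refl
        where
        c : ℤ
        c = corr (h v)
        lowT : ∀ {A b} dT o νT νU p → Paid A b → h v ≡ dT + o → deg X v ≡ dT + o → nb X v ≡ νT + νU → νU ≤ o →
          A ≡ + 2 * (+ 2 * κ - + 7) * c - + 2 * (κ - + 2) * h v + + 6 * (κ - + 2) + + 2 * (κ - + 3) * p →
          (+ 2 * κ - + 7) * f v + + 2 * (κ - + 2) * - o ≤ + 2 * (κ - + 2) * (dT - + 3) - + 2 * (κ - + 3) * p - (+ 2 * κ - + 7) * (dT - νT)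
            × (+ 2 * κ - + 7) * f v + + 2 * (κ - + 2) * - o + (+ 2 * (+ 2 * κ - + 7) * b - (+ 2 * κ + 1ℤ)) ≤ + 2 * (κ - + 2) * (dT - + 3) - + 2 * (κ - + 3) * p - (+ 2 * κ - + 7) * (dT - νT)
        lowT {_} {b} dT o νT νU p (x , y) e₁ e₂ e₃ r refl =
            subst (λ f → (+ 2 * κ - + 7) * f + + 2 * (κ - + 2) * - o ≤ + 2 * (κ - + 2) * (dT - + 3) - + 2 * (κ - + 3) * p - (+ 2 * κ - + 7) * (dT - νT)) (sym fv) (num₁ c (subst (λ t → + 2 * (+ 2 * κ - + 7) * c - + 2 * (κ - + 2) * t + + 6 * (κ - + 2) + + 2 * (κ - + 3) * p ≤ 0ℤ) e₁ x))
            , subst (λ f → (+ 2 * κ - + 7) * f + + 2 * (κ - + 2) * - o + (+ 2 * (+ 2 * κ - + 7) * b - (+ 2 * κ + 1ℤ)) ≤ + 2 * (κ - + 2) * (dT - + 3) - + 2 * (κ - + 3) * p - (+ 2 * κ - + 7) * (dT - νT)) (sym fv) (num₂ c (subst (λ t → + 2 * (+ 2 * κ - + 7) * c - + 2 * (κ - + 2) * t + + 6 * (κ - + 2) + + 2 * (κ - + 3) * p + + 2 * (+ 2 * κ - + 7) * b ≤ + 2 * κ + 1ℤ) e₁ y))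
          where
          fv : f v ≡ + 2 * ((dT + o) * ℓ + c) + (νT + νU - (+ 2 * ℓ + 1ℤ) * (dT + o))
          fv = cong₂ (λ a b → + 2 * a + b) (trans (P-def (h v)) (cong (λ t → t * ℓ + c) e₁)) (cong₂ (λ a b → a - (+ 2 * ℓ + 1ℤ) * b) e₃ e₂)
          num₁ : ∀ c → + 2 * (+ 2 * κ - + 7) * c - + 2 * (κ - + 2) * (dT + o) + + 6 * (κ - + 2) + + 2 * (κ - + 3) * p ≤ 0ℤ →
            (+ 2 * κ - + 7) * (+ 2 * ((dT + o) * ℓ + c) + (νT + νU - (+ 2 * ℓ + 1ℤ) * (dT + o))) + + 2 * (κ - + 2) * - o ≤ + 2 * (κ - + 2) * (dT - + 3) - + 2 * (κ - + 3) * p - (+ 2 * κ - + 7) * (dT - νT)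
          num₁ c x = fit (x ⊕ scale 2κ-7≥0 r) eq
            where
            eq : + 2 * (κ - + 2) * (dT - + 3) - + 2 * (κ - + 3) * p - (+ 2 * κ - + 7) * (dT - νT) + (+ 2 * (+ 2 * κ - + 7) * c - + 2 * (κ - + 2) * (dT + o) + + 6 * (κ - + 2) + + 2 * (κ - + 3) * p + (+ 2 * κ - + 7) * νU)
              ≡ (+ 2 * κ - + 7) * (+ 2 * ((dT + o) * ℓ + c) + (νT + νU - (+ 2 * ℓ + 1ℤ) * (dT + o))) + + 2 * (κ - + 2) * - o + (0ℤ + (+ 2 * κ - + 7) * o)
            eq = solve (κ ∷ ℓ ∷ dT ∷ o ∷ νT ∷ νU ∷ p ∷ c ∷ [])
          num₂ : ∀ c → + 2 * (+ 2 * κ - + 7) * c - + 2 * (κ - + 2) * (dT + o) + + 6 * (κ - + 2) + + 2 * (κ - + 3) * p + + 2 * (+ 2 * κ - + 7) * b ≤ + 2 * κ + 1ℤ →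
            (+ 2 * κ - + 7) * (+ 2 * ((dT + o) * ℓ + c) + (νT + νU - (+ 2 * ℓ + 1ℤ) * (dT + o))) + + 2 * (κ - + 2) * - o + (+ 2 * (+ 2 * κ - + 7) * b - (+ 2 * κ + 1ℤ)) ≤ + 2 * (κ - + 2) * (dT - + 3) - + 2 * (κ - + 3) * p - (+ 2 * κ - + 7) * (dT - νT)
          num₂ c y = fit (y ⊕ scale 2κ-7≥0 r) eq
            where
            eq : + 2 * (κ - + 2) * (dT - + 3) - + 2 * (κ - + 3) * p - (+ 2 * κ - + 7) * (dT - νT) + (+ 2 * (+ 2 * κ - + 7) * c - + 2 * (κ - + 2) * (dT + o) + + 6 * (κ - + 2) + + 2 * (κ - + 3) * p + + 2 * (+ 2 * κ - + 7) * b + (+ 2 * κ - + 7) * νU)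
              ≡ (+ 2 * κ - + 7) * (+ 2 * ((dT + o) * ℓ + c) + (νT + νU - (+ 2 * ℓ + 1ℤ) * (dT + o))) + + 2 * (κ - + 2) * - o + (+ 2 * (+ 2 * κ - + 7) * b - (+ 2 * κ + 1ℤ)) + (+ 2 * κ + 1ℤ + (+ 2 * κ - + 7) * o)
            eq = solve (κ ∷ ℓ ∷ dT ∷ o ∷ νT ∷ νU ∷ p ∷ c ∷ b ∷ [])
        highU : ∀ {b t c} d ν dT p → p ≡ t * ℓ + c → Paid (+ 2 * (+ 2 * κ - + 7) * (t * ℓ + c - ℓ * d) + + 2 * (κ - + 2) * d) b → ν ≤ d → dT ≤ d →
          (+ 2 * κ - + 7) * (+ 2 * p + (ν - (+ 2 * ℓ + 1ℤ) * d)) + + 2 * (κ - + 2) * dT ≤ 0ℤ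
            × (+ 2 * κ - + 7) * (+ 2 * p + (ν - (+ 2 * ℓ + 1ℤ) * d)) + + 2 * (κ - + 2) * dT + (+ 2 * (+ 2 * κ - + 7) * b - (+ 2 * κ + 1ℤ)) ≤ 0ℤ
        highU {b} {t} {c} d ν dT p refl (x , y) r s = fit (x ⊕ scale 2κ-7≥0 r ⊕ scale 2κ-4≥0′ s) eq₁ , fit (y ⊕ scale 2κ-7≥0 r ⊕ scale 2κ-4≥0′ s) eq₂
          where
          eq₁ : 0ℤ + (+ 2 * (+ 2 * κ - + 7) * (t * ℓ + c - ℓ * d) + + 2 * (κ - + 2) * d + ((+ 2 * κ - + 7) * ν + + 2 * (κ - + 2) * dT))
            ≡ (+ 2 * κ - + 7) * (+ 2 * (t * ℓ + c) + (ν - (+ 2 * ℓ + 1ℤ) * d)) + + 2 * (κ - + 2) * dT + (0ℤ + ((+ 2 * κ - + 7) * d + + 2 * (κ - + 2) * d))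
          eq₁ = solve (κ ∷ ℓ ∷ t ∷ c ∷ d ∷ ν ∷ dT ∷ [])
          eq₂ : 0ℤ + (+ 2 * (+ 2 * κ - + 7) * (t * ℓ + c - ℓ * d) + + 2 * (κ - + 2) * d + + 2 * (+ 2 * κ - + 7) * b + ((+ 2 * κ - + 7) * ν + + 2 * (κ - + 2) * dT))
            ≡ (+ 2 * κ - + 7) * (+ 2 * (t * ℓ + c) + (ν - (+ 2 * ℓ + 1ℤ) * d)) + + 2 * (κ - + 2) * dT + (+ 2 * (+ 2 * κ - + 7) * b - (+ 2 * κ + 1ℤ)) + (+ 2 * κ + 1ℤ + ((+ 2 * κ - + 7) * d + + 2 * (κ - + 2) * d))
          eq₂ = solve (κ ∷ ℓ ∷ t ∷ c ∷ d ∷ ν ∷ dT ∷ b ∷ [])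
        Out : Bool → Set
        Out b = (+ 2 * κ - + 7) * f v + + 2 * (κ - + 2) * (if b then - deg U v else deg T v) ≤ on b (val (deg T v) (nb T v))
          × (+ 2 * κ - + 7) * f v + + 2 * (κ - + 2) * (if b then - deg U v else deg T v) + (+ 2 * (+ 2 * κ - + 7) * bonus (h v) - (+ 2 * κ + 1ℤ)) ≤ on b (val (deg T v) (nb T v))
        go : ∀ b → T v ≡ b → charge v ≤ base v × charge v + (+ 2 * (+ 2 * κ - + 7) * bonus (h v) - (+ 2 * κ + 1ℤ)) ≤ base v
        go true e = subst Out (sym e) (lowT (deg T v) (deg U v) (nb T v) (nb U v) (cap (deg T v))
          (paid-low (view (h v) (hκ v)) (cap-view (deg T v)) (≤-trans (deg-⊆ T⊆X v) (few e)) (h-pos vX))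
          (trans (≤-antisym (h≤deg vX) (few e)) (deg-part part v)) (deg-part part v) (Σₛ-part part (adj v)) (nb≤ U v) refl)
        go false e = subst Out (sym e) (highU {bonus (h v)} {h v} {corr (h v)} (deg X v) (nb X v) (deg T v) (P (h v)) (P-def (h v))
          (paid-high (view (h v) (hκ v)) (h-pos vX) (high vX e)) (nb≤ X v) (deg-⊆ T⊆X v))

    no-counterexample : ⊥
    no-counterexample = go (any? λ v → T v Bool.≟ true)
      where
      -- The Gallai-type bound contributes `6(κ - 2)`, and `r + b` at least -1 uses up `2(2κ - 7)`.
      -- The difference `2κ + 2` exceeds by one the `2κ + 1` granted in `Paid`.
      lem : ∀ {r b w s} → s ≡ (+ 2 * κ - + 7) * (+ 2 * r) → s + (+ 2 * (+ 2 * κ - + 7) * b - (+ 2 * κ + 1ℤ)) ≤ w → w + + 6 * (κ - + 2) ≤ 0ℤ → -[1+ 0 ] ≤ r + b → 1ℤ ≤ 0ℤ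
      lem {r} {b} {w} refl x y z = fit (x ⊕ y ⊕ 2 ⋆ scale 2κ-7≥0 z) eq
        where
        eq : 0ℤ + ((+ 2 * κ - + 7) * (+ 2 * r) + (+ 2 * (+ 2 * κ - + 7) * b - (+ 2 * κ + 1ℤ)) + (w + + 6 * (κ - + 2) + + 2 * ((+ 2 * κ - + 7) * -[1+ 0 ])))
          ≡ 1ℤ + (w + (0ℤ + + 2 * ((+ 2 * κ - + 7) * (r + b))))
        eq = solve (κ ∷ r ∷ b ∷ w ∷ [])
      go : Dec (∃ λ v → v ∈ T) → ⊥
      go (no n) = all-high n
      go (yes neT) = witness λ v vX p → clash 0 (lem {rho h X} {bonus (h v)} {weight T} {Σₛ X charge} Σ-charge
        (subst (Σₛ X charge + (+ 2 * (+ 2 * κ - + 7) * bonus (h v) - (+ 2 * κ + 1ℤ)) ≤_) Σ-base (Σₛ-gain X (λ u uX → proj₁ (pays u uX)) vX (proj₂ (pays v vX))))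
        (gallai T T⊆X few neT) p) refl

  -- The colouring theorem and the bound for minimal uncolourable sets

  sparse-colourable : ∀ {N K} (X : Sub N) → Goal K X
  sparse-colourable {N} {K} = ⊂-rec (Goal K) λ X rec {g} Γ l h long hκ sparse plain → decidable-stable (Colouring.colourable? Γ X l) λ uncol →
    Critical.no-counterexample record { minimal = rec ; Γ = Γ ; l = l ; h = h ; long = long ; hκ = hκ ; sparse = sparse ; plain = plain ; uncol = uncol }

  module _ {N K : ℕ} {X : Sub N} {g : Graph N} (Γ : Conflicts g (suc K)) (l : Lists N (suc K)) (h : Fin N → ℤ)
    (long : ∀ v → v ∈ X → h v ≤ len l v) (hκ : ∀ v → h v ≤ κ - 1ℤ) (plain : ¬ Weights.Exceptional g X)
    (uncol : ¬ Colouring.Colourable Γ X l) (proper-col : ∀ {Y} → Y ⊂ X → Colouring.Colourable Γ Y l) where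
    open Colouring Γ
    open Weights g

    private
      Claim : Sub N → Set
      Claim Z = ∀ {Y} → Part X Y Z → Nonempty Y → rho h X ≤ rho h Y

      -- If `Z` is nonempty, a colouring of `Y` leaves an uncolourable residue on `Z`, which has a
      -- bad set by `sparse-colourable`. Adding it to `Y` does not raise the potential, even when
      -- its bonus is dropped.
      rho-min : ∀ Z → Claim Z
      rho-min = ⊂-rec Claim λ Z rec {Y} part neY → step Z rec part neY (any? λ v → Z v Bool.≟ true)
        where
        step : ∀ Z → (∀ Z′ → Z′ ⊂ Z → Claim Z′) → ∀ {Y} → Part X Y Z → Nonempty Y → Dec (∃ λ v → v ∈ Z) → rho h X ≤ rho h Y
        step Z rec {Y} part neY (no n) = ≤-reflexive (rho-ext h (part-all part n))
        step Z rec {Y} part neY (yes (z , zZ)) = stable λ neg → absurd neg (proper-col (part-left part , z , part-right part z zZ , part-disjoint (part-sym part) zZ))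
          where
          h′ : Fin N → ℤ
          h′ v = h v - deg Y v
          absurd : ¬ rho h X ≤ rho h Y → Colourable Y l → ⊥
          absurd neg (φ , col) = uncol (combine part col (sparse-colourable Z Γ (resid Y φ l) h′
              (λ v vZ → absurd-arith (long v (part-right part v vZ)) (resid-len Y φ l v)) (λ v → absurd-arith₁ (hκ v) (deg-nonneg Y v)) sparse′ (plain ∘ Exceptional-⊆ (part-right part))))
            where
            sparse′ : ∀ Y′ → Y′ ⊆ Z → ¬ Bad h′ Y′
            sparse′ Y′ s ((u , uY′) , bad) = neg (≤-trans
                (rec (Z ∖ Y′) ((λ v → ∧-left) , u , s u uY′ , part-disjoint (part-∖ s) uY′) (part-merge part (part-∖ s) partY) (proj₁ neY , part-left partY _ (proj₂ neY)))
                (sparse-arith {rho h (λ v → Y v ∨ Y′ v)} {rho h Y} {rho h Y′} {cross Y Y′} {rho h′ Y′} {edges Y Y′} {bonus (h′ u)} (rho-part partY h) (cross-≤ Y Y′)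
                  (≤-trans (rho-shift {h} {h′} Y′ {λ v → (ℓ + + 2) * deg Y v} λ v _ → subst (λ z → P (h v) ≤ P (h′ v) + z) (*-comm (deg Y v) (ℓ + + 2)) (P-weak (hκ v) (deg-nonneg Y v)))
                    (≤-reflexive (cong (λ z → rho h′ Y′ + z) (trans (Σₛ-* Y′ (ℓ + + 2) (deg Y)) (cong ((ℓ + + 2) *_) (edges-swap Y′ Y))))))
                  (bad u uY′) (bonus≥0 (view (h′ u) (absurd-arith₁ (hκ u) (deg-nonneg Y u)))) (edges-nonneg Y Y′)))
              where
              partY : Part (λ v → Y v ∨ Y′ v) Y Y′
              partY = part-∨ λ v vY′ → part-disjoint (part-sym part) (s v vY′)

    -- By `rho-min` a bad subset already bounds ρ(X) by -2; without bad subsets `X` would be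
    -- colourable.
    rho-minimal : rho h X ≤ -[1+ 1 ]
    rho-minimal = stable λ neg → uncol (sparse-colourable X Γ l h long hκ (λ { Y s ((u , uY) , bad) → neg (≤-trans (rho-min (X ∖ Y) (part-∖ s) (u , uY))
        (rho-minimal-arith {rho h Y} (bad u uY) (bonus≥0 (view (h u) (hκ u))))) }) plain)

-- Translation of the statement: sums over lists, counting, enumeration

open import Defs

module _ where
  private
    variable
      A B : Set

  sumℤ-++ : ∀ (xs ys : List ℤ) → sumℤ (xs ++ ys) ≡ sumℤ xs + sumℤ ys
  sumℤ-++ [] ys = sym (+-identityˡ _)
  sumℤ-++ (x ∷ xs) ys = trans (cong (λ z → x + z) (sumℤ-++ xs ys)) (assoc x (sumℤ xs) (sumℤ ys))
    where
    assoc : ∀ a b c → a + (b + c) ≡ a + b + c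
    assoc a b c = solve (a ∷ b ∷ c ∷ [])

  sumℤ-concatMap : ∀ (f : B → ℤ) (g : A → List B) xs → sumℤ (map f (concatMap g xs)) ≡ sumℤ (map (λ x → sumℤ (map f (g x))) xs)
  sumℤ-concatMap f g [] = refl
  sumℤ-concatMap f g (x ∷ xs) = trans (cong sumℤ (map-++ f (g x) (concatMap g xs)))
    (trans (sumℤ-++ (map f (g x)) _) (cong (λ z → sumℤ (map f (g x)) + z) (sumℤ-concatMap f g xs)))

  sumℤ-tabulate : ∀ n (f : A → ℤ) (g : Fin n → A) → sumℤ (map f (tabulate g)) ≡ ∑ (λ i → f (g i))
  sumℤ-tabulate zero f g = sym (∑-nil (f ∘ g))
  sumℤ-tabulate (suc n) f g = trans (cong (λ z → f (g zero) + z) (sumℤ-tabulate n f (g ∘ suc))) (sym (∑-cons (f ∘ g)))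

  sumℤ-filter : ∀ {P : A → Set} (P? : ∀ a → Dec (P a)) n (f : B → ℤ) (p : A → B) (g : Fin n → A) →
    sumℤ (map f (map p (filter P? (tabulate g)))) ≡ ∑ (λ i → on (does (P? (g i))) (f (p (g i))))
  sumℤ-filter P? zero f p g = sym (∑-nil λ i → on (does (P? (g i))) (f (p (g i))))
  sumℤ-filter P? (suc n) f p g = trans step (sym (∑-cons λ i → on (does (P? (g i))) (f (p (g i)))))
    where
    step : sumℤ (map f (map p (filter P? (tabulate g)))) ≡ on (does (P? (g zero))) (f (p (g zero))) + ∑ (λ i → on (does (P? (g (suc i)))) (f (p (g (suc i)))))
    step with does (P? (g zero))
    ... | true = cong (λ z → f (p (g zero)) + z) (sumℤ-filter P? n f p (g ∘ suc))
    ... | false = trans (sumℤ-filter P? n f p (g ∘ suc)) (sym (+-identityˡ _))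

  length-filter : ∀ {P : A → Set} (P? : ∀ a → Dec (P a)) n (g : Fin n → A) →
    + length (filter P? (tabulate g)) ≡ count (λ i → does (P? (g i)))
  length-filter P? zero g = sym (∑-nil λ i → on (does (P? (g i))) 1ℤ)
  length-filter P? (suc n) g = trans step (sym (∑-cons λ i → on (does (P? (g i))) 1ℤ))
    where
    step : + length (filter P? (tabulate g)) ≡ on (does (P? (g zero))) 1ℤ + count (λ i → does (P? (g (suc i))))
    step with does (P? (g zero))
    ... | true = cong (λ z → 1ℤ + z) (length-filter P? n (g ∘ suc))
    ... | false = trans (length-filter P? n (g ∘ suc)) (sym (+-identityˡ _))

count-below : ∀ M s → s ℕ.≤ M → + s ≤ count {M} (λ c → toℕ c ℕ.<ᵇ s)
count-below M zero _ = ∑-nonneg λ c → ≤-refl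
count-below (suc M) (suc s) (s≤s p) = ≤-trans (≤-refl {1ℤ} ⊕ count-below M s p) (≤-reflexive (sym (∑-cons λ c → on (toℕ c ℕ.<ᵇ suc s) 1ℤ)))

upper : ∀ {n} → (Fin n → ℕ) → ℕ
upper {zero} f = 0
upper {suc n} f = f zero ℕ.+ upper (f ∘ suc)

≤-upper : ∀ {n} (f : Fin n → ℕ) i → f i ℕ.≤ upper f
≤-upper f zero = ℕ.m≤m+n _ _
≤-upper f (suc i) = ℕ.≤-trans (≤-upper (f ∘ suc) i) (ℕ.m≤n+m _ _)

enumerate : ∀ {N} n (W : Sub N) → card W ≡ + n → ∃ λ (f : Fin n → Fin N) → Injective _≡_ _≡_ f × (∀ i → f i ∈ W)
enumerate zero W e = (λ ()) , (λ { {()} }) , λ ()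
enumerate {N} (suc n) W e = go (card-some W (≤-trans (+≤+ (s≤s z≤n)) (≤-reflexive (sym e))))
  where
  go : Nonempty W → _
  go (v , vW) = f , (λ {i} {j} → inj {i} {j}) , within
    where
    less : card (W ⊝ v) ≡ + n
    less = lem (card-remove W vW) e
      where
      lem : ∀ {a b} → a ≡ 1ℤ + b → a ≡ + suc n → b ≡ + n
      lem {b = b} refl p = trans (undo b) (cong (λ z → - 1ℤ + z) p)
        where
        undo : ∀ b → b ≡ - 1ℤ + (1ℤ + b)
        undo b = solve (b ∷ [])
    rest : _
    rest = enumerate n (W ⊝ v) less
    f : Fin (suc n) → Fin N
    f zero = v
    f (suc i) = proj₁ rest i
    inj : Injective _≡_ _≡_ f
    inj {zero} {zero} _ = refl
    inj {zero} {suc j} p = ⊥-elim (⊝-≢ W (proj₂ (proj₂ rest) j) p)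
    inj {suc i} {zero} p = ⊥-elim (⊝-≢ W (proj₂ (proj₂ rest) i) (sym p))
    inj {suc i} {suc j} p = cong suc (proj₁ (proj₂ rest) p)
    within : ∀ i → f i ∈ W
    within zero = vW
    within (suc i) = ∧-left (proj₂ (proj₂ rest) i)

-- Multigraphs given by their edges; extracting a double cycle

module MultigraphGraph (G : Multigraph) where
  private
    N = n G

  Ends : Fin (m G) → Fin N → Fin N → Set
  Ends e x y = proj₁ (ends G e) ≡ x × proj₂ (ends G e) ≡ y

  Joins : Fin (m G) → Fin N → Fin N → Set
  Joins e x y = Ends e x y ⊎ Ends e y x

  joins-true : ∀ e x y → joins? G e x y ≡ true → Joins e x y
  joins-true e x y with ends G e
  ... | (a , b) with a Fin.≟ x | b Fin.≟ y | a Fin.≟ y | b Fin.≟ x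
  ...   | yes p | yes q | _ | _ = λ _ → inj₁ (p , q)
  ...   | yes _ | no _ | yes p | yes q = λ _ → inj₂ (p , q)
  ...   | no _ | _ | yes p | yes q = λ _ → inj₂ (p , q)
  ...   | yes _ | no _ | yes _ | no _ = λ ()
  ...   | yes _ | no _ | no _ | _ = λ ()
  ...   | no _ | _ | yes _ | no _ = λ ()
  ...   | no _ | _ | no _ | _ = λ ()

  joins-intro : ∀ e x y → Joins e x y → joins? G e x y ≡ true
  joins-intro e x y with ends G e
  ... | (a , b) with a Fin.≟ x | b Fin.≟ y | a Fin.≟ y | b Fin.≟ x
  ...   | yes p | yes q | _ | _ = λ _ → refl
  ...   | yes _ | no _ | yes p | yes q = λ _ → refl
  ...   | no _ | _ | yes p | yes q = λ _ → refl
  ...   | yes _ | no ¬q | yes _ | no ¬r = λ { (inj₁ (_ , q)) → ⊥-elim (¬q q) ; (inj₂ (_ , r)) → ⊥-elim (¬r r) }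
  ...   | yes _ | no ¬q | no ¬r | _ = λ { (inj₁ (_ , q)) → ⊥-elim (¬q q) ; (inj₂ (r , _)) → ⊥-elim (¬r r) }
  ...   | no ¬p | _ | yes _ | no ¬r = λ { (inj₁ (p , _)) → ⊥-elim (¬p p) ; (inj₂ (_ , r)) → ⊥-elim (¬r r) }
  ...   | no ¬p | _ | no ¬r | _ = λ { (inj₁ (p , _)) → ⊥-elim (¬p p) ; (inj₂ (r , _)) → ⊥-elim (¬r r) }

  does-true : ∀ b → does (b Bool.≟ true) ≡ b
  does-true true = refl
  does-true false = refl

  mult-count : ∀ x y → + mult G x y ≡ count (λ e → joins? G e x y)
  mult-count x y = trans (length-filter (λ e → joins? G e x y Bool.≟ true) (m G) (λ e → e))
    (∑-cong λ e → cong (λ b → on b 1ℤ) (does-true (joins? G e x y)))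

  joins-swap : ∀ e x y → joins? G e x y ≡ joins? G e y x
  joins-swap e x y with joins? G e x y in p | joins? G e y x in q
  ... | true | true = refl
  ... | false | false = refl
  ... | true | false = ⊥-elim (tf (joins-intro e y x (swap (joins-true e x y p))) q)
    where
    swap : Joins e x y → Joins e y x
    swap (inj₁ z) = inj₂ z
    swap (inj₂ z) = inj₁ z
  ... | false | true = ⊥-elim (tf (joins-intro e x y (swap (joins-true e y x q))) p)
    where
    swap : Joins e y x → Joins e x y
    swap (inj₁ z) = inj₂ z
    swap (inj₂ z) = inj₁ z

  graph : Graph N
  graph = record
    { m = mult G
    ; m-sym = λ x y → +-injective (trans (mult-count x y) (trans (∑-cong λ e → cong (λ b → on b 1ℤ) (joins-swap e x y)) (sym (mult-count y x))))
    ; m-irr = λ x → +-injective (trans (mult-count x x) (∑-zero λ e → cong (λ b → on b 1ℤ) (≢true λ p → loop e x (joins-true e x x p)))) }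
    where
    loop : ∀ e x → Joins e x x → ⊥
    loop e x (inj₁ (p , q)) = loopless G e (trans p (sym q))
    loop e x (inj₂ (p , q)) = loopless G e (trans p (sym q))

  -- Walking along double edges without turning back closes a double cycle.
  walk : ∀ (W : Sub N) → (∀ v → v ∈ W → ∃ λ a → ∃ λ b → a ∈ W × b ∈ W × a ≢ b × + 2 ≤ + mult G v a × + 2 ≤ + mult G v b) →
    ∀ fuel ℓ (f : Fin (suc (suc ℓ)) → Fin N) → Injective _≡_ _≡_ f → (∀ i → f i ∈ W) →
    ((i : Fin (suc ℓ)) → 2 ℕ.≤ mult G (f (Fin.inject₁ i)) (f (suc i))) → N ℕ.≤ fuel ℕ.+ ℓ → HasDoubleCycle G
  -- The walk holds `ℓ + 2` distinct vertices, while exhausted fuel means `N ≤ ℓ`.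
  walk W nbrs zero ℓ f inj fW edge p = ⊥-elim (ℕ.<-irrefl refl (ℕ.≤-trans (ℕ.≤-trans (ℕ.m≤n⇒m≤1+n ℕ.≤-refl) (Fin.injective⇒≤ inj)) p))
  walk W nbrs (suc fuel) ℓ f inj fW edge p = choose (nbrs (f zero) (fW zero))
    where
    go : ∀ w → w ∈ W → 2 ℕ.≤ mult G (f zero) w → w ≢ f (suc zero) → Dec (∃ λ i → f i ≡ w) → HasDoubleCycle G
    go w wW two w≢ (no fresh) = walk W nbrs fuel (suc ℓ) f′ inj′ f′W edge′ (subst (N ℕ.≤_) (sym (ℕ.+-suc fuel ℓ)) p)
      where
      f′ : Fin (suc (suc (suc ℓ))) → Fin N
      f′ zero = w
      f′ (suc i) = f i
      inj′ : Injective _≡_ _≡_ f′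
      inj′ {zero} {zero} _ = refl
      inj′ {zero} {suc j} e = ⊥-elim (fresh (j , sym e))
      inj′ {suc i} {zero} e = ⊥-elim (fresh (i , e))
      inj′ {suc i} {suc j} e = cong suc (inj e)
      f′W : ∀ i → f′ i ∈ W
      f′W zero = wW
      f′W (suc i) = fW i
      edge′ : (i : Fin (suc (suc ℓ))) → 2 ℕ.≤ mult G (f′ (Fin.inject₁ i)) (f′ (suc i))
      edge′ zero = subst (2 ℕ.≤_) (Graph.m-sym graph (f zero) w) two
      edge′ (suc i) = edge i
    -- The walk is stored with its newest vertex at `f zero`, so a repetition at index `i` closes
    -- the cycle on the indices 0 to `i`. Not turning back excludes index 1, as a cycle needs three
    -- vertices.
    go w wW two w≢ (yes (i , fi)) = toℕ i , far i fi , g , (λ e → Fin.toℕ-injective (trans (sym (Fin.toℕ-inject≤ _ bnd)) (trans (cong toℕ (inj e)) (Fin.toℕ-inject≤ _ bnd)))) , edges′ , close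
      where
      far : ∀ i → f i ≡ w → 2 ℕ.≤ toℕ i
      far zero e = ⊥-elim (ℕ.n≮0 {1} (subst (2 ℕ.≤_) (trans (cong (mult G (f zero)) (sym e)) (Graph.m-irr graph (f zero))) two))
      far (suc zero) e = ⊥-elim (w≢ (sym e))
      far (suc (suc i)) e = s≤s (s≤s z≤n)
      bnd : suc (toℕ i) ℕ.≤ suc (suc ℓ)
      bnd = Fin.toℕ<n i
      g : Fin (suc (toℕ i)) → Fin N
      g j = f (Fin.inject≤ j bnd)
      edges′ : (j : Fin (toℕ i)) → 2 ℕ.≤ mult G (g (Fin.inject₁ j)) (g (suc j))
      edges′ j = subst₂ (λ a b → 2 ℕ.≤ mult G (f a) (f b))
        (Fin.toℕ-injective (trans (Fin.toℕ-inject₁ _) (trans (Fin.toℕ-inject≤ j (ℕ.s≤s⁻¹ bnd)) (sym (trans (Fin.toℕ-inject≤ (Fin.inject₁ j) bnd) (Fin.toℕ-inject₁ j))))))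
        (Fin.toℕ-injective (trans (cong suc (Fin.toℕ-inject≤ j (ℕ.s≤s⁻¹ bnd))) (sym (Fin.toℕ-inject≤ (suc j) bnd))))
        (edge (Fin.inject≤ j (ℕ.s≤s⁻¹ bnd)))
      close : 2 ℕ.≤ mult G (g (Fin.fromℕ (toℕ i))) (g zero)
      close = subst₂ (λ a b → 2 ℕ.≤ mult G a b)
        (trans (sym fi) (cong f (Fin.toℕ-injective (sym (trans (Fin.toℕ-inject≤ (Fin.fromℕ (toℕ i)) bnd) (Fin.toℕ-fromℕ (toℕ i)))))))
        (cong f (Fin.toℕ-injective (sym (Fin.toℕ-inject≤ zero bnd))))
        (subst (2 ℕ.≤_) (Graph.m-sym graph (f zero) w) two)
    choose : (∃ λ a → ∃ λ b → a ∈ W × b ∈ W × a ≢ b × + 2 ≤ + mult G (f zero) a × + 2 ≤ + mult G (f zero) b) → HasDoubleCycle G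
    choose (a , b , aW , bW , a≢b , p , q) = pick (a Fin.≟ f (suc zero))
      where
      pick : Dec (a ≡ f (suc zero)) → HasDoubleCycle G
      pick (no ne) = go a aW (drop‿+≤+ p) ne (any? λ i → f i Fin.≟ a)
      pick (yes e) = go b bW (drop‿+≤+ q) (λ r → a≢b (trans e (sym r))) (any? λ i → f i Fin.≟ b)

  double-cycle : ∀ (W : Sub N) → Nonempty W → (∀ v → v ∈ W → ∃ λ a → ∃ λ b → a ∈ W × b ∈ W × a ≢ b × + 2 ≤ + mult G v a × + 2 ≤ + mult G v b) → HasDoubleCycle G
  double-cycle W (v , vW) nbrs = start (nbrs v vW)
    where
    start : (∃ λ a → ∃ λ b → a ∈ W × b ∈ W × a ≢ b × + 2 ≤ + mult G v a × + 2 ≤ + mult G v b) → HasDoubleCycle G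
    start (a , _ , aW , _ , _ , two , _) = walk W nbrs N 0 f inj within edge (ℕ.m≤m+n N 0)
      where
      v≢a : v ≢ a
      v≢a refl = ℕ.n≮0 {1} (subst (2 ℕ.≤_) (Graph.m-irr graph v) (drop‿+≤+ two))
      f : Fin 2 → Fin N
      f zero = v
      f (suc zero) = a
      inj : Injective _≡_ _≡_ f
      inj {zero} {zero} _ = refl
      inj {zero} {suc zero} e = ⊥-elim (v≢a e)
      inj {suc zero} {zero} e = ⊥-elim (v≢a (sym e))
      inj {suc zero} {suc zero} _ = refl
      within : ∀ i → f i ∈ W
      within zero = vW
      within (suc zero) = aW
      edge : (i : Fin 1) → 2 ℕ.≤ mult G (f (Fin.inject₁ i)) (f (suc i))
      edge zero = drop‿+≤+ two

  -- Covers as conflict relations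

  module CoverConflicts (C : Cover G) where
    -- All lists become initial segments of one colour set. Its size is the successor of this bound,
    -- so there is always a colour to assign outside the coloured set.
    colours-bound : ℕ
    colours-bound = upper (size C)

    Match : ∀ e → Fin (suc colours-bound) → Fin (suc colours-bound) → Set
    Match e a b = ∃ λ a′ → ∃ λ b′ → toℕ a′ ≡ toℕ a × toℕ b′ ≡ toℕ b × match C e a′ b′ ≡ true

    match? : ∀ e a b → Dec (Match e a b)
    match? e a b = any? λ a′ → any? λ b′ → (toℕ a′ ℕ.≟ toℕ a) ×-dec ((toℕ b′ ℕ.≟ toℕ b) ×-dec (match C e a′ b′ Bool.≟ true))

    Hit : Fin N → Fin N → Fin (suc colours-bound) → Fin (suc colours-bound) → Fin (m G) → Set
    Hit v w a b e = (Ends e v w × Match e a b) ⊎ (Ends e w v × Match e b a)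

    hit? : ∀ v w a b e → Dec (Hit v w a b e)
    hit? v w a b e = (((proj₁ (ends G e) Fin.≟ v) ×-dec (proj₂ (ends G e) Fin.≟ w)) ×-dec match? e a b)
      ⊎-dec (((proj₁ (ends G e) Fin.≟ w) ×-dec (proj₂ (ends G e) Fin.≟ v)) ×-dec match? e b a)

    hits : Fin N → Fin N → Fin (suc colours-bound) → Fin (suc colours-bound) → Bool
    hits v w a b = some λ e → does (hit? v w a b e)

    hits-false : ∀ {v w a b} → hits v w a b ≡ false → ∀ e → ¬ Hit v w a b e
    hits-false {v} {w} {a} {b} p e q = tf (dec-true (hit? v w a b e) q) (some-false _ p e)

    hits-none : ∀ {v w a b} → (∀ e → ¬ Hit v w a b e) → hits v w a b ≡ false
    hits-none {v} {w} {a} {b} p = some-none _ λ e → dec-false (hit? v w a b e) (p e)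

    Hit-swap : ∀ {v w a b e} → Hit v w a b e → Hit w v b a e
    Hit-swap (inj₁ z) = inj₂ z
    Hit-swap (inj₂ z) = inj₁ z

    Match-unique₂ : ∀ {e a b c} → Match e a b → Match e a c → b ≡ c
    Match-unique₂ {e} (a₁ , b₁ , p₁ , q₁ , r₁) (a₂ , b₂ , p₂ , q₂ , r₂) with Fin.toℕ-injective (trans p₁ (sym p₂))
    ... | refl = Fin.toℕ-injective (trans (sym q₁) (trans (cong toℕ (match-inj₁ C e a₁ b₁ b₂ r₁ r₂)) q₂))

    Match-unique₁ : ∀ {e a b c} → Match e b a → Match e c a → b ≡ c
    Match-unique₁ {e} (b₁ , a₁ , q₁ , p₁ , r₁) (b₂ , a₂ , q₂ , p₂ , r₂) with Fin.toℕ-injective (trans p₁ (sym p₂))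
    ... | refl = Fin.toℕ-injective (trans (sym q₁) (trans (cong toℕ (match-inj₂ C e b₁ b₂ a₁ r₁ r₂)) q₂))

    -- Both readings of an edge at once would make it a loop; within one reading this is the
    -- matching property.
    Hit-unique : ∀ {v w a b c e} → Hit v w a b e → Hit v w a c e → b ≡ c
    Hit-unique (inj₁ (_ , p)) (inj₁ (_ , q)) = Match-unique₂ p q
    Hit-unique (inj₂ (_ , p)) (inj₂ (_ , q)) = Match-unique₁ p q
    Hit-unique {e = e} (inj₁ ((p , q) , _)) (inj₂ ((r , s) , _)) = ⊥-elim (loopless G e (trans p (sym s)))
    Hit-unique {e = e} (inj₂ ((p , q) , _)) (inj₁ ((r , s) , _)) = ⊥-elim (loopless G e (trans p (sym s)))

    conflicts : Conflicts graph (suc colours-bound)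
    conflicts = record
      { R = hits
      ; R-sym = λ v w a b → symmetric v w a b (hits v w a b) (hits w v b a) refl refl
      ; R-deg = λ v w a → ≤-trans (∑-mono λ b → some-≤ (λ e → does (hit? v w a b e)))
          (≤-trans (≤-reflexive (∑-swap λ b e → on (does (hit? v w a b e)) 1ℤ)) (≤-trans (∑-mono λ e → once v w a e) (≤-reflexive (sym (mult-count v w))))) }
      where
      symmetric : ∀ v w a b s t → hits v w a b ≡ s → hits w v b a ≡ t → s ≡ t
      symmetric v w a b true true _ _ = refl
      symmetric v w a b false false _ _ = refl
      symmetric v w a b true false p q = ⊥-elim (tf p (hits-none λ e z → hits-false q e (Hit-swap z)))
      symmetric v w a b false true p q = ⊥-elim (tf q (hits-none λ e z → hits-false p e (Hit-swap z)))
      once : ∀ v w a e → count (λ b → does (hit? v w a b e)) ≤ on (joins? G e v w) 1ℤ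
      once v w a e = go (joins? G e v w) refl
        where
        joined : ∀ {b} → Hit v w a b e → Joins e v w
        joined (inj₁ (p , _)) = inj₁ p
        joined (inj₂ (p , _)) = inj₂ p
        go : ∀ s → joins? G e v w ≡ s → count (λ b → does (hit? v w a b e)) ≤ on s 1ℤ
        go true _ = count-≤1 {f = λ b → does (hit? v w a b e)} λ b c p q → Hit-unique (does⇒ (hit? v w a b e) p) (does⇒ (hit? v w a c e) q)
        go false p = ≤-reflexive (∑-zero λ b → cong (λ s → on s 1ℤ) (dec-false (hit? v w a b e) λ z → tf (joins-intro e v w (joined z)) p))

    lists : Lists N (suc colours-bound)
    lists v c = toℕ c ℕ.<ᵇ size C v

    lists-len : ∀ v → + size C v ≤ len lists v
    lists-len v = count-below (suc colours-bound) (size C v) (ℕ.m≤n⇒m≤1+n (≤-upper (size C) v))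

    lists-< : ∀ {v c} → lists v c ≡ true → toℕ c ℕ.< size C v
    lists-< {v} {c} e = ℕ.<ᵇ⇒< (toℕ c) (size C v) (subst Bool.T (sym e) tt)

    module Col = Colouring conflicts

    full : Sub N
    full _ = true

    to-coloring : Col.Colourable full lists → Coloring C (whole G)
    to-coloring (ψ , Col.colours good clean) = (λ v _ → φ v) , λ e _ → ≢true λ p →
        hits-false (clean (proj₁ (ends G e)) (proj₂ (ends G e)) refl refl) e (inj₁ ((refl , refl) , φ _ , φ _ , φ-toℕ _ , φ-toℕ _ , p))
      where
      φ : ∀ v → Fin (size C v)
      φ v = Fin.fromℕ< (lists-< {v} {ψ v} (good v refl))
      φ-toℕ : ∀ v → toℕ (φ v) ≡ toℕ (ψ v)
      φ-toℕ v = Fin.toℕ-fromℕ< (lists-< {v} {ψ v} (good v refl))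

    -- Colourings of a vertex set avoid all conflicts inside it, so they correspond to the induced
    -- subgraph; a proper subset loses a vertex, which makes the subgraph proper.
    induced : Sub N → Subgraph G
    induced Y = record { S = Y ; T = λ e → Y (proj₁ (ends G e)) ∧ Y (proj₂ (ends G e))
                       ; closed₁ = λ e → ∧-left ; closed₂ = λ e → ∧-right {Y (proj₁ (ends G e))} }

    from-coloring : ∀ Y → Coloring C (induced Y) → Col.Colourable Y lists
    from-coloring Y (φ , proper) = ψ , Col.colours (λ v vY → good v vY) λ v w vY wY → hits-none λ e → clean v w vY wY e
      where
      fit-in : ∀ v → size C v ℕ.≤ suc colours-bound
      fit-in v = ℕ.m≤n⇒m≤1+n (≤-upper (size C) v)
      -- The equation is an argument because `φ` asks for a proof of membership; outside `Y` the
      -- colour is arbitrary.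
      at : ∀ v b → Y v ≡ b → Fin (suc colours-bound)
      at v true e = Fin.inject≤ (φ v e) (fit-in v)
      at v false _ = zero
      ψ : Fin N → Fin (suc colours-bound)
      ψ v = at v (Y v) refl
      at-toℕ : ∀ v b (e : Y v ≡ b) (vY : v ∈ Y) → toℕ (at v b e) ≡ toℕ (φ v vY)
      at-toℕ v true e vY = trans (Fin.toℕ-inject≤ (φ v e) (fit-in v)) (cong (λ p → toℕ (φ v p)) (irrelevant e vY))
        where
        irrelevant : ∀ {b} (p q : b ≡ true) → p ≡ q
        irrelevant refl refl = refl
      at-toℕ v false e vY = ⊥-elim (tf vY e)
      ψ-toℕ : ∀ v vY → toℕ (ψ v) ≡ toℕ (φ v vY)
      ψ-toℕ v vY = at-toℕ v (Y v) refl vY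
      good : ∀ v → v ∈ Y → lists v (ψ v) ≡ true
      good v vY = T⇒ (ℕ.<⇒<ᵇ (subst (ℕ._< size C v) (sym (ψ-toℕ v vY)) (Fin.toℕ<n (φ v vY))))
        where
        T⇒ : ∀ {b} → Bool.T b → b ≡ true
        T⇒ {true} _ = refl
      edge : ∀ v w → v ∈ Y → w ∈ Y → ∀ e → Ends e v w → ¬ Match e (ψ v) (ψ w)
      edge v w vY wY e (refl , refl) (a , b , p , q , r) = tf (subst₂ (λ a b → match C e a b ≡ true) (same v p) (same w q) r) (proper e (∧-intro vY wY))
        where
        same : ∀ u {a} {uY : u ∈ Y} → toℕ a ≡ toℕ (ψ u) → a ≡ φ u uY
        same u {a} {uY} p = Fin.toℕ-injective (trans p (ψ-toℕ u uY))
      clean : ∀ v w → v ∈ Y → w ∈ Y → ∀ e → ¬ Hit v w (ψ v) (ψ w) e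
      clean v w vY wY e (inj₁ (p , q)) = edge v w vY wY e p q
      clean v w vY wY e (inj₂ (p , q)) = edge w v wY vY e p q

-- Vertex potentials, the value of λ, and the theorem

ρv-top : ∀ k {t} → suc t ≡ k → ρv k t ≡ + (t ℕ.* lam k) + 1ℤ
ρv-top k {t} e with suc t ℕ.≟ k | t ℕ.≤? 1
... | yes _ | _ = refl
... | no n | _ = ⊥-elim (n e)

ρv-low : ∀ k {t} → suc t ≢ k → t ℕ.≤ 1 → ρv k t ≡ + (t ℕ.* lam k) - + 2
ρv-low k {t} n p with suc t ℕ.≟ k | t ℕ.≤? 1
... | yes e | _ = ⊥-elim (n e)
... | no _ | yes _ = refl
... | no _ | no q = ⊥-elim (q p)

ρv-mid : ∀ k {t} → suc t ≢ k → ¬ t ℕ.≤ 1 → ρv k t ≡ + (t ℕ.* lam k) - 1ℤ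
ρv-mid k {t} n q with suc t ℕ.≟ k | t ℕ.≤? 1
... | yes e | _ = ⊥-elim (n e)
... | no _ | yes p = ⊥-elim (q p)
... | no _ | no _ = refl

module Parameters {k : ℕ} (k≥5 : 5 ℕ.≤ k) where
  κ ℓ : ℤ
  κ = + k
  ℓ = + lam k

  private
    j : ℕ
    j = proj₁ (ℕ.m≤n⇒∃[o]m+o≡n k≥5)

    k≡ : k ≡ 5 ℕ.+ j
    k≡ = sym (proj₂ (ℕ.m≤n⇒∃[o]m+o≡n k≥5))

    -- `num` is `k² - 7` and `suc den` is `2k - 7`, expressed in `j = k - 5` so that no truncated
    -- subtraction is left.
    num den : ℕ
    num = 18 ℕ.+ 10 ℕ.* j ℕ.+ j ℕ.* j
    den = 2 ℕ.+ 2 ℕ.* j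

    lam≡ : lam k ≡ (num ℕ.+ den) ℕ./ suc den
    lam≡ = trans (cong lam k≡) (cong₂ (λ a b → (a ℕ.+ b) ℕ./ suc b) square double)
      where
      square : (5 ℕ.+ j) ℕ.* (5 ℕ.+ j) ℕ.∸ 7 ≡ num
      square = trans (cong (ℕ._∸ 7) (expand j)) (ℕ.m+n∸m≡n 7 num)
        where
        expand : ∀ j → (5 ℕ.+ j) ℕ.* (5 ℕ.+ j) ≡ 7 ℕ.+ (18 ℕ.+ 10 ℕ.* j ℕ.+ j ℕ.* j)
        expand j = solveℕ (j ∷ [])
      double : 2 ℕ.* (5 ℕ.+ j) ℕ.∸ 8 ≡ den
      double = trans (cong (ℕ._∸ 8) (expand j)) (ℕ.m+n∸m≡n 8 den)
        where
        expand : ∀ j → 2 ℕ.* (5 ℕ.+ j) ≡ 8 ℕ.+ (2 ℕ.+ 2 ℕ.* j)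
        expand j = solveℕ (j ∷ [])

    -- Division with remainder of `num + den`: the remainder is at most `den`, and cancelling `den`
    -- leaves the inequality of the ceiling.
    num≤ : num ℕ.≤ lam k ℕ.* suc den
    num≤ = ℕ.+-cancelʳ-≤ den num (lam k ℕ.* suc den) (ℕ.≤-trans (ℕ.≤-reflexive (ℕ.m≡m%n+[m/n]*n (num ℕ.+ den) (suc den)))
      (ℕ.≤-trans (ℕ.+-mono-≤ (ℕ.s≤s⁻¹ (ℕ.m%n<n (num ℕ.+ den) (suc den))) (ℕ.≤-reflexive (cong (ℕ._* suc den) (sym lam≡))))
        (ℕ.≤-reflexive (ℕ.+-comm den _))))

    jℤ : κ ≡ + 5 + + j
    jℤ = cong +_ k≡

    num≤ℤ : + 18 + + 10 * + j + + j * + j ≤ ℓ * (+ 3 + + 2 * + j)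
    num≤ℤ = subst₂ _≤_ (trans (cong (λ z → + (18 ℕ.+ 10 ℕ.* j) + z) (pos-* j j)) (cong (λ z → + 18 + z + + j * + j) (pos-* 10 j)))
      (trans (pos-* (lam k) (suc den)) (cong (λ z → ℓ * (+ 3 + z)) (pos-* 2 j))) (+≤+ num≤)

  κ≥5 : + 5 ≤ κ
  κ≥5 = +≤+ k≥5

  bound : κ * κ - + 7 ≤ (+ 2 * κ - + 7) * ℓ
  bound = subst (λ κ → κ * κ - + 7 ≤ (+ 2 * κ - + 7) * ℓ) (sym jℤ) (lem (+ j) ℓ num≤ℤ)
    where
    lem : ∀ j ℓ → + 18 + + 10 * j + j * j ≤ ℓ * (+ 3 + + 2 * j) → (+ 5 + j) * (+ 5 + j) - + 7 ≤ (+ 2 * (+ 5 + j) - + 7) * ℓ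
    lem j ℓ p = fit p (solve (j ∷ ℓ ∷ []))

  -- With λ at most 5 the right-hand side of `num≤ℤ` would be at most `15 + 10j`, below `18 + 10j`.
  ℓ≥6 : + 6 ≤ ℓ
  ℓ≥6 = stable λ q → clash 2 (lem (+ j) ℓ num≤ℤ (0≤+ j) (0≤* (0≤+ j) (0≤+ j)) (above q)) refl
    where
    lem : ∀ j ℓ → + 18 + + 10 * j + j * j ≤ ℓ * (+ 3 + + 2 * j) → 0ℤ ≤ j → 0ℤ ≤ j * j → ℓ + 1ℤ ≤ + 6 → + 3 ≤ 0ℤ
    lem j ℓ p q r s = fit (p ⊕ r ⊕ scale {c = + 3 + + 2 * j} (pos q) s) (solve (j ∷ ℓ ∷ []))
      where
      pos : 0ℤ ≤ j → 0ℤ ≤ + 3 + + 2 * j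
      pos q = fit (2 ⋆ q ⊕ 0≤+ 3) (solve (j ∷ []))

  open Potential κ ℓ κ≥5 ℓ≥6

  ρv-P : ∀ t → t ℕ.< k → ρv k t ≡ P (+ t)
  ρv-P t t<k = trans (go (view (+ t) small-t)) (sym (P-def (+ t)))
    where
    small-t : + t ≤ κ - 1ℤ
    small-t = lem (+ t) κ (+≤+ t<k)
      where
      lem : ∀ t κ → 1ℤ + t ≤ κ → t ≤ κ - 1ℤ
      lem t κ p = fit p (solve (t ∷ κ ∷ []))
    top-t : ∀ {t} → + t ≡ κ - 1ℤ → suc t ≡ k
    top-t {t} e = +-injective (trans (cong (λ z → 1ℤ + z) e) (lem κ))
      where
      lem : ∀ κ → 1ℤ + (κ - 1ℤ) ≡ κ
      lem κ = solve (κ ∷ [])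
    not-top : ∀ {t a} → + t ≤ κ - + suc (suc a) → suc t ≢ k
    not-top {t} {a} p refl = clash a p (lem (+ t) (+ suc a))
      where
      lem : ∀ t a → t ≡ 1ℤ + t - (1ℤ + a) + a
      lem t a = solve (t ∷ a ∷ [])
    low-top : + t ≤ 1ℤ → suc t ≢ k
    low-top p refl = clash 2 (p ⊕ κ≥5) (lem (+ t))
      where
      lem : ∀ t → t + + 5 ≡ 1ℤ + (1ℤ + t) + + 3
      lem t = solve (t ∷ [])
    value : ∀ z → + (t ℕ.* lam k) + z ≡ + t * ℓ + z
    value z = cong (_+ z) (pos-* t (lam k))
    big : + 2 ≤ + t → ¬ t ℕ.≤ 1
    big (+≤+ p) q = ℕ.<-irrefl refl (ℕ.≤-trans p q)
    go : ∀ {c b} → View (+ t) c b → ρv k t ≡ + t * ℓ + c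
    go (top q) = trans (ρv-top k (top-t q)) (value 1ℤ)
    go (sub q) = trans (ρv-mid k (not-top {a = 0} (≤-reflexive q)) (big (lem (+ t) κ q κ≥5))) (value -[1+ 0 ])
      where
      lem : ∀ t κ → t ≡ κ - + 2 → + 5 ≤ κ → + 2 ≤ t
      lem _ κ refl p = fit (p ⊕ 0≤+ 1) (solve (κ ∷ []))
    go (mid p q) = trans (ρv-mid k (not-top {a = 1} q) (big p)) (value -[1+ 0 ])
    go (one q) = trans (ρv-low k (low-top (≤-reflexive q)) (ℕ.≤-reflexive (+-injective q))) (value -[1+ 1 ])
    go (low q) = trans (ρv-low k (low-top (≤-trans q (0≤+ 1))) (drop‿+≤+ (≤-trans q (0≤+ 1)))) (value -[1+ 1 ])

  ρe-E : ∀ s → ρe k s ≡ + sgn s - (+ 2 * ℓ + 1ℤ) * + s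
  ρe-E zero = sym (lem ℓ)
    where
    lem : ∀ ℓ → 0ℤ - (+ 2 * ℓ + 1ℤ) * 0ℤ ≡ 0ℤ
    lem ℓ = solve (ℓ ∷ [])
  ρe-E (suc s) = cong (λ z → 1ℤ - (z + 1ℤ) * + suc s) (pos-* 2 (lam k))

  module _ (G : Multigraph) (h : Fin (n G) → Fin k) where
    open MultigraphGraph G
    open Weights graph

    hℤ : Fin (n G) → ℤ
    hℤ v = + toℕ (h v)

    ρ-rho : ρ k G h ≡ rho hℤ (λ _ → true)
    ρ-rho = sym (trans (rho-def hℤ (λ _ → true)) (trans (∑-+ (λ v → P (hℤ v)) (λ v → ∑ (F v))) (cong₂ _+_
      (trans (∑-cong λ v → sym (ρv-P (toℕ (h v)) (Fin.toℕ<n (h v)))) (sym (sumℤ-tabulate (n G) (λ v → ρv k (toℕ (h v))) (λ v → v))))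
      (trans (∑-cong λ v → trans (∑-cong λ w → cong (on (toℕ v ℕ.<ᵇ toℕ w)) (sym (ρe-E (mult G v w))))
          (sym (sumℤ-filter (λ y → toℕ v ℕ.<? toℕ y) (n G) (λ p → ρe k (mult G (proj₁ p) (proj₂ p))) (λ y → v , y) (λ y → y))))
        (trans (sym (sumℤ-tabulate (n G) (λ v → sumℤ (map (λ p → ρe k (mult G (proj₁ p) (proj₂ p))) (map (λ y → v , y) (filter (λ y → toℕ v ℕ.<? toℕ y) (allFin (n G)))))) (λ v → v)))
          (sym (sumℤ-concatMap (λ p → ρe k (mult G (proj₁ p) (proj₂ p))) (λ x → map (λ y → x , y) (filter (λ y → toℕ x ℕ.<? toℕ y) (allFin (n G)))) (allFin (n G)))))))))

    unexceptional : ¬ HasK k G → (k ≡ 5 → ¬ HasK24 G) → (k ≡ 5 → ¬ HasDoubleCycle G) → ∀ {X} → ¬ Exceptional X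
    unexceptional noK no24 noDC (clique W _ c adjacent) with enumerate k W c
    ... | f , inj , within = noK (f , inj , λ i j i≢j → ℕ.n≢0⇒n>0 (adjacent (within i) (within j) (i≢j ∘ inj)))
    unexceptional noK no24 noDC (heavy e {u} {w} _ _ p) = no24 (+-injective e) (u , w , drop‿+≤+ p)
    unexceptional noK no24 noDC (doubled e W _ ne nbrs) = noDC (+-injective e) (double-cycle W ne nbrs)

theorem6p1 : (k : ℕ) → 5 ℕ.≤ k →
    (G : Multigraph) → (h : Fin (n G) → Fin k) →
    ¬ HasK k G →
    ((k ≡ 5) → ¬ HasK24 G) →
    ((k ≡ 5) → ¬ HasDoubleCycle G) →
    (C : Cover G) → IsHCover h C → Minimal C →
    ρ k G h Data.Integer.≤ -[1+ 1 ]
theorem6p1 k k≥5 G h noK no24 noDC C hcover (uncol , minimal) =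
  subst (_≤ -[1+ 1 ]) (sym (ρ-rho G h))
    (Reduction.rho-minimal κ ℓ κ≥5 ℓ≥6 bound conflicts lists (hℤ G h)
      (λ v _ → ≤-trans (+≤+ (hcover v)) (lists-len v))
      (λ v → below (Fin.toℕ<n (h v)))
      (unexceptional G h noK no24 noDC)
      (uncol ∘ to-coloring)
      λ {Y} Y⊂ → from-coloring Y (minimal (induced Y) (inj₁ (proj₁ (proj₂ Y⊂) , proj₂ (proj₂ (proj₂ Y⊂))))))
  where
  open Parameters k≥5
  open MultigraphGraph G
  open CoverConflicts C
  below : ∀ {t} → t ℕ.< k → + t ≤ + k - 1ℤ
  below {t} p = lem (+ t) (+ k) (+≤+ p)
    where
    lem : ∀ t k → 1ℤ + t ≤ k → t ≤ k - 1ℤ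
    lem t k p = fit p (solve (t ∷ k ∷ []))
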